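{- For every odd integer $r\geq 3$ and every integer $s\geq 3$ there exists $\varepsilon=\varepsilon(s)>0$, depending only on $s$, such that for every positive integer $t$, $$\mathrm{ex}\big(n,K^{(r)}_{s,t}\big)=O_{r,s,t}\Big(n^{\,r-\frac{1}{s-1}-\varepsilon}\Big),$$ i.e. there is a constant $C=C(r,s,t)$ such that every $n$-vertex $r$-uniform hypergraph containing no copy of $K^{(r)}_{s,t}$ has at most $C\,n^{r-\frac{1}{s-1}-\varepsilon}$ edges.
   Context: For positive integers $r,s,t$, $K^{(r)}_{s,t}$ denotes the $r$-uniform hypergraph with vertex set $\left(\bigcup_{i\in[t]}X_i\right)\cup Y$ and edge set $\{X_i\cup\{y\}: i\in[t],\,y\in Y\}$, where $X_1,\dots,X_t$ are pairwise disjoint sets of size $r-1$ and $Y$ is a set of size $s$ disjoint from each $X_i$. For an $r$-uniform hypergraph $H$, $\mathrm{ex}(n,H)$ is the maximum number of edges in an $n$-vertex $r$-uniform hypergraph containing no copy of $H$ as a subgraph. -}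

module Defs where

open import Data.Nat using (ℕ; zero; suc; _+_; _*_; _∸_; _^_; _≤_)
open import Data.Bool using (Bool; true; false)
open import Data.Fin using (Fin)
open import Data.Fin.Subset using (Subset; ⁅_⁆; _∪_; ⋃; ∣_∣)
open import Data.List using (List; []; _∷_; map; _++_; length; filterᵇ)
open import Data.Vec using (_∷_; [])
open import Data.Product using (_×_; _,_)
open import Data.Sum using (_⊎_; inj₁; inj₂)
open import Relation.Binary.PropositionalEquality using (_≡_)

allSubsets : (n : ℕ) → List (Subset n)
allSubsets zero = [] ∷ []
allSubsets (suc n) = map (true ∷_) (allSubsets n) ++ map (false ∷_) (allSubsets n)

record Hypergraph (r n : ℕ) : Set where
  field
    isEdge  : Subset n → Bool
    uniform : ∀ e → isEdge e ≡ true → ∣ e ∣ ≡ r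
open Hypergraph public

edgeCount : ∀ {r n} → Hypergraph r n → ℕ
edgeCount {r} {n} H = length (filterᵇ (isEdge H) (allSubsets n))

-- Vertices of K^{(r)}_{s,t}: X_i = {i} × Fin (r-1) for i : Fin t, and Y = Fin s.
KVertex : (r s t : ℕ) → Set
KVertex r s t = (Fin t × Fin (r ∸ 1)) ⊎ Fin s

allFinL : (k : ℕ) → List (Fin k)
allFinL zero = []
allFinL (suc k) = Fin.zero ∷ map Fin.suc (allFinL k)

-- image under f of the edge X_i ∪ {y} of K^{(r)}_{s,t}
imageEdge : ∀ {r s t n} → (KVertex r s t → Fin n) → Fin t → Fin s → Subset n
imageEdge {r} f i y = ⁅ f (inj₂ y) ⁆ ∪ ⋃ (map (λ j → ⁅ f (inj₁ (i , j)) ⁆) (allFinL (r ∸ 1)))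

record ContainsK {r n : ℕ} (s t : ℕ) (H : Hypergraph r n) : Set where
  field
    emb       : KVertex r s t → Fin n
    injective : ∀ u v → emb u ≡ emb v → u ≡ v
    edges     : ∀ i y → isEdge H (imageEdge {r} {s} {t} emb i y) ≡ true

{-# OPTIONS --safe #-}
module Submission where

-- Fix s and write m = s − 1.  In a K_{s,t}-free hypergraph the common link of any s distinct vertices
-- has no matching of size t, hence a vertex cover of bounded size.  Counting pairs (S , X) with X in the
-- common link of S, this forces, for all but few pairs, a dichotomy: replacing one particular vertex of X
-- leaves at most boundedly many members of the link ("poor" direction), while replacing any other
-- vertex leaves nearly as many as the codegree allows ("rich" directions).
--
-- For an edge e and two of its positions i, v consider the link graph of the other r − 2 vertices, and
-- the ball of all vertices having large codegree with e_i there.  Typically there is exactly one v for which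
-- the ball meets the neighbourhood of e_v in a small proportion: two such v would give too many
-- S that are not rich in two directions, and if there were none, S could be chosen inside all
-- balls, where poor sets are extremely rare (a poor set is counted by boundedly many vertices
-- only), so that S would have no poor direction.  Counting the edges between the neighbourhoods of e_i
-- and e_v shows that the relation is symmetric, so a single typical edge carries a fixed-point-free
-- involution of its r positions and r is even.  All losses are powers of Q = n^(m−1) / D^m, where D is
-- the average codegree; the argument works as soon as D exceeds a constant times Q^(9m).

open import Defs
open import Data.Nat
open import Data.Nat.DivMod using (m/n*n≤m; m%n<n; m≡m%n+[m/n]*n; m<n⇒m/n≡0; m*n%n≡0)
open import Data.Nat.ListAction using (sum)
open import Data.Nat.Properties
open import Data.Nat.Tactic.RingSolver using (solve-∀)
open import Data.Bool as Bool using (Bool; true; false; if_then_else_)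
import Data.Bool.Properties as Bool
open import Data.Empty using (⊥-elim)
open import Data.Fin using (Fin; zero; suc; toℕ; punchIn; punchOut)
import Data.Fin.Properties as Fin
open import Data.Fin.Subset using (Subset; ⁅_⁆; _∪_; ⋃; ∣_∣; ⊥; _⊆_) renaming (_∈_ to _∈ˢ_)
open import Data.Fin.Subset.Properties using (∉⊥; ∣⊥∣≡0; x∈⁅x⁆; x∈⁅y⁆⇒x≡y; ∣⁅x⁆∣≡1; ⊆-antisym; p⊆q⇒∣p∣≤∣q∣; x∈p∪q⁻; x∈p∪q⁺; ∪-identityˡ)
open import Data.List using (List; []; _∷_; map; _++_; length; allFin; cartesianProductWith; filterᵇ)
open import Data.List.Membership.Propositional using (_∈_; lose)
open import Data.List.Membership.Propositional.Properties using (∈-allFin; ∈-cartesianProductWith⁺; ∈-map⁺; ∈-++⁺ˡ; ∈-++⁺ʳ)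
open import Data.List.Properties using (length-tabulate; map-tabulate; length-++)
open import Data.List.Relation.Unary.Any using (here; there; any?; satisfied)
open import Data.Product using (Σ; ∃; _×_; _,_; proj₁; proj₂)
open import Data.Sum using (_⊎_; inj₁; inj₂)
open import Data.Vec as Vec using (Vec; []; _∷_; lookup; _[_]≔_; toList)
open import Data.Vec.Membership.Propositional.Properties using (∈-lookup; ∈-toList⁺)
open import Data.Vec.Properties using ([]≔-idempotent; []≔-commutes; []≔-lookup; lookup∘update; lookup∘update′; ≡-dec; length-toList)
open import Data.Vec.Relation.Unary.All as All using (All; []; _∷_)
open import Data.Vec.Relation.Unary.All.Properties using (lookup⁺)
open import Function using (_∘_; id; case_of_)
open import Relation.Binary.Definitions using (tri<; tri≈; tri>)
open import Relation.Binary.PropositionalEquality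
open import Relation.Nullary using (¬_; Dec; yes; no; does)
open import Relation.Nullary.Decidable using (decidable-stable; _→-dec_; _×-dec_; ¬?)

-- Finite sums and indicators

-- The value `Q = 1` corresponds to about n^(r - 1/(s-1)) edges, so `Q` measures how far the
-- hypergraph lies below that benchmark. An argument that loses only a power of `Q` whose exponent
-- depends on `m` alone therefore gives a positive ε: eliminate `Q` between D ≤ C Q^(9m) and Q D^m ≈
-- n^(m-1). The parameters r and t enter only the constant C, so ε depends on s alone. Two obstacles
-- shape the details. Codegrees may far exceed their average, while the ball and crossing estimates
-- need an upper bound on them; a dyadic count first discards the edges with a codegree above Q D.
-- And passing from e_i to e_v loses something in the threshold of the ball: sparsity of a large
-- ball around e_i gives sparsity only of a smaller ball around e_v. Hence the partner of a position
-- is found with large balls, but its uniqueness is needed, and proved, for small ones.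

private variable
  A B : Set

∑ : List A → (A → ℕ) → ℕ
∑ xs f = sum (map f xs)

∑-mono : (xs : List A) {f g : A → ℕ} → (∀ x → f x ≤ g x) → ∑ xs f ≤ ∑ xs g
∑-mono [] h = z≤n
∑-mono (x ∷ xs) h = +-mono-≤ (h x) (∑-mono xs h)

∑-cong : (xs : List A) {f g : A → ℕ} → (∀ x → f x ≡ g x) → ∑ xs f ≡ ∑ xs g
∑-cong [] h = refl
∑-cong (x ∷ xs) h = cong₂ _+_ (h x) (∑-cong xs h)

∑-const : (xs : List A) (k : ℕ) → ∑ xs (λ _ → k) ≡ length xs * k
∑-const [] k = refl
∑-const (x ∷ xs) k = cong (k +_) (∑-const xs k)

∑-bound : (xs : List A) {f : A → ℕ} (k : ℕ) → (∀ x → f x ≤ k) → ∑ xs f ≤ length xs * k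
∑-bound xs k h = ≤-trans (∑-mono xs h) (≤-reflexive (∑-const xs k))

∑-+ : (xs : List A) (f g : A → ℕ) → ∑ xs (λ x → f x + g x) ≡ ∑ xs f + ∑ xs g
∑-+ [] f g = refl
∑-+ (x ∷ xs) f g = trans (cong (f x + g x +_) (∑-+ xs f g)) (lemma (f x) (g x) (∑ xs f) (∑ xs g))
  where
  lemma : ∀ a b c d → a + b + (c + d) ≡ a + c + (b + d)
  lemma = solve-∀

∑-*ˡ : (xs : List A) (k : ℕ) (f : A → ℕ) → ∑ xs (λ x → k * f x) ≡ k * ∑ xs f
∑-*ˡ [] k f = sym (*-zeroʳ k)
∑-*ˡ (x ∷ xs) k f = trans (cong (k * f x +_) (∑-*ˡ xs k f)) (sym (*-distribˡ-+ k (f x) (∑ xs f)))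

∑-*ʳ : (xs : List A) (k : ℕ) (f : A → ℕ) → ∑ xs (λ x → f x * k) ≡ ∑ xs f * k
∑-*ʳ xs k f = trans (∑-cong xs (λ x → *-comm (f x) k)) (trans (∑-*ˡ xs k f) (*-comm k _))

∑-swap : (xs : List A) (ys : List B) (f : A → B → ℕ) →
  ∑ xs (λ x → ∑ ys (f x)) ≡ ∑ ys (λ y → ∑ xs (λ x → f x y))
∑-swap [] ys f = sym (trans (∑-const ys 0) (*-zeroʳ (length ys)))
∑-swap (x ∷ xs) ys f =
  trans (cong (∑ ys (f x) +_) (∑-swap xs ys f)) (sym (∑-+ ys (f x) (λ y → ∑ xs (λ x → f x y))))

∑-term : {xs : List A} {x : A} (f : A → ℕ) → x ∈ xs → f x ≤ ∑ xs f
∑-term f (here refl) = m≤m+n _ _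
∑-term {xs = y ∷ xs} f (there p) = ≤-trans (∑-term f p) (m≤n+m _ (f y))

∑-++ : (xs ys : List A) (f : A → ℕ) → ∑ (xs ++ ys) f ≡ ∑ xs f + ∑ ys f
∑-++ [] ys f = refl
∑-++ (x ∷ xs) ys f = trans (cong (f x +_) (∑-++ xs ys f)) (sym (+-assoc (f x) _ _))

∑-map : (h : A → B) (xs : List A) (f : B → ℕ) → ∑ (map h xs) f ≡ ∑ xs (f ∘ h)
∑-map h [] f = refl
∑-map h (x ∷ xs) f = cong (f (h x) +_) (∑-map h xs f)

∑-<⇒∃ : (xs : List A) (f g : A → ℕ) → ∑ xs f < ∑ xs g → ∃ λ x → f x < g x
∑-<⇒∃ (x ∷ xs) f g h with f x <? g x
... | yes p = x , p
... | no ¬p = ∑-<⇒∃ xs f g (+-cancelˡ-< (g x) _ _ (≤-<-trans (+-monoˡ-≤ (∑ xs f) (≮⇒≥ ¬p)) h))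

⟦_⟧ : Dec A → ℕ
⟦ d ⟧ = if does d then 1 else 0

⟦⟧≤1 : (d : Dec A) → ⟦ d ⟧ ≤ 1
⟦⟧≤1 (yes _) = ≤-refl
⟦⟧≤1 (no _) = z≤n

⟦⟧-≤ : (d : Dec A) {k : ℕ} → (A → 1 ≤ k) → ⟦ d ⟧ ≤ k
⟦⟧-≤ (yes p) h = h p
⟦⟧-≤ (no _) h = z≤n

*⟦⟧-≤ : (d : Dec A) {k b : ℕ} → (A → k ≤ b) → k * ⟦ d ⟧ ≤ b
*⟦⟧-≤ (yes p) {k} h = ≤-trans (≤-reflexive (*-identityʳ k)) (h p)
*⟦⟧-≤ (no _) {k} h = ≤-trans (≤-reflexive (*-zeroʳ k)) z≤n

⟦⟧-cases : (d : Dec A) → ⟦ d ⟧ ≡ 0 ⊎ A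
⟦⟧-cases (yes p) = inj₂ p
⟦⟧-cases (no _) = inj₁ refl

⟦⟧-true : (d : Dec A) → A → ⟦ d ⟧ ≡ 1
⟦⟧-true (yes _) p = refl
⟦⟧-true (no ¬p) p = ⊥-elim (¬p p)

⟦⟧-false : (d : Dec A) → ¬ A → ⟦ d ⟧ ≡ 0
⟦⟧-false (yes p) ¬p = ⊥-elim (¬p p)
⟦⟧-false (no _) ¬p = refl

⟦⟧-pos : (d : Dec A) → 0 < ⟦ d ⟧ → A
⟦⟧-pos (yes p) _ = p

⟦⟧-mono : (d : Dec A) (d' : Dec B) → (A → B) → ⟦ d ⟧ ≤ ⟦ d' ⟧
⟦⟧-mono d d' h = ⟦⟧-≤ d (λ p → ≤-reflexive (sym (⟦⟧-true d' (h p))))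

⟦⟧-cong : (d : Dec A) (d' : Dec B) → (A → B) → (B → A) → ⟦ d ⟧ ≡ ⟦ d' ⟧
⟦⟧-cong d d' h h' = ≤-antisym (⟦⟧-mono d d' h) (⟦⟧-mono d' d h')

⟦⟧-× : (d : Dec A) (d' : Dec B) → ⟦ d ×-dec d' ⟧ ≡ ⟦ d ⟧ * ⟦ d' ⟧
⟦⟧-× (yes _) d' = sym (*-identityˡ ⟦ d' ⟧)
⟦⟧-× (no _) d' = refl

⟦⟧-∪ : {C : Set} (d : Dec A) (d₁ : Dec B) (d₂ : Dec C) → (A → B ⊎ C) → ⟦ d ⟧ ≤ ⟦ d₁ ⟧ + ⟦ d₂ ⟧
⟦⟧-∪ d d₁ d₂ h = ⟦⟧-≤ d λ p → case h p of λ where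
  (inj₁ q) → ≤-trans (≤-reflexive (sym (⟦⟧-true d₁ q))) (m≤m+n _ _)
  (inj₂ q) → ≤-trans (≤-reflexive (sym (⟦⟧-true d₂ q))) (m≤n+m _ ⟦ d₁ ⟧)

∑-allFin-suc : ∀ {n} (f : Fin (suc n) → ℕ) →
  ∑ (allFin (suc n)) f ≡ f zero + ∑ (allFin n) (f ∘ suc)
∑-allFin-suc {n} f = cong (f zero +_)
  (trans (cong (λ xs → ∑ xs f) (sym (map-tabulate {n = n} id suc))) (∑-map suc (allFin n) f))

∑-allFin-≡ : ∀ {n} (z : Fin n) → ∑ (allFin n) (λ y → ⟦ y Fin.≟ z ⟧) ≡ 1
∑-allFin-≡ {suc n} zero = trans (∑-allFin-suc {n} (λ y → ⟦ y Fin.≟ zero ⟧))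
  (cong suc (trans (∑-const (allFin n) 0) (*-zeroʳ (length (allFin n)))))
∑-allFin-≡ {suc n} (suc z) = trans (∑-allFin-suc {n} (λ y → ⟦ y Fin.≟ suc z ⟧))
  (trans (∑-cong (allFin n) (λ y → ⟦⟧-cong (suc y Fin.≟ suc z) (y Fin.≟ z) Fin.suc-injective (cong suc)))
    (∑-allFin-≡ z))

length-allFin : ∀ n → length (allFin n) ≡ n
length-allFin n = length-tabulate id

_∈?_ : ∀ {n} (x : Fin n) (xs : List (Fin n)) → Dec (x ∈ xs)
x ∈? xs = any? (x Fin.≟_) xs

count-∈-≤-length : ∀ {n} (zs : List (Fin n)) → ∑ (allFin n) (λ y → ⟦ y ∈? zs ⟧) ≤ length zs
count-∈-≤-length {n} [] = ≤-reflexive (trans (∑-const (allFin n) 0) (*-zeroʳ (length (allFin n))))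
count-∈-≤-length {n} (z ∷ zs) = begin
  ∑ (allFin n) (λ y → ⟦ y ∈? (z ∷ zs) ⟧)
    ≤⟨ ∑-mono (allFin n) (λ y → ⟦⟧-∪ (y ∈? (z ∷ zs)) (y Fin.≟ z) (y ∈? zs)
         λ where (here p) → inj₁ p ; (there p) → inj₂ p) ⟩
  ∑ (allFin n) (λ y → ⟦ y Fin.≟ z ⟧ + ⟦ y ∈? zs ⟧)
    ≡⟨ ∑-+ (allFin n) (λ y → ⟦ y Fin.≟ z ⟧) (λ y → ⟦ y ∈? zs ⟧) ⟩
  ∑ (allFin n) (λ y → ⟦ y Fin.≟ z ⟧) + ∑ (allFin n) (λ y → ⟦ y ∈? zs ⟧)
    ≤⟨ +-mono-≤ (≤-reflexive (∑-allFin-≡ z)) (count-∈-≤-length zs) ⟩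
  suc (length zs) ∎
  where open ≤-Reasoning

-- Tuples: sums along lines and planes, powers of a set, repeated entries

tuples : ∀ n r → List (Vec (Fin n) r)
tuples n zero = [] ∷ []
tuples n (suc r) = cartesianProductWith _∷_ (allFin n) (tuples n r)

∑-cartesianProductWith : {C : Set} (h : A → B → C) (xs : List A) (ys : List B) (f : C → ℕ) →
  ∑ (cartesianProductWith h xs ys) f ≡ ∑ xs (λ x → ∑ ys (λ y → f (h x y)))
∑-cartesianProductWith h [] ys f = refl
∑-cartesianProductWith h (x ∷ xs) ys f =
  trans (∑-++ (map (h x) ys) _ f) (cong₂ _+_ (∑-map (h x) ys f) (∑-cartesianProductWith h xs ys f))

∑-tuples-suc : ∀ n r (f : Vec (Fin n) (suc r) → ℕ) →
  ∑ (tuples n (suc r)) f ≡ ∑ (allFin n) (λ x → ∑ (tuples n r) (λ e → f (x ∷ e)))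
∑-tuples-suc n r f = ∑-cartesianProductWith _∷_ (allFin n) (tuples n r) f

length-tuples : ∀ n r → length (tuples n r) ≡ n ^ r
length-tuples n zero = refl
length-tuples n (suc r) = trans (length-∑ (tuples n (suc r))) (trans (∑-tuples-suc n r (λ _ → 1))
  (trans (∑-cong (allFin n) (λ _ → trans (sym (length-∑ (tuples n r))) (length-tuples n r)))
    (trans (∑-const (allFin n) (n ^ r)) (cong (_* n ^ r) (length-allFin n)))))
  where
  length-∑ : (xs : List A) → length xs ≡ ∑ xs (λ _ → 1)
  length-∑ xs = sym (trans (∑-const xs 1) (*-identityʳ (length xs)))

-- The map from `(e , y)` to `e [ i ]≔ y` is `n`-to-one, since the overwritten entry is free.
-- Averaging over lines in this way replaces the passage to (r - 1)-tuples.
∑-update : ∀ n r (i : Fin r) (f : Vec (Fin n) r → ℕ) →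
  ∑ (tuples n r) (λ e → ∑ (allFin n) (λ y → f (e [ i ]≔ y))) ≡ n * ∑ (tuples n r) f
∑-update n (suc r) zero f = begin
  ∑ (tuples n (suc r)) (λ e → ∑ (allFin n) (λ y → f (e [ zero ]≔ y)))
    ≡⟨ ∑-tuples-suc n r (λ e → ∑ (allFin n) (λ y → f (e [ zero ]≔ y))) ⟩
  ∑ (allFin n) (λ x → ∑ (tuples n r) (λ e → ∑ (allFin n) (λ y → f (y ∷ e))))
    ≡⟨ ∑-const (allFin n) _ ⟩
  length (allFin n) * ∑ (tuples n r) (λ e → ∑ (allFin n) (λ y → f (y ∷ e)))
    ≡⟨ cong₂ _*_ (length-allFin n) (∑-swap (tuples n r) (allFin n) (λ e y → f (y ∷ e))) ⟩
  n * ∑ (allFin n) (λ y → ∑ (tuples n r) (λ e → f (y ∷ e)))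
    ≡⟨ cong (n *_) (∑-tuples-suc n r f) ⟨
  n * ∑ (tuples n (suc r)) f ∎
  where open ≡-Reasoning
∑-update n (suc r) (suc i) f = begin
  ∑ (tuples n (suc r)) (λ e → ∑ (allFin n) (λ y → f (e [ suc i ]≔ y)))
    ≡⟨ ∑-tuples-suc n r (λ e → ∑ (allFin n) (λ y → f (e [ suc i ]≔ y))) ⟩
  ∑ (allFin n) (λ x → ∑ (tuples n r) (λ e → ∑ (allFin n) (λ y → f (x ∷ (e [ i ]≔ y)))))
    ≡⟨ ∑-cong (allFin n) (λ x → ∑-update n r i (λ e → f (x ∷ e))) ⟩
  ∑ (allFin n) (λ x → n * ∑ (tuples n r) (λ e → f (x ∷ e)))
    ≡⟨ ∑-*ˡ (allFin n) n _ ⟩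
  n * ∑ (allFin n) (λ x → ∑ (tuples n r) (λ e → f (x ∷ e)))
    ≡⟨ cong (n *_) (∑-tuples-suc n r f) ⟨
  n * ∑ (tuples n (suc r)) f ∎
  where open ≡-Reasoning

line-bound : ∀ n r (i : Fin r) (f : Vec (Fin n) r → ℕ) (B : ℕ) →
  (∀ e → ∑ (allFin n) (λ y → f (e [ i ]≔ y)) ≤ B) →
  n * ∑ (tuples n r) f ≤ n ^ r * B
line-bound n r i f B h = begin
  n * ∑ (tuples n r) f                                            ≡⟨ ∑-update n r i f ⟨
  ∑ (tuples n r) (λ e → ∑ (allFin n) (λ y → f (e [ i ]≔ y)))      ≤⟨ ∑-bound (tuples n r) B h ⟩
  length (tuples n r) * B                                         ≡⟨ cong (_* B) (length-tuples n r) ⟩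
  n ^ r * B ∎
  where open ≤-Reasoning

plane-bound : ∀ n r (j l : Fin r) (f : Vec (Fin n) r → ℕ) (B : ℕ) →
  (∀ e → ∑ (allFin n) (λ y → ∑ (allFin n) (λ z → f ((e [ j ]≔ y) [ l ]≔ z))) ≤ B) →
  n * (n * ∑ (tuples n r) f) ≤ n ^ r * B
plane-bound n r j l f B h = begin
  n * (n * ∑ (tuples n r) f)                                      ≡⟨ cong (n *_) (∑-update n r l f) ⟨
  n * ∑ (tuples n r) (λ e → ∑ (allFin n) (λ z → f (e [ l ]≔ z)))  ≤⟨ line-bound n r j _ B h ⟩
  n ^ r * B ∎
  where open ≤-Reasoning

module _ {n : ℕ} {A : Fin n → Set} (A? : ∀ y → Dec (A y)) where

  ⟦all⟧-∷ : ∀ {m} y (T : Vec (Fin n) m) → ⟦ All.all? A? (y ∷ T) ⟧ ≡ ⟦ A? y ⟧ * ⟦ All.all? A? T ⟧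
  ⟦all⟧-∷ y T = trans
    (⟦⟧-cong (All.all? A? (y ∷ T)) (A? y ×-dec All.all? A? T) (λ where (p ∷ q) → p , q) (λ where (p , q) → p ∷ q))
    (⟦⟧-× (A? y) (All.all? A? T))

  card : ℕ
  card = ∑ (allFin n) (λ y → ⟦ A? y ⟧)

  ∑-tuples-all : ∀ m → ∑ (tuples n m) (λ T → ⟦ All.all? A? T ⟧) ≡ card ^ m
  ∑-tuples-all zero = refl
  ∑-tuples-all (suc m) = begin
    ∑ (tuples n (suc m)) (λ T → ⟦ All.all? A? T ⟧)
      ≡⟨ ∑-tuples-suc n m _ ⟩
    ∑ (allFin n) (λ y → ∑ (tuples n m) (λ T → ⟦ All.all? A? (y ∷ T) ⟧))
      ≡⟨ ∑-cong (allFin n) (λ y → trans (∑-cong (tuples n m) (⟦all⟧-∷ y)) (∑-*ˡ (tuples n m) ⟦ A? y ⟧ _)) ⟩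
    ∑ (allFin n) (λ y → ⟦ A? y ⟧ * ∑ (tuples n m) (λ T → ⟦ All.all? A? T ⟧))
      ≡⟨ ∑-*ʳ (allFin n) _ _ ⟩
    card * ∑ (tuples n m) (λ T → ⟦ All.all? A? T ⟧)
      ≡⟨ cong (card *_) (∑-tuples-all m) ⟩
    card ^ suc m ∎
    where open ≡-Reasoning

-- `L` collects the entries already seen. Thus `Repeats [] S` says that `S` is not injective, and
-- for `S = x ∷ T` this amounts to `Repeats (x ∷ []) T`.
data Repeats {n : ℕ} (L : List (Fin n)) : ∀ {m} → Vec (Fin n) m → Set where
  hit   : ∀ {m y} {T : Vec (Fin n) m} → y ∈ L → Repeats L (y ∷ T)
  later : ∀ {m y} {T : Vec (Fin n) m} → Repeats (y ∷ L) T → Repeats L (y ∷ T)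

repeats? : ∀ {n m} (L : List (Fin n)) (T : Vec (Fin n) m) → Dec (Repeats L T)
repeats? L [] = no λ ()
repeats? L (y ∷ T) with y ∈? L | repeats? (y ∷ L) T
... | yes p | _ = yes (hit p)
... | no _ | yes q = yes (later q)
... | no ¬p | no ¬q = no λ where
  (hit p) → ¬p p
  (later q) → ¬q q

-- Union bound: each of the `m` positions has at most `length L + m` forbidden values, and fixing an
-- entry to one of them costs a factor `card A?`.
repeats-count : ∀ {n} {A : Fin n → Set} (A? : ∀ y → Dec (A y)) m (L : List (Fin n)) →
  card A? * ∑ (tuples n m) (λ T → ⟦ All.all? A? T ⟧ * ⟦ repeats? L T ⟧) ≤ m * (length L + m) * card A? ^ m
repeats-count A? zero L = ≤-reflexive (*-zeroʳ (card A?))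
repeats-count {n} {A} A? (suc m) L = begin
  a * ∑ (tuples n (suc m)) (λ T → ⟦ All.all? A? T ⟧ * ⟦ repeats? L T ⟧)
    ≡⟨ cong (a *_) (∑-tuples-suc n m _) ⟩
  a * ∑ (allFin n) (λ y → ∑ (tuples n m) (λ T → ⟦ All.all? A? (y ∷ T) ⟧ * ⟦ repeats? L (y ∷ T) ⟧))
    ≤⟨ *-monoʳ-≤ a (∑-mono (allFin n) λ y → ≤-trans (∑-mono (tuples n m) (λ T → split y T)) (≤-reflexive (total y))) ⟩
  a * ∑ (allFin n) (λ y → ⟦ y ∈? L ⟧ * a ^ m + ⟦ A? y ⟧ * X y)
    ≡⟨ cong (a *_) (trans (∑-+ (allFin n) _ _) (cong₂ _+_ (∑-*ʳ (allFin n) (a ^ m) _) refl)) ⟩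
  a * (∑ (allFin n) (λ y → ⟦ y ∈? L ⟧) * a ^ m + ∑ (allFin n) (λ y → ⟦ A? y ⟧ * X y))
    ≡⟨ *-distribˡ-+ a _ _ ⟩
  a * (∑ (allFin n) (λ y → ⟦ y ∈? L ⟧) * a ^ m) + a * ∑ (allFin n) (λ y → ⟦ A? y ⟧ * X y)
    ≤⟨ +-mono-≤ (*-monoʳ-≤ a (*-monoˡ-≤ (a ^ m) (count-∈-≤-length L))) rest ⟩
  a * (l * a ^ m) + a * (m * (suc l + m) * a ^ m)
    ≤⟨ m≤m+n _ (a * a ^ m * suc m) ⟩
  a * (l * a ^ m) + a * (m * (suc l + m) * a ^ m) + a * a ^ m * suc m
    ≡⟨ arith a (a ^ m) l m ⟩
  suc m * (l + suc m) * a ^ suc m ∎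
  where
  open ≤-Reasoning
  a = card A?
  l = length L
  X : Fin n → ℕ
  X y = ∑ (tuples n m) (λ T → ⟦ All.all? A? T ⟧ * ⟦ repeats? (y ∷ L) T ⟧)
  arith : ∀ a p l m → a * (l * p) + a * (m * (suc l + m) * p) + a * p * suc m ≡ suc m * (l + suc m) * (a * p)
  arith = solve-∀
  split : ∀ y (T : Vec (Fin n) m) → ⟦ All.all? A? (y ∷ T) ⟧ * ⟦ repeats? L (y ∷ T) ⟧ ≤
    ⟦ y ∈? L ⟧ * ⟦ All.all? A? T ⟧ + ⟦ A? y ⟧ * (⟦ All.all? A? T ⟧ * ⟦ repeats? (y ∷ L) T ⟧)
  split y T = begin
    ⟦ All.all? A? (y ∷ T) ⟧ * ⟦ repeats? L (y ∷ T) ⟧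
      ≤⟨ *-mono-≤ (≤-reflexive (⟦all⟧-∷ A? y T)) (⟦⟧-∪ (repeats? L (y ∷ T)) (y ∈? L) (repeats? (y ∷ L) T)
           λ where (hit p) → inj₁ p ; (later q) → inj₂ q) ⟩
    ⟦ A? y ⟧ * ⟦ All.all? A? T ⟧ * (⟦ y ∈? L ⟧ + ⟦ repeats? (y ∷ L) T ⟧)
      ≡⟨ distr ⟦ A? y ⟧ ⟦ All.all? A? T ⟧ ⟦ y ∈? L ⟧ ⟦ repeats? (y ∷ L) T ⟧ ⟩
    ⟦ A? y ⟧ * (⟦ y ∈? L ⟧ * ⟦ All.all? A? T ⟧) + ⟦ A? y ⟧ * (⟦ All.all? A? T ⟧ * ⟦ repeats? (y ∷ L) T ⟧)
      ≤⟨ +-monoˡ-≤ _ (≤-trans (*-monoˡ-≤ _ (⟦⟧≤1 (A? y))) (≤-reflexive (*-identityˡ _))) ⟩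
    ⟦ y ∈? L ⟧ * ⟦ All.all? A? T ⟧ + ⟦ A? y ⟧ * (⟦ All.all? A? T ⟧ * ⟦ repeats? (y ∷ L) T ⟧) ∎
    where
    distr : ∀ a b c d → a * b * (c + d) ≡ a * (c * b) + a * (b * d)
    distr = solve-∀
  total : ∀ y → ∑ (tuples n m) (λ T → ⟦ y ∈? L ⟧ * ⟦ All.all? A? T ⟧ + ⟦ A? y ⟧ * (⟦ All.all? A? T ⟧ * ⟦ repeats? (y ∷ L) T ⟧))
    ≡ ⟦ y ∈? L ⟧ * a ^ m + ⟦ A? y ⟧ * X y
  total y = trans (∑-+ (tuples n m) _ _) (cong₂ _+_
    (trans (∑-*ˡ (tuples n m) ⟦ y ∈? L ⟧ _) (cong (⟦ y ∈? L ⟧ *_) (∑-tuples-all A? m)))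
    (∑-*ˡ (tuples n m) ⟦ A? y ⟧ _))
  rest : a * ∑ (allFin n) (λ y → ⟦ A? y ⟧ * X y) ≤ a * (m * (suc l + m) * a ^ m)
  rest = begin
    a * ∑ (allFin n) (λ y → ⟦ A? y ⟧ * X y)
      ≡⟨ ∑-*ˡ (allFin n) a _ ⟨
    ∑ (allFin n) (λ y → a * (⟦ A? y ⟧ * X y))
      ≤⟨ ∑-mono (allFin n) (λ y → ≤-trans (≤-reflexive (exch a ⟦ A? y ⟧ (X y)))
           (*-monoʳ-≤ ⟦ A? y ⟧ (repeats-count A? m (y ∷ L)))) ⟩
    ∑ (allFin n) (λ y → ⟦ A? y ⟧ * (m * (suc l + m) * a ^ m))
      ≡⟨ ∑-*ʳ (allFin n) _ _ ⟩
    a * (m * (suc l + m) * a ^ m) ∎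
    where
    exch : ∀ a b c → a * (b * c) ≡ b * (a * c)
    exch = solve-∀

^-distribʳ-* : ∀ k x y → (x * y) ^ k ≡ x ^ k * y ^ k
^-distribʳ-* zero x y = refl
^-distribʳ-* (suc k) x y = trans (cong (x * y *_) (^-distribʳ-* k x y)) (exch x y (x ^ k) (y ^ k))
  where
  exch : ∀ x y a b → x * y * (a * b) ≡ x * a * (y * b)
  exch = solve-∀

∑-union : {A B : Set} (xs : List A) (ys : List B) (f : A → B → ℕ) (k K : ℕ) →
  (∀ x → k * ∑ ys (f x) ≤ K) → k * ∑ ys (λ y → ∑ xs (λ x → f x y)) ≤ length xs * K
∑-union xs ys f k K h = begin
  k * ∑ ys (λ y → ∑ xs (λ x → f x y)) ≡⟨ cong (k *_) (∑-swap xs ys f) ⟨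
  k * ∑ xs (λ x → ∑ ys (f x))         ≡⟨ ∑-*ˡ xs k _ ⟨
  ∑ xs (λ x → k * ∑ ys (f x))         ≤⟨ ∑-bound xs K h ⟩
  length xs * K ∎
  where open ≤-Reasoning

∑-zero : {A : Set} (xs : List A) {f : A → ℕ} → (∀ x → f x ≡ 0) → ∑ xs f ≡ 0
∑-zero xs h = trans (∑-cong xs h) (trans (∑-const xs 0) (*-zeroʳ (length xs)))

card-mono : ∀ {n} {A B : Fin n → Set} (A? : ∀ y → Dec (A y)) (B? : ∀ y → Dec (B y)) →
  (∀ y → A y → B y) → card A? ≤ card B?
card-mono {n} A? B? h = ∑-mono (allFin n) (λ y → ⟦⟧-mono (A? y) (B? y) (h y))

-- Counting with covers

-- In each application S = e_i ∷ T, so the cover Z i (e_i ∷ T) is constant on the plane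
-- obtained from e by varying the coordinates j and l.
module CoverCount {n r m c : ℕ} (Z : Fin r → Vec (Fin n) (suc m) → List (Fin n))
  (Z≤c : ∀ i S → length (Z i S) ≤ c) where

  Dominated : Fin r → (Vec (Fin n) r → Vec (Fin n) m → ℕ) →
    (Fin r → Vec (Fin n) r → Vec (Fin n) m → ℕ) → Set
  Dominated i F G = ∀ e T → F e T ≡ 0 ⊎ ∃ λ j → ∃ λ l →
    (j ≢ i × l ≢ i × j ≢ l × lookup e j ∈ Z i (lookup e i ∷ T)) × F e T ≤ G l e T

  -- Fix `T`, `j` and `l`. On a plane in the directions `j` and `l` the cover leaves at most `c`
  -- values for coordinate `j`, and each remaining line in direction `l` carries at most `B`. The
  -- factors `r` pay for the choice of `j` and `l`.
  cover-count : ∀ i F G B →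
    (∀ l → l ≢ i → ∀ e T → ∑ (allFin n) (λ z → G l (e [ l ]≔ z) T) ≤ B) →
    Dominated i F G →
    n * n * ∑ (tuples n r) (λ e → ∑ (tuples n m) (F e)) ≤ n ^ m * (r * (r * (n ^ r * (c * B))))
  cover-count i F G B line dom = begin
    n * n * ∑ (tuples n r) (λ e → ∑ (tuples n m) (F e))
      ≤⟨ ∑-union (tuples n m) (tuples n r) (λ T e → F e T) (n * n) _ perTuple ⟩
    length (tuples n m) * (r * (r * (n ^ r * (c * B))))
      ≡⟨ cong (_* (r * (r * (n ^ r * (c * B))))) (length-tuples n m) ⟩
    n ^ m * (r * (r * (n ^ r * (c * B)))) ∎
    where
    open ≤-Reasoning
    Cond : Fin r → Fin r → Vec (Fin n) r → Vec (Fin n) m → Set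
    Cond j l e T = j ≢ i × l ≢ i × j ≢ l × lookup e j ∈ Z i (lookup e i ∷ T)
    cond? : ∀ j l e T → Dec (Cond j l e T)
    cond? j l e T = ¬? (j Fin.≟ i) ×-dec ¬? (l Fin.≟ i) ×-dec ¬? (j Fin.≟ l) ×-dec (lookup e j ∈? Z i (lookup e i ∷ T))
    H : Vec (Fin n) m → Fin r → Fin r → Vec (Fin n) r → ℕ
    H T j l e = ⟦ cond? j l e T ⟧ * G l e T
    F≤H : ∀ T e → F e T ≤ ∑ (allFin r) (λ j → ∑ (allFin r) (λ l → H T j l e))
    F≤H T e with dom e T
    ... | inj₁ F≡0 = ≤-trans (≤-reflexive F≡0) z≤n
    ... | inj₂ (j , l , p , F≤G) = begin
      F e T                                                ≤⟨ F≤G ⟩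
      G l e T                                              ≡⟨ *-identityˡ _ ⟨
      1 * G l e T                                          ≡⟨ cong (_* G l e T) (⟦⟧-true (cond? j l e T) p) ⟨
      H T j l e                                            ≤⟨ ∑-term (λ l → H T j l e) (∈-allFin l) ⟩
      ∑ (allFin r) (λ l → H T j l e)                       ≤⟨ ∑-term (λ j → ∑ (allFin r) (λ l → H T j l e)) (∈-allFin j) ⟩
      ∑ (allFin r) (λ j → ∑ (allFin r) (λ l → H T j l e))  ∎
    plane : ∀ T j l e → ∑ (allFin n) (λ y → ∑ (allFin n) (λ z → H T j l ((e [ j ]≔ y) [ l ]≔ z))) ≤ c * B
    plane T j l e with j Fin.≟ i | l Fin.≟ i | j Fin.≟ l
    ... | yes _ | _ | _ = ≤-trans (≤-reflexive (∑-zero (allFin n) (λ y → ∑-zero (allFin n) (λ z → refl)))) z≤n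
    ... | no _ | yes _ | _ = ≤-trans (≤-reflexive (∑-zero (allFin n) (λ y → ∑-zero (allFin n) (λ z → refl)))) z≤n
    ... | no _ | no _ | yes _ = ≤-trans (≤-reflexive (∑-zero (allFin n) (λ y → ∑-zero (allFin n) (λ z → refl)))) z≤n
    ... | no j≢i | no l≢i | no j≢l = begin
      ∑ (allFin n) (λ y → ∑ (allFin n) (λ z →
        ⟦ lookup ((e [ j ]≔ y) [ l ]≔ z) j ∈? Z i (lookup ((e [ j ]≔ y) [ l ]≔ z) i ∷ T) ⟧ * G l ((e [ j ]≔ y) [ l ]≔ z) T))
        ≡⟨ ∑-cong (allFin n) (λ y → trans (∑-cong (allFin n) (λ z → cong₂ (λ u v → ⟦ u ∈? Z i (v ∷ T) ⟧ * G l ((e [ j ]≔ y) [ l ]≔ z) T)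
             (trans (lookup∘update′ j≢l (e [ j ]≔ y) z) (lookup∘update j e y))
             (trans (lookup∘update′ (l≢i ∘ sym) (e [ j ]≔ y) z) (lookup∘update′ (j≢i ∘ sym) e y))))
             (∑-*ˡ (allFin n) ⟦ y ∈? zs ⟧ _)) ⟩
      ∑ (allFin n) (λ y → ⟦ y ∈? zs ⟧ * ∑ (allFin n) (λ z → G l ((e [ j ]≔ y) [ l ]≔ z) T))
        ≤⟨ ∑-mono (allFin n) (λ y → *-monoʳ-≤ ⟦ y ∈? zs ⟧ (line l l≢i (e [ j ]≔ y) T)) ⟩
      ∑ (allFin n) (λ y → ⟦ y ∈? zs ⟧ * B)
        ≡⟨ ∑-*ʳ (allFin n) B _ ⟩
      ∑ (allFin n) (λ y → ⟦ y ∈? zs ⟧) * B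
        ≤⟨ *-monoˡ-≤ B (≤-trans (count-∈-≤-length zs) (Z≤c i _)) ⟩
      c * B ∎
      where zs = Z i (lookup e i ∷ T)
    perTuple : ∀ T → n * n * ∑ (tuples n r) (λ e → F e T) ≤ r * (r * (n ^ r * (c * B)))
    perTuple T = begin
      n * n * ∑ (tuples n r) (λ e → F e T)
        ≤⟨ *-monoʳ-≤ (n * n) (∑-mono (tuples n r) (F≤H T)) ⟩
      n * n * ∑ (tuples n r) (λ e → ∑ (allFin r) (λ j → ∑ (allFin r) (λ l → H T j l e)))
        ≤⟨ ∑-union (allFin r) (tuples n r) (λ j e → ∑ (allFin r) (λ l → H T j l e)) (n * n) (r * (n ^ r * (c * B)))
             (λ j → ≤-trans (∑-union (allFin r) (tuples n r) (λ l e → H T j l e) (n * n) (n ^ r * (c * B))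
               (λ l → ≤-trans (≤-reflexive (*-assoc n n _)) (plane-bound n r j l (H T j l) (c * B) (plane T j l))))
               (≤-reflexive (cong (_* (n ^ r * (c * B))) (length-allFin r)))) ⟩
      length (allFin r) * (r * (n ^ r * (c * B)))
        ≡⟨ cong (_* (r * (n ^ r * (c * B)))) (length-allFin r) ⟩
      r * (r * (n ^ r * (c * B))) ∎

-- Edges are ordered r-tuples.  Coordinate i of e is a dummy in deg i e, Common i S e and ext i j S e,
-- which concern the (r − 1)-tuple of the other coordinates.
module Edges {n r : ℕ} {P : Vec (Fin n) r → Set} (P? : ∀ e → Dec (P e)) where

  deg : Fin r → Vec (Fin n) r → ℕ
  deg i e = card (λ y → P? (e [ i ]≔ y))

  Common : ∀ {k} → Fin r → Vec (Fin n) k → Vec (Fin n) r → Set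
  Common i S e = All (λ y → P (e [ i ]≔ y)) S

  common? : ∀ {k} i (S : Vec (Fin n) k) e → Dec (Common i S e)
  common? i S e = All.all? (λ y → P? (e [ i ]≔ y)) S

  ext : ∀ {k} → Fin r → Fin r → Vec (Fin n) k → Vec (Fin n) r → ℕ
  ext i j S e = card (λ z → common? i S (e [ j ]≔ z))

  codeg? : ∀ i j e y z → Dec (P (e [ j ]≔ z) × P ((e [ j ]≔ z) [ i ]≔ y))
  codeg? i j e y z = P? (e [ j ]≔ z) ×-dec P? ((e [ j ]≔ z) [ i ]≔ y)

  codeg : Fin r → Fin r → Vec (Fin n) r → Fin n → ℕ
  codeg i j e y = card (codeg? i j e y)

  deg-update : ∀ i e y → deg i (e [ i ]≔ y) ≡ deg i e
  deg-update i e y = ∑-cong (allFin n) (λ z → cong (λ e → ⟦ P? e ⟧) ([]≔-idempotent e i))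

  ext-update : ∀ {k} i j (S : Vec (Fin n) k) e z → ext i j S (e [ j ]≔ z) ≡ ext i j S e
  ext-update i j S e z = ∑-cong (allFin n) (λ z → cong (λ e → ⟦ common? i S e ⟧) ([]≔-idempotent e j))

  codeg-update : ∀ i j e z y → codeg i j (e [ j ]≔ z) y ≡ codeg i j e y
  codeg-update i j e z y = ∑-cong (allFin n)
    (λ z → cong (λ e → ⟦ P? e ×-dec P? (e [ i ]≔ y) ⟧) ([]≔-idempotent e j))

  P-lookup : ∀ i e → P (e [ i ]≔ lookup e i) → P e
  P-lookup i e = subst P ([]≔-lookup e i)

  -- A longer tuple has fewer common extensions, so a single entry of `T` outside a ball already
  -- makes `e_i ∷ T` poor in that direction.
  ext≤codeg : ∀ {k} i j e (T : Vec (Fin n) k) (p : Fin k) → j ≢ i →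
    ext i j (lookup e i ∷ T) e ≤ codeg i j e (lookup T p)
  ext≤codeg i j e T p j≢i = card-mono (λ z → common? i (lookup e i ∷ T) (e [ j ]≔ z)) (codeg? i j e (lookup T p)) λ where
    z (q ∷ qs) → P-lookup i (e [ j ]≔ z) (subst (λ x → P ((e [ j ]≔ z) [ i ]≔ x)) (sym (lookup∘update′ (j≢i ∘ sym) e z)) q)
      , lookup⁺ qs p

  -- Both sides count the two-step paths that leave `e_i` through a neighbour `z` in coordinate `j`
  -- and end at some `y` in coordinate `i`.
  ∑-codeg : ∀ i j e → ∑ (allFin n) (codeg i j e) ≡ ∑ (allFin n) (λ z → ⟦ P? (e [ j ]≔ z) ⟧ * deg i (e [ j ]≔ z))
  ∑-codeg i j e = trans (∑-swap (allFin n) (allFin n) (λ y z → ⟦ codeg? i j e y z ⟧))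
    (∑-cong (allFin n) (λ z → trans (∑-cong (allFin n) (λ y → ⟦⟧-× (P? (e [ j ]≔ z)) (P? ((e [ j ]≔ z) [ i ]≔ y))))
      (∑-*ˡ (allFin n) ⟦ P? (e [ j ]≔ z) ⟧ _)))

-- Three rare kinds of pairs: two poor directions, no poor direction, poor although inside a ball

module Counting {n r m c : ℕ} {P : Vec (Fin n) r → Set} (P? : ∀ e → Dec (P e))
  (Z : Fin r → Vec (Fin n) (suc m) → List (Fin n))
  (Z≤c : ∀ i S → length (Z i S) ≤ c)
  (covers : ∀ i S → ¬ Repeats [] S → ∀ e → Edges.Common P? i S e → ∃ λ j → j ≢ i × lookup e j ∈ Z i S)
  where

  open Edges P?
  open CoverCount {n} {r} {m} {c} Z Z≤c

  PoorPair : ℕ → ℕ → Fin r → Vec (Fin n) (suc m) → Vec (Fin n) r → Set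
  PoorPair D W i S e = ∃ λ u → ∃ λ v → (u ≢ i × v ≢ i × u ≢ v) × W * ext i u S e < D × W * ext i v S e < D

  poorPair? : ∀ D W i S e → Dec (PoorPair D W i S e)
  poorPair? D W i S e = Fin.any? λ u → Fin.any? λ v →
    (¬? (u Fin.≟ i) ×-dec ¬? (v Fin.≟ i) ×-dec ¬? (u Fin.≟ v)) ×-dec (W * ext i u S e <? D) ×-dec (W * ext i v S e <? D)

  Proper : Fin r → Vec (Fin n) (suc m) → Vec (Fin n) r → Set
  Proper i S e = Common i S e × ¬ Repeats [] S

  proper? : ∀ i S e → Dec (Proper i S e)
  proper? i S e = common? i S e ×-dec ¬? (repeats? [] S)

  poorPairs : ℕ → ℕ → Fin r → Vec (Fin n) r → ℕ
  poorPairs D W i e = ∑ (tuples n m) (λ T → ⟦ proper? i (lookup e i ∷ T) e ×-dec poorPair? D W i (lookup e i ∷ T) e ⟧)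

  -- The cover accounts for one position `j`. Of two poor directions at least one differs from `j`
  -- and can serve as `l`; a line in a poor direction carries fewer than `D / W` common edges.
  poorPairs-count : ∀ D W i →
    W * (n * n * ∑ (tuples n r) (poorPairs D W i)) ≤ n ^ m * (r * (r * (n ^ r * (c * D))))
  poorPairs-count D W i = ≤-trans (≤-reflexive scale) (cover-count i F G D line dom)
    where
    open ≤-Reasoning
    F : Vec (Fin n) r → Vec (Fin n) m → ℕ
    F e T = W * ⟦ proper? i (lookup e i ∷ T) e ×-dec poorPair? D W i (lookup e i ∷ T) e ⟧
    G : Fin r → Vec (Fin n) r → Vec (Fin n) m → ℕ
    G l e T = W * ⟦ common? i (lookup e i ∷ T) e ×-dec (W * ext i l (lookup e i ∷ T) e <? D) ⟧
    exch : ∀ w k x → w * (k * x) ≡ k * (w * x)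
    exch = solve-∀
    scale : W * (n * n * ∑ (tuples n r) (poorPairs D W i)) ≡ n * n * ∑ (tuples n r) (λ e → ∑ (tuples n m) (F e))
    scale = trans (exch W (n * n) _) (cong (n * n *_) (sym
      (trans (∑-cong (tuples n r) (λ e → ∑-*ˡ (tuples n m) W _)) (∑-*ˡ (tuples n r) W _))))
    line : ∀ l → l ≢ i → ∀ e T → ∑ (allFin n) (λ z → G l (e [ l ]≔ z) T) ≤ D
    line l l≢i e T = begin
      ∑ (allFin n) (λ z → G l (e [ l ]≔ z) T)
        ≡⟨ ∑-*ˡ (allFin n) W _ ⟩
      W * ∑ (allFin n) (λ z → ⟦ common? i (lookup (e [ l ]≔ z) i ∷ T) (e [ l ]≔ z) ×-dec (W * ext i l (lookup (e [ l ]≔ z) i ∷ T) (e [ l ]≔ z) <? D) ⟧)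
        ≡⟨ cong (W *_) (∑-cong (allFin n) (λ z → trans (⟦⟧-× (common? i (lookup (e [ l ]≔ z) i ∷ T) (e [ l ]≔ z))
               (W * ext i l (lookup (e [ l ]≔ z) i ∷ T) (e [ l ]≔ z) <? D))
             (trans (cong (λ x → ⟦ common? i (x ∷ T) (e [ l ]≔ z) ⟧ * ⟦ W * ext i l (x ∷ T) (e [ l ]≔ z) <? D ⟧) (lookup∘update′ (l≢i ∘ sym) e z))
               (cong (λ k → ⟦ common? i S (e [ l ]≔ z) ⟧ * ⟦ W * k <? D ⟧) (ext-update i l S e z))))) ⟩
      W * ∑ (allFin n) (λ z → ⟦ common? i S (e [ l ]≔ z) ⟧ * ⟦ W * ext i l S e <? D ⟧)
        ≡⟨ cong (W *_) (∑-*ʳ (allFin n) _ _) ⟩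
      W * (ext i l S e * ⟦ W * ext i l S e <? D ⟧)
        ≡⟨ *-assoc W _ _ ⟨
      W * ext i l S e * ⟦ W * ext i l S e <? D ⟧
        ≤⟨ *⟦⟧-≤ (W * ext i l S e <? D) <⇒≤ ⟩
      D ∎
      where
      S = lookup e i ∷ T
    dom : Dominated i F G
    dom e T with ⟦⟧-cases (proper? i (lookup e i ∷ T) e ×-dec poorPair? D W i (lookup e i ∷ T) e)
    ... | inj₁ F≡0 = inj₁ (trans (cong (W *_) F≡0) (*-zeroʳ W))
    ... | inj₂ ((com , nr) , u , v , (u≢i , v≢i , u≢v) , pu , pv) with covers i (lookup e i ∷ T) nr e com
    ... | j , j≢i , j∈Z with j Fin.≟ u
    ... | no j≢u = inj₂ (j , u , (j≢i , u≢i , j≢u , j∈Z) , *-monoʳ-≤ W (⟦⟧-mono (proper? i (lookup e i ∷ T) e ×-dec poorPair? D W i (lookup e i ∷ T) e)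
            (common? i (lookup e i ∷ T) e ×-dec (W * ext i u (lookup e i ∷ T) e <? D)) (λ _ → com , pu)))
    ... | yes refl = inj₂ (j , v , (j≢i , v≢i , u≢v , j∈Z) , *-monoʳ-≤ W (⟦⟧-mono (proper? i (lookup e i ∷ T) e ×-dec poorPair? D W i (lookup e i ∷ T) e)
            (common? i (lookup e i ∷ T) e ×-dec (W * ext i v (lookup e i ∷ T) e <? D)) (λ _ → com , pv)))

  NoPoor : Fin r → Vec (Fin n) (suc m) → Vec (Fin n) r → Set
  NoPoor i S e = ∀ u → u ≢ i → c < ext i u S e

  noPoor? : ∀ i S e → Dec (NoPoor i S e)
  noPoor? i S e = Fin.all? λ u → ¬? (u Fin.≟ i) →-dec (c <? ext i u S e)

  noPoors : Fin r → Vec (Fin n) r → ℕ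
  noPoors i e = ∑ (tuples n m) (λ T → ⟦ proper? i (lookup e i ∷ T) e ×-dec noPoor? i (lookup e i ∷ T) e ⟧)

  -- A link with more than c extensions in the direction of a cover vertex has a second cover vertex.
  noPoors-count : ∀ i → n * n * ∑ (tuples n r) (noPoors i) ≤ n ^ m * (r * (r * (n ^ r * (c * c))))
  noPoors-count i = cover-count i F G c line dom
    where
    open ≤-Reasoning
    F : Vec (Fin n) r → Vec (Fin n) m → ℕ
    F e T = ⟦ proper? i (lookup e i ∷ T) e ×-dec noPoor? i (lookup e i ∷ T) e ⟧
    G : Fin r → Vec (Fin n) r → Vec (Fin n) m → ℕ
    G l e T = ⟦ lookup e l ∈? Z i (lookup e i ∷ T) ⟧
    line : ∀ l → l ≢ i → ∀ e T → ∑ (allFin n) (λ z → G l (e [ l ]≔ z) T) ≤ c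
    line l l≢i e T = begin
      ∑ (allFin n) (λ z → G l (e [ l ]≔ z) T)
        ≡⟨ ∑-cong (allFin n) (λ z → cong₂ (λ u v → ⟦ u ∈? Z i (v ∷ T) ⟧) (lookup∘update l e z) (lookup∘update′ (l≢i ∘ sym) e z)) ⟩
      ∑ (allFin n) (λ z → ⟦ z ∈? Z i (lookup e i ∷ T) ⟧)
        ≤⟨ ≤-trans (count-∈-≤-length (Z i (lookup e i ∷ T))) (Z≤c i _) ⟩
      c ∎
    dom : Dominated i F G
    dom e T with ⟦⟧-cases (proper? i (lookup e i ∷ T) e ×-dec noPoor? i (lookup e i ∷ T) e)
    ... | inj₁ F≡0 = inj₁ F≡0
    ... | inj₂ ((com , nr) , rich) with covers i (lookup e i ∷ T) nr e com
    -- The line in direction `j` has more common edges than the cover has elements, so one of them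
    -- has its `j`-entry outside the cover. Its own cover position `l` differs from `j`, and that
    -- entry is shared with `e`.
    ... | j , j≢i , j∈Z with ∑-<⇒∃ (allFin n) (λ z → ⟦ z ∈? Z i (lookup e i ∷ T) ⟧) (λ z → ⟦ common? i (lookup e i ∷ T) (e [ j ]≔ z) ⟧)
           (≤-<-trans (≤-trans (count-∈-≤-length (Z i (lookup e i ∷ T))) (Z≤c i _)) (rich j j≢i))
    ... | z , lt with covers i (lookup e i ∷ T) nr (e [ j ]≔ z) (⟦⟧-pos (common? i (lookup e i ∷ T) (e [ j ]≔ z)) (≤-<-trans z≤n lt))
    ... | l , l≢i , l∈Z with j Fin.≟ l
    ... | no j≢l = inj₂ (j , l , (j≢i , l≢i , j≢l , j∈Z) ,
          ⟦⟧-mono (proper? i (lookup e i ∷ T) e ×-dec noPoor? i (lookup e i ∷ T) e) (lookup e l ∈? Z i (lookup e i ∷ T))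
            (λ _ → subst (_∈ Z i (lookup e i ∷ T)) (lookup∘update′ (j≢l ∘ sym) e z) l∈Z))
    ... | yes refl = ⊥-elim (<⇒≱ lt (≤-trans (⟦⟧≤1 (common? i (lookup e i ∷ T) (e [ j ]≔ z)))
          (≤-reflexive (sym (⟦⟧-true (z ∈? Z i (lookup e i ∷ T)) (subst (_∈ Z i (lookup e i ∷ T)) (lookup∘update j e z) l∈Z))))))

  Ball : ℕ → ℕ → Fin r → Fin r → Vec (Fin n) r → Fin n → Set
  Ball D W i u e y = D ≤ W * codeg i u e y

  ball? : ∀ D W i u e y → Dec (Ball D W i u e y)
  ball? D W i u e y = D ≤? W * codeg i u e y

  -- The bound `c` complements the one in `NoPoor`: a tuple that lies in all balls satisfies one of
  -- the two conditions.
  BallPoor : ℕ → ℕ → Fin r → Vec (Fin n) m → Vec (Fin n) r → Set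
  BallPoor D W i T e = ∃ λ u → u ≢ i × All (Ball D W i u e) T × ext i u (lookup e i ∷ T) e ≤ c

  ballPoor? : ∀ D W i T e → Dec (BallPoor D W i T e)
  ballPoor? D W i T e = Fin.any? λ u →
    ¬? (u Fin.≟ i) ×-dec All.all? (ball? D W i u e) T ×-dec (ext i u (lookup e i ∷ T) e ≤? c)

  ballPoors : ℕ → ℕ → Fin r → Vec (Fin n) r → ℕ
  ballPoors D W i e = ∑ (tuples n m) (λ T → ⟦ common? i (lookup e i ∷ T) e ×-dec ballPoor? D W i T e ⟧)

  -- Markov's inequality for `codeg`, whose total is the number of two-step paths from `e_i` and
  -- hence at most `M * M`.
  card-ball : ∀ D W M → (∀ i e → deg i e ≤ M) → ∀ i u e → D * card (ball? D W i u e) ≤ W * (M * M)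
  card-ball D W M degM i u e = begin
    D * card (ball? D W i u e)                                      ≡⟨ ∑-*ˡ (allFin n) D _ ⟨
    ∑ (allFin n) (λ y → D * ⟦ ball? D W i u e y ⟧)                  ≤⟨ ∑-mono (allFin n) inBall ⟩
    ∑ (allFin n) (λ y → W * codeg i u e y)                          ≡⟨ ∑-*ˡ (allFin n) W _ ⟩
    W * ∑ (allFin n) (codeg i u e)                                  ≡⟨ cong (W *_) (∑-codeg i u e) ⟩
    W * ∑ (allFin n) (λ z → ⟦ P? (e [ u ]≔ z) ⟧ * deg i (e [ u ]≔ z)) ≤⟨ *-monoʳ-≤ W (∑-mono (allFin n) (λ z → *-monoʳ-≤ ⟦ P? (e [ u ]≔ z) ⟧ (degM i _))) ⟩
    W * ∑ (allFin n) (λ z → ⟦ P? (e [ u ]≔ z) ⟧ * M)                ≡⟨ cong (W *_) (∑-*ʳ (allFin n) M _) ⟩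
    W * (deg u e * M)                                               ≤⟨ *-monoʳ-≤ W (*-monoˡ-≤ M (degM u e)) ⟩
    W * (M * M) ∎
    where
    open ≤-Reasoning
    inBall : ∀ y → D * ⟦ ball? D W i u e y ⟧ ≤ W * codeg i u e y
    inBall y = *⟦⟧-≤ (ball? D W i u e y) id

  -- For fixed T at most c of the vertices z can have at most c common extensions with T,
  -- and the ball does not depend on the coordinate u.
  ballPoors-count : ∀ D W K → (∀ i u e → card (ball? D W i u e) ≤ K) → ∀ i →
    n * ∑ (tuples n r) (ballPoors D W i) ≤ r * (n ^ r * (c * K ^ m))
  ballPoors-count D W K ballK i = begin
    n * ∑ (tuples n r) (ballPoors D W i)
      ≤⟨ *-monoʳ-≤ n (∑-mono (tuples n r) split) ⟩
    n * ∑ (tuples n r) (λ e → ∑ (allFin r) (λ u → H u e))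
      ≤⟨ ∑-union (allFin r) (tuples n r) H n _ (λ u → line-bound n r u (H u) (c * K ^ m) (line u)) ⟩
    length (allFin r) * (n ^ r * (c * K ^ m))
      ≡⟨ cong (_* (n ^ r * (c * K ^ m))) (length-allFin r) ⟩
    r * (n ^ r * (c * K ^ m)) ∎
    where
    open ≤-Reasoning
    cond? : ∀ u e T → Dec (u ≢ i × All (Ball D W i u e) T × ext i u (lookup e i ∷ T) e ≤ c)
    cond? u e T = ¬? (u Fin.≟ i) ×-dec All.all? (ball? D W i u e) T ×-dec (ext i u (lookup e i ∷ T) e ≤? c)
    term? : ∀ u e T → Dec _
    term? u e T = common? i (lookup e i ∷ T) e ×-dec cond? u e T
    H : Fin r → Vec (Fin n) r → ℕ
    H u e = ∑ (tuples n m) (λ T → ⟦ term? u e T ⟧)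
    split : ∀ e → ballPoors D W i e ≤ ∑ (allFin r) (λ u → H u e)
    split e = ≤-trans
      (∑-mono (tuples n m) (λ T → ⟦⟧-≤ (common? i (lookup e i ∷ T) e ×-dec ballPoor? D W i T e)
        λ where (com , u , q) → ≤-trans (≤-reflexive (sym (⟦⟧-true (term? u e T) (com , q)))) (∑-term (λ u → ⟦ term? u e T ⟧) (∈-allFin u))))
      (≤-reflexive (∑-swap (tuples n m) (allFin r) (λ T u → ⟦ term? u e T ⟧)))
    line : ∀ u e → ∑ (allFin n) (λ z → H u (e [ u ]≔ z)) ≤ c * K ^ m
    line u e = case u Fin.≟ i of λ where
        (yes u≡i) → ≤-trans (≤-reflexive (∑-zero (allFin n) (λ z → ∑-zero (tuples n m) (λ T →
          ⟦⟧-false (term? u (e [ u ]≔ z) T) (λ where (_ , u≢i , _) → u≢i u≡i))))) z≤n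
        (no u≢i) → main u≢i
      where
      main : u ≢ i → ∑ (allFin n) (λ z → H u (e [ u ]≔ z)) ≤ c * K ^ m
      main u≢i = begin
        ∑ (allFin n) (λ z → H u (e [ u ]≔ z))
          ≡⟨ ∑-swap (allFin n) (tuples n m) (λ z T → ⟦ term? u (e [ u ]≔ z) T ⟧) ⟩
        ∑ (tuples n m) (λ T → ∑ (allFin n) (λ z → ⟦ term? u (e [ u ]≔ z) T ⟧))
          ≤⟨ ∑-mono (tuples n m) perTuple ⟩
        ∑ (tuples n m) (λ T → c * ⟦ All.all? (ball? D W i u e) T ⟧)
          ≡⟨ trans (∑-*ˡ (tuples n m) c _) (cong (c *_) (∑-tuples-all (ball? D W i u e) m)) ⟩
        c * card (ball? D W i u e) ^ m
          ≤⟨ *-monoʳ-≤ c (^-monoˡ-≤ m (ballK i u e)) ⟩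
        c * K ^ m ∎
        where
        perTuple : ∀ T → ∑ (allFin n) (λ z → ⟦ term? u (e [ u ]≔ z) T ⟧) ≤ c * ⟦ All.all? (ball? D W i u e) T ⟧
        perTuple T = begin
          ∑ (allFin n) (λ z → ⟦ term? u (e [ u ]≔ z) T ⟧)
            ≤⟨ ∑-mono (allFin n) (λ z → ≤-trans (⟦⟧-mono (term? u (e [ u ]≔ z) T)
                 (common? i S (e [ u ]≔ z) ×-dec ((ext i u S e ≤? c) ×-dec All.all? (ball? D W i u e) T)) (transfer z))
                 (≤-reflexive (⟦⟧-× (common? i S (e [ u ]≔ z)) ((ext i u S e ≤? c) ×-dec All.all? (ball? D W i u e) T)))) ⟩
          ∑ (allFin n) (λ z → ⟦ common? i S (e [ u ]≔ z) ⟧ * ⟦ (ext i u S e ≤? c) ×-dec All.all? (ball? D W i u e) T ⟧)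
            ≡⟨ trans (∑-*ʳ (allFin n) _ _) (trans (cong (ext i u S e *_) (⟦⟧-× (ext i u S e ≤? c) (All.all? (ball? D W i u e) T))) (sym (*-assoc (ext i u S e) _ _))) ⟩
          ext i u S e * ⟦ ext i u S e ≤? c ⟧ * ⟦ All.all? (ball? D W i u e) T ⟧
            ≤⟨ *-monoˡ-≤ ⟦ All.all? (ball? D W i u e) T ⟧ (*⟦⟧-≤ (ext i u S e ≤? c) id) ⟩
          c * ⟦ All.all? (ball? D W i u e) T ⟧ ∎
          where
          S = lookup e i ∷ T
          transfer : ∀ z → Common i (lookup (e [ u ]≔ z) i ∷ T) (e [ u ]≔ z) ×
            (u ≢ i × All (Ball D W i u (e [ u ]≔ z)) T × ext i u (lookup (e [ u ]≔ z) i ∷ T) (e [ u ]≔ z) ≤ c) →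
            Common i S (e [ u ]≔ z) × ext i u S e ≤ c × All (Ball D W i u e) T
          transfer z (com , _ , inBall , poor) rewrite lookup∘update′ (u≢i ∘ sym) e z =
            com , subst (_≤ c) (ext-update i u S e z) poor ,
            All.map (λ {y} → subst (λ k → D ≤ W * k) (codeg-update i u e z y)) inBall

-- Fixed-point-free involutions and parity

∑-involution : ∀ {r} (f : Fin r → Fin r) → (∀ i → f (f i) ≡ i) → (g : Fin r → ℕ) →
  ∑ (allFin r) (λ i → g (f i)) ≡ ∑ (allFin r) g
∑-involution {r} f inv g = begin
  ∑ (allFin r) (λ i → g (f i))
    ≡⟨ ∑-cong (allFin r) (λ i → pick (f i)) ⟩
  ∑ (allFin r) (λ i → ∑ (allFin r) (λ j → ⟦ j Fin.≟ f i ⟧ * g j))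
    ≡⟨ ∑-swap (allFin r) (allFin r) (λ i j → ⟦ j Fin.≟ f i ⟧ * g j) ⟩
  ∑ (allFin r) (λ j → ∑ (allFin r) (λ i → ⟦ j Fin.≟ f i ⟧ * g j))
    ≡⟨ ∑-cong (allFin r) (λ j → trans (∑-*ʳ (allFin r) (g j) _) (trans (cong (_* g j) (trans
         (∑-cong (allFin r) (λ i → ⟦⟧-cong (j Fin.≟ f i) (i Fin.≟ f j)
           (λ where refl → sym (inv i)) (λ where refl → sym (inv j)))) (∑-allFin-≡ (f j)))) (*-identityˡ (g j)))) ⟩
  ∑ (allFin r) g ∎
  where
  open ≡-Reasoning
  pick : ∀ k → g k ≡ ∑ (allFin r) (λ j → ⟦ j Fin.≟ k ⟧ * g j)
  pick k = begin
    g k                                              ≡⟨ *-identityˡ (g k) ⟨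
    1 * g k                                          ≡⟨ cong (_* g k) (∑-allFin-≡ k) ⟨
    ∑ (allFin r) (λ j → ⟦ j Fin.≟ k ⟧) * g k         ≡⟨ ∑-*ʳ (allFin r) (g k) _ ⟨
    ∑ (allFin r) (λ j → ⟦ j Fin.≟ k ⟧ * g k)         ≡⟨ ∑-cong (allFin r) (λ j → same j (j Fin.≟ k)) ⟩
    ∑ (allFin r) (λ j → ⟦ j Fin.≟ k ⟧ * g j) ∎
    where
    same : ∀ j (d : Dec (j ≡ k)) → ⟦ d ⟧ * g k ≡ ⟦ d ⟧ * g j
    same j (yes refl) = refl
    same j (no _) = refl

-- Every `i` satisfies exactly one of `i < f i` and `f i < i`, and `f` exchanges the two classes.
involution⇒even : ∀ {r} (f : Fin r → Fin r) → (∀ i → f (f i) ≡ i) → (∀ i → f i ≢ i) → r % 2 ≡ 0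
involution⇒even {r} f inv free = trans (cong (_% 2) r≡2h) (m*n%n≡0 h 2)
  where
  open ≡-Reasoning
  h = ∑ (allFin r) (λ i → ⟦ i Fin.<? f i ⟧)
  one : ∀ i → 1 ≡ ⟦ i Fin.<? f i ⟧ + ⟦ f i Fin.<? i ⟧
  one i with Fin.<-cmp i (f i)
  ... | tri< a _ c = sym (cong₂ _+_ (⟦⟧-true (i Fin.<? f i) a) (⟦⟧-false (f i Fin.<? i) c))
  ... | tri≈ _ b _ = ⊥-elim (free i (sym b))
  ... | tri> a _ c = sym (cong₂ _+_ (⟦⟧-false (i Fin.<? f i) a) (⟦⟧-true (f i Fin.<? i) c))
  r≡2h : r ≡ h * 2
  r≡2h = begin
    r                                                                   ≡⟨ length-allFin r ⟨
    length (allFin r)                                                   ≡⟨ *-identityʳ _ ⟨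
    length (allFin r) * 1                                               ≡⟨ ∑-const (allFin r) 1 ⟨
    ∑ (allFin r) (λ _ → 1)                                              ≡⟨ ∑-cong (allFin r) one ⟩
    ∑ (allFin r) (λ i → ⟦ i Fin.<? f i ⟧ + ⟦ f i Fin.<? i ⟧)            ≡⟨ ∑-+ (allFin r) _ _ ⟩
    h + ∑ (allFin r) (λ i → ⟦ f i Fin.<? i ⟧)                           ≡⟨ cong (h +_) (∑-cong (allFin r)
      (λ i → ⟦⟧-cong (f i Fin.<? i) (f i Fin.<? f (f i)) (subst (λ k → toℕ (f i) < toℕ k) (sym (inv i))) (subst (λ k → toℕ (f i) < toℕ k) (inv i)))) ⟩
    h + ∑ (allFin r) (λ i → ⟦ f i Fin.<? f (f i) ⟧)                     ≡⟨ cong (h +_) (∑-involution f inv (λ i → ⟦ i Fin.<? f i ⟧)) ⟩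
    h + h                                                               ≡⟨ cong (h +_) (+-identityʳ h) ⟨
    2 * h                                                               ≡⟨ *-comm 2 h ⟩
    h * 2 ∎

-- QD bounds all degrees, D bounds the degrees of a good edge from below; 1/W and 1/W' are the
-- thresholds (relative to D) of the large and the small balls, and 1/U, 1/R are the densities
-- below which a ball, respectively the set of poor pairs, is negligible.
record Scales (r m c D Q W W' U R : ℕ) : Set where
  field
    r-pos : 0 < r
    Q-pos : 0 < Q
    D-pos : 0 < D
    W-pos : 0 < W
    W'-pos : 0 < W'
    U-large : 2 ≤ U
    W-poor : 10 * r * (r * r * c) * R * Q ≤ W
    W'-poor : 10 * r * (r * r * c) * 9 * Q ≤ W'
    W'≤W : W' ≤ W
    U-reverse : 4 * W' * (Q * Q) ≤ U
    W-reverse : 8 * W' * Q ≤ W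
    R-core : 16 * (r * r) * U ≤ R
    D-reps : m * suc m * R ≤ D
    D-reps' : m * suc m * 9 ≤ D
    D-reps'' : m * suc m * (4 * (2 * U) ^ m) ≤ D
    D-noPoor : 10 * r * (4 * (2 * U) ^ m) * (r * r * (c * c)) * Q ≤ D
    D-ball : 10 * r * (4 * (2 * U) ^ m) * (r * c) * (W * (Q * Q)) ^ m ≤ D

-- Analysis of a single edge

module EdgeAnalysis {n r m' c : ℕ} {P : Vec (Fin n) r → Set} (P? : ∀ e → Dec (P e))
  (Z : Fin r → Vec (Fin n) (3 + m') → List (Fin n))
  (Z≤c : ∀ i S → length (Z i S) ≤ c)
  (covers : ∀ i S → ¬ Repeats [] S → ∀ e → Edges.Common P? i S e → ∃ λ j → j ≢ i × lookup e j ∈ Z i S)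
  where

  open Edges P?
  open Counting {n} {r} {2 + m'} {c} P? Z Z≤c covers

  m : ℕ
  m = 2 + m'

  reps : Fin r → Vec (Fin n) r → ℕ
  reps i e = ∑ (tuples n m) (λ T → ⟦ common? i T e ⟧ * ⟦ repeats? (lookup e i ∷ []) T ⟧)

  reps-small : ∀ i e R → m * suc m * R ≤ deg i e → 0 < deg i e → R * reps i e ≤ deg i e ^ m
  reps-small i e R large pos = *-cancelˡ-≤ a (begin
    a * (R * reps i e)              ≡⟨ exch a R (reps i e) ⟩
    R * (a * reps i e)              ≤⟨ *-monoʳ-≤ R (repeats-count (λ y → P? (e [ i ]≔ y)) m (lookup e i ∷ [])) ⟩
    R * (m * suc m * a ^ m)         ≡⟨ assoc R (m * suc m) (a ^ m) ⟩
    m * suc m * R * a ^ m           ≤⟨ *-monoˡ-≤ (a ^ m) large ⟩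
    a * a ^ m ∎)
    where
    open ≤-Reasoning
    a = deg i e
    instance
      _ = >-nonZero pos
    exch : ∀ a b c → a * (b * c) ≡ b * (a * c)
    exch = solve-∀
    assoc : ∀ a b c → a * (b * c) ≡ b * a * c
    assoc = solve-∀

  in? : ∀ D W i u e y → Dec (P (e [ i ]≔ y) × Ball D W i u e y)
  in? D W i u e y = P? (e [ i ]≔ y) ×-dec ball? D W i u e y

  out? : ∀ D W i u e y → Dec (P (e [ i ]≔ y) × ¬ Ball D W i u e y)
  out? D W i u e y = P? (e [ i ]≔ y) ×-dec ¬? (ball? D W i u e y)

  inside outside : ℕ → ℕ → Fin r → Fin r → Vec (Fin n) r → ℕ
  inside D W i u e = card (in? D W i u e)
  outside D W i u e = card (out? D W i u e)

  deg≤inside+outside : ∀ D W i u e → deg i e ≤ inside D W i u e + outside D W i u e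
  deg≤inside+outside D W i u e = ≤-trans
    (∑-mono (allFin n) (λ y → ⟦⟧-∪ (P? (e [ i ]≔ y)) (in? D W i u e y) (out? D W i u e y) (λ p → case ball? D W i u e y of λ where
      (yes q) → inj₁ (p , q)
      (no ¬q) → inj₂ (p , ¬q))))
    (≤-reflexive (∑-+ (allFin n) _ _))

  proper : ∀ i e (T : Vec (Fin n) m) → P e → Common i T e → ¬ Repeats (lookup e i ∷ []) T → Proper i (lookup e i ∷ T) e
  proper i e T Pe com nr = (subst P (sym ([]≔-lookup e i)) Pe ∷ com) , λ where (later q) → nr q

  -- A tuple whose first entry escapes the ball in direction `u` and whose second escapes the ball
  -- in direction `v` is poor in both directions, whatever its other `m'` entries are. Only
  -- degenerate tuples have to be set aside.
  outside-product : ∀ D W i u v e → P e → u ≢ i → v ≢ i → u ≢ v →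
    outside D W i u e * (outside D W i v e * deg i e ^ m') ≤ poorPairs D W i e + reps i e
  outside-product D W i u v e Pe u≢i v≢i u≢v = begin
    outside D W i u e * (outside D W i v e * deg i e ^ m')
      ≡⟨ cong (λ k → outside D W i u e * (outside D W i v e * k)) (∑-tuples-all (λ y → P? (e [ i ]≔ y)) m') ⟨
    outside D W i u e * (outside D W i v e * ∑ (tuples n m') (λ T → ⟦ common? i T e ⟧))
      ≡⟨ ∑-*ʳ (allFin n) _ _ ⟨
    ∑ (allFin n) (λ y → ⟦ out? D W i u e y ⟧ * (outside D W i v e * ∑ (tuples n m') (λ T → ⟦ common? i T e ⟧)))
      ≡⟨ ∑-cong (allFin n) (λ y → cong (⟦ out? D W i u e y ⟧ *_) (trans (sym (∑-*ʳ (allFin n) _ _))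
           (∑-cong (allFin n) (λ y' → sym (∑-*ˡ (tuples n m') ⟦ out? D W i v e y' ⟧ _))))) ⟩
    ∑ (allFin n) (λ y → ⟦ out? D W i u e y ⟧ * ∑ (allFin n) (λ y' → ∑ (tuples n m') (λ T → ⟦ out? D W i v e y' ⟧ * ⟦ common? i T e ⟧)))
      ≡⟨ ∑-cong (allFin n) (λ y → trans (sym (∑-*ˡ (allFin n) ⟦ out? D W i u e y ⟧ _))
           (∑-cong (allFin n) (λ y' → sym (∑-*ˡ (tuples n m') ⟦ out? D W i u e y ⟧ _)))) ⟩
    ∑ (allFin n) (λ y → ∑ (allFin n) (λ y' → ∑ (tuples n m') (λ T → ⟦ out? D W i u e y ⟧ * (⟦ out? D W i v e y' ⟧ * ⟦ common? i T e ⟧))))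
      ≤⟨ ∑-mono (allFin n) (λ y → ∑-mono (allFin n) (λ y' → ∑-mono (tuples n m') (pointwise y y'))) ⟩
    ∑ (allFin n) (λ y → ∑ (allFin n) (λ y' → ∑ (tuples n m') (λ T → H (y ∷ y' ∷ T))))
      ≡⟨ trans (∑-tuples-suc n (suc m') H) (∑-cong (allFin n) (λ y → ∑-tuples-suc n m' (λ T → H (y ∷ T)))) ⟨
    ∑ (tuples n m) H
      ≡⟨ ∑-+ (tuples n m) _ _ ⟩
    poorPairs D W i e + reps i e ∎
    where
    open ≤-Reasoning
    pp? : ∀ T → Dec (Proper i (lookup e i ∷ T) e × PoorPair D W i (lookup e i ∷ T) e)
    pp? T = proper? i (lookup e i ∷ T) e ×-dec poorPair? D W i (lookup e i ∷ T) e
    H : Vec (Fin n) m → ℕ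
    H T = ⟦ pp? T ⟧ + ⟦ common? i T e ⟧ * ⟦ repeats? (lookup e i ∷ []) T ⟧
    pointwise : ∀ y y' T → ⟦ out? D W i u e y ⟧ * (⟦ out? D W i v e y' ⟧ * ⟦ common? i T e ⟧) ≤ H (y ∷ y' ∷ T)
    pointwise y y' T = begin
      ⟦ out? D W i u e y ⟧ * (⟦ out? D W i v e y' ⟧ * ⟦ common? i T e ⟧)
        ≡⟨ trans (⟦⟧-× (out? D W i u e y) (out? D W i v e y' ×-dec common? i T e))
             (cong (⟦ out? D W i u e y ⟧ *_) (⟦⟧-× (out? D W i v e y') (common? i T e))) ⟨
      ⟦ out? D W i u e y ×-dec (out? D W i v e y' ×-dec common? i T e) ⟧
        ≤⟨ ⟦⟧-∪ (out? D W i u e y ×-dec (out? D W i v e y' ×-dec common? i T e)) (pp? S) (common? i S e ×-dec repeats? (lookup e i ∷ []) S) split ⟩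
      ⟦ pp? S ⟧ + ⟦ common? i S e ×-dec repeats? (lookup e i ∷ []) S ⟧
        ≡⟨ cong (⟦ pp? S ⟧ +_) (⟦⟧-× (common? i S e) (repeats? (lookup e i ∷ []) S)) ⟩
      H S ∎
      where
      S : Vec (Fin n) m
      S = y ∷ y' ∷ T
      split : (P (e [ i ]≔ y) × ¬ Ball D W i u e y) × (P (e [ i ]≔ y') × ¬ Ball D W i v e y') × Common i T e →
        (Proper i (lookup e i ∷ S) e × PoorPair D W i (lookup e i ∷ S) e) ⊎ (Common i S e × Repeats (lookup e i ∷ []) S)
      split ((p , ¬b) , (p' , ¬b') , com) = case repeats? (lookup e i ∷ []) S of λ where
        (yes rep) → inj₂ ((p ∷ p' ∷ com) , rep)
        (no nr) → inj₁ (proper i e S Pe (p ∷ p' ∷ com) nr , u , v , (u≢i , v≢i , u≢v) ,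
          ≤-<-trans (*-monoʳ-≤ W (ext≤codeg i u e S zero u≢i)) (≰⇒> ¬b) ,
          ≤-<-trans (*-monoʳ-≤ W (ext≤codeg i v e S (suc zero) v≢i)) (≰⇒> ¬b'))

  outside-product-small : ∀ D W R i e → P e → 0 < deg i e → m * suc m * R ≤ deg i e → R * poorPairs D W i e ≤ deg i e ^ m →
    ∀ u v → u ≢ i → v ≢ i → u ≢ v → R * (outside D W i u e * outside D W i v e) ≤ 2 * (deg i e * deg i e)
  outside-product-small D W R i e Pe pos large pp u v u≢i v≢i u≢v = *-cancelʳ-≤ _ _ (a ^ m') (begin
    R * (x * y) * a ^ m'                  ≡⟨ assoc R x y (a ^ m') ⟩
    R * (x * (y * a ^ m'))                ≤⟨ *-monoʳ-≤ R (outside-product D W i u v e Pe u≢i v≢i u≢v) ⟩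
    R * (poorPairs D W i e + reps i e)    ≡⟨ *-distribˡ-+ R _ _ ⟩
    R * poorPairs D W i e + R * reps i e  ≤⟨ +-mono-≤ pp (reps-small i e R large pos) ⟩
    a ^ m + a ^ m                         ≡⟨ twice a (a ^ m') ⟩
    2 * (a * a) * a ^ m' ∎)
    where
    open ≤-Reasoning
    a = deg i e
    x = outside D W i u e
    y = outside D W i v e
    instance
      _ = >-nonZero pos
      _ = m^n≢0 a m'
    assoc : ∀ R x y k → R * (x * y) * k ≡ R * (x * (y * k))
    assoc = solve-∀
    twice : ∀ a k → a * (a * k) + a * (a * k) ≡ 2 * (a * a) * k
    twice = solve-∀

  core? : ∀ D W i e y → Dec (P (e [ i ]≔ y) × ¬ (∃ λ u → u ≢ i × ¬ Ball D W i u e y))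
  core? D W i e y = P? (e [ i ]≔ y) ×-dec ¬? (Fin.any? λ u → ¬? (u Fin.≟ i) ×-dec ¬? (ball? D W i u e y))

  core : ℕ → ℕ → Fin r → Vec (Fin n) r → ℕ
  core D W i e = card (core? D W i e)

  -- Members of `X` that miss the core are charged to a direction in `I`. The freedom in `X` and `I`
  -- allows one exceptional direction to be left out, by taking `X` inside its ball.
  card≤core+outside : ∀ D W i e {X : Fin n → Set} (X? : ∀ y → Dec (X y)) {I : Fin r → Set} (I? : ∀ u → Dec (I u)) →
    (∀ y → X y → P (e [ i ]≔ y)) →
    (∀ y → X y → ∀ u → u ≢ i → ¬ Ball D W i u e y → I u) →
    card X? ≤ core D W i e + ∑ (allFin r) (λ u → ⟦ I? u ⟧ * outside D W i u e)
  card≤core+outside D W i e {X} X? I? X⊆P escape = begin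
    card X?
      ≤⟨ ∑-mono (allFin n) pointwise ⟩
    ∑ (allFin n) (λ y → ⟦ core? D W i e y ⟧ + ∑ (allFin r) (λ u → ⟦ I? u ⟧ * ⟦ out? D W i u e y ⟧))
      ≡⟨ ∑-+ (allFin n) _ _ ⟩
    core D W i e + ∑ (allFin n) (λ y → ∑ (allFin r) (λ u → ⟦ I? u ⟧ * ⟦ out? D W i u e y ⟧))
      ≡⟨ cong (core D W i e +_) (trans (∑-swap (allFin n) (allFin r) (λ y u → ⟦ I? u ⟧ * ⟦ out? D W i u e y ⟧))
           (∑-cong (allFin r) (λ u → ∑-*ˡ (allFin n) ⟦ I? u ⟧ _))) ⟩
    core D W i e + ∑ (allFin r) (λ u → ⟦ I? u ⟧ * outside D W i u e) ∎
    where
    open ≤-Reasoning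
    esc? : ∀ y → Dec (∃ λ u → u ≢ i × ¬ Ball D W i u e y)
    esc? y = Fin.any? λ u → ¬? (u Fin.≟ i) ×-dec ¬? (ball? D W i u e y)
    pointwise : ∀ y → ⟦ X? y ⟧ ≤ ⟦ core? D W i e y ⟧ + ∑ (allFin r) (λ u → ⟦ I? u ⟧ * ⟦ out? D W i u e y ⟧)
    pointwise y = ⟦⟧-≤ (X? y) λ x → case esc? y of λ where
      (no ¬esc) → ≤-trans (≤-reflexive (sym (⟦⟧-true (core? D W i e y) (X⊆P y x , ¬esc)))) (m≤m+n _ _)
      (yes (u , u≢i , ¬b)) → ≤-trans
        (≤-reflexive (sym (cong₂ _*_ (⟦⟧-true (I? u) (escape y x u u≢i ¬b)) (⟦⟧-true (out? D W i u e y) (X⊆P y x , ¬b)))))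
        (≤-trans (∑-term (λ u → ⟦ I? u ⟧ * ⟦ out? D W i u e y ⟧) (∈-allFin u)) (m≤n+m _ _))

  -- A nondegenerate tuple from the core either has more than `c` extensions in every direction, or
  -- at most `c` in some direction `u`; in the latter case it is counted by `ballPoors`, because its
  -- entries lie in the ball for `u`.
  core^m-bound : ∀ D W i e → P e → core D W i e ^ m ≤ ballPoors D W i e + noPoors i e + reps i e
  core^m-bound D W i e Pe = begin
    core D W i e ^ m
      ≡⟨ ∑-tuples-all (core? D W i e) m ⟨
    ∑ (tuples n m) (λ T → ⟦ All.all? (core? D W i e) T ⟧)
      ≤⟨ ∑-mono (tuples n m) pointwise ⟩
    ∑ (tuples n m) (λ T → ⟦ bp? T ⟧ + ⟦ np? T ⟧ + ⟦ common? i T e ⟧ * ⟦ repeats? (lookup e i ∷ []) T ⟧)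
      ≡⟨ trans (∑-+ (tuples n m) (λ T → ⟦ bp? T ⟧ + ⟦ np? T ⟧) _) (cong (_+ reps i e) (∑-+ (tuples n m) _ _)) ⟩
    ballPoors D W i e + noPoors i e + reps i e ∎
    where
    open ≤-Reasoning
    bp? : ∀ T → Dec (Common i (lookup e i ∷ T) e × BallPoor D W i T e)
    bp? T = common? i (lookup e i ∷ T) e ×-dec ballPoor? D W i T e
    np? : ∀ T → Dec (Proper i (lookup e i ∷ T) e × NoPoor i (lookup e i ∷ T) e)
    np? T = proper? i (lookup e i ∷ T) e ×-dec noPoor? i (lookup e i ∷ T) e
    pointwise : ∀ T → ⟦ All.all? (core? D W i e) T ⟧ ≤ ⟦ bp? T ⟧ + ⟦ np? T ⟧ + ⟦ common? i T e ⟧ * ⟦ repeats? (lookup e i ∷ []) T ⟧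
    pointwise T = ⟦⟧-≤ (All.all? (core? D W i e) T) λ cores →
      let com = All.map proj₁ cores in case repeats? (lookup e i ∷ []) T of λ where
      (yes rep) → ≤-trans (≤-reflexive (sym (cong₂ _*_ (⟦⟧-true (common? i T e) com) (⟦⟧-true (repeats? (lookup e i ∷ []) T) rep)))) (m≤n+m _ _)
      (no nr) → let pr = proper i e T Pe com nr in ≤-trans (case ballPoor? D W i T e of λ where
        (yes bp) → ≤-trans (≤-reflexive (sym (⟦⟧-true (bp? T) (proj₁ pr , bp)))) (m≤m+n _ _)
        (no ¬bp) → ≤-trans (≤-reflexive (sym (⟦⟧-true (np? T) (pr , λ u u≢i → ≰⇒> λ poor →
          ¬bp (u , u≢i , All.map (λ {y} q → decidable-stable (ball? D W i u e y) (λ ¬b → proj₂ q (u , u≢i , ¬b))) cores , poor))))) (m≤n+m _ _))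
        (m≤m+n _ _)

  -- By the product bound at most one direction loses more than `deg / (4 r)` neighbours. If none
  -- does, the core keeps three quarters of them. If `v` does, start from the at least `deg / U`
  -- neighbours inside its ball: each other direction removes at most `8 r deg / R`, together at
  -- most `deg / (2 U)`.
  core-large : ∀ D W U R i e → 0 < r → 2 ≤ U → 16 * (r * r) * U ≤ R → 0 < deg i e →
    (∀ u v → u ≢ i → v ≢ i → u ≢ v → R * (outside D W i u e * outside D W i v e) ≤ 2 * (deg i e * deg i e)) →
    (∀ v → v ≢ i → deg i e ≤ U * inside D W i v e) →
    deg i e ≤ 2 * U * core D W i e
  core-large D W U R i e 0<r 2≤U R-large pos product dense =
    case Fin.any? (λ v → ¬? (v Fin.≟ i) ×-dec (a <? 4 * r * outside D W i v e)) of λ where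
      (yes (v , v≢i , big)) → oneBig v v≢i big
      (no none) → noneBig (λ u u≢i → ≮⇒≥ (λ big → none (u , u≢i , big)))
    where
    open ≤-Reasoning
    a = deg i e
    k = core D W i e
    instance
      _ = >-nonZero pos
      _ = >-nonZero 0<r
    weighted : ∀ {I : Fin r → Set} (I? : ∀ u → Dec (I u)) w b → (∀ u → I u → w * outside D W i u e ≤ b) →
      w * ∑ (allFin r) (λ u → ⟦ I? u ⟧ * outside D W i u e) ≤ r * b
    weighted I? w b h = begin
      w * ∑ (allFin r) (λ u → ⟦ I? u ⟧ * outside D W i u e)
        ≡⟨ ∑-*ˡ (allFin r) w _ ⟨
      ∑ (allFin r) (λ u → w * (⟦ I? u ⟧ * outside D W i u e))
        ≤⟨ ∑-bound (allFin r) b (λ u → ≤-trans (≤-reflexive (exch w ⟦ I? u ⟧ (outside D W i u e))) (*⟦⟧-≤ (I? u) (h u))) ⟩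
      length (allFin r) * b
        ≡⟨ cong (_* b) (length-allFin r) ⟩
      r * b ∎
      where
      exch : ∀ w x y → w * (x * y) ≡ w * y * x
      exch = solve-∀
    noneBig : (∀ u → u ≢ i → 4 * r * outside D W i u e ≤ a) → a ≤ 2 * U * k
    noneBig small = begin
      a              ≤⟨ m≤n*m a 3 ⟩
      3 * a          ≤⟨ +-cancelʳ-≤ a (3 * a) (4 * k) (begin
        3 * a + a      ≡⟨ four a ⟩
        4 * a          ≤⟨ *-monoʳ-≤ 4 (card≤core+outside D W i e (λ y → P? (e [ i ]≔ y)) (λ u → ¬? (u Fin.≟ i))
                            (λ _ p → p) (λ _ _ u u≢i _ → u≢i)) ⟩
        4 * (k + S)    ≡⟨ *-distribˡ-+ 4 k S ⟩
        4 * k + 4 * S  ≤⟨ +-monoʳ-≤ (4 * k) (*-cancelˡ-≤ r (≤-trans (≤-reflexive (exch r S)) (weighted (λ u → ¬? (u Fin.≟ i)) (4 * r) a small))) ⟩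
        4 * k + a ∎) ⟩
      4 * k          ≤⟨ *-monoˡ-≤ k (*-monoʳ-≤ 2 2≤U) ⟩
      2 * U * k ∎
      where
      S = ∑ (allFin r) (λ u → ⟦ ¬? (u Fin.≟ i) ⟧ * outside D W i u e)
      four : ∀ a → 3 * a + a ≡ 4 * a
      four = solve-∀
      exch : ∀ r s → r * (4 * s) ≡ 4 * r * s
      exch = solve-∀
    oneBig : ∀ v → v ≢ i → a < 4 * r * outside D W i v e → a ≤ 2 * U * k
    oneBig v v≢i big = +-cancelʳ-≤ a a (2 * U * k) (begin
      a + a                            ≡⟨ double a ⟩
      2 * a                            ≤⟨ *-monoʳ-≤ 2 (dense v v≢i) ⟩
      2 * (U * inside D W i v e)       ≤⟨ *-monoʳ-≤ 2 (*-monoʳ-≤ U (card≤core+outside D W i e (in? D W i v e) I?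
                                            (λ _ → proj₁) (λ y q u u≢i ¬b → u≢i , λ where refl → ¬b (proj₂ q)))) ⟩
      2 * (U * (k + S))                ≡⟨ distr U k S ⟩
      2 * U * k + 2 * U * S            ≤⟨ +-monoʳ-≤ (2 * U * k) tail ⟩
      2 * U * k + a ∎)
      where
      I? : ∀ u → Dec (u ≢ i × u ≢ v)
      I? u = ¬? (u Fin.≟ i) ×-dec ¬? (u Fin.≟ v)
      S = ∑ (allFin r) (λ u → ⟦ I? u ⟧ * outside D W i u e)
      double : ∀ a → a + a ≡ 2 * a
      double = solve-∀
      distr : ∀ u k s → 2 * (u * (k + s)) ≡ 2 * u * k + 2 * u * s
      distr = solve-∀
      other : ∀ u → u ≢ i × u ≢ v → R * outside D W i u e ≤ 8 * r * a
      other u (u≢i , u≢v) = *-cancelˡ-≤ a (begin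
        a * (R * x)                    ≤⟨ *-monoˡ-≤ (R * x) (<⇒≤ big) ⟩
        4 * r * y * (R * x)            ≡⟨ regroup r R x y ⟩
        4 * r * (R * (x * y))          ≤⟨ *-monoʳ-≤ (4 * r) (product u v u≢i v≢i u≢v) ⟩
        4 * r * (2 * (a * a))          ≡⟨ regroup' r a ⟩
        a * (8 * r * a) ∎)
        where
        x = outside D W i u e
        y = outside D W i v e
        regroup : ∀ r R x y → 4 * r * y * (R * x) ≡ 4 * r * (R * (x * y))
        regroup = solve-∀
        regroup' : ∀ r a → 4 * r * (2 * (a * a)) ≡ a * (8 * r * a)
        regroup' = solve-∀
      tail : 2 * U * S ≤ a
      tail = *-cancelˡ-≤ (8 * (r * r)) {{m*n≢0 8 (r * r) {{_}} {{m*n≢0 r r}}}} (begin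
        8 * (r * r) * (2 * U * S)      ≡⟨ regroup r U S ⟩
        16 * (r * r) * U * S           ≤⟨ *-monoˡ-≤ S R-large ⟩
        R * S                          ≤⟨ weighted I? R (8 * r * a) other ⟩
        r * (8 * r * a)                ≡⟨ regroup' r a ⟩
        8 * (r * r) * a ∎)
        where
        regroup : ∀ r U S → 8 * (r * r) * (2 * U * S) ≡ 16 * (r * r) * U * S
        regroup = solve-∀
        regroup' : ∀ r a → r * (8 * r * a) ≡ 8 * (r * r) * a
        regroup' = solve-∀

  -- Otherwise the core has at least `deg / (2 U)` elements, and the `m`-th power of this number
  -- would have to fit into three terms, each of them at most a quarter of it.
  sparse-direction : ∀ D W U R i e → P e → 0 < r → 2 ≤ U → 16 * (r * r) * U ≤ R → 0 < deg i e →
    m * suc m * R ≤ deg i e → R * poorPairs D W i e ≤ deg i e ^ m →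
    4 * (2 * U) ^ m * ballPoors D W i e ≤ deg i e ^ m →
    4 * (2 * U) ^ m * noPoors i e ≤ deg i e ^ m →
    m * suc m * (4 * (2 * U) ^ m) ≤ deg i e →
    ∃ λ v → v ≢ i × U * inside D W i v e < deg i e
  sparse-direction D W U R i e Pe 0<r 2≤U R-large pos large pp bp np large' =
    case Fin.any? (λ v → ¬? (v Fin.≟ i) ×-dec (U * inside D W i v e <? a)) of λ where
      (yes found) → found
      (no none) → ⊥-elim (impossible (core-large D W U R i e 0<r 2≤U R-large pos
        (outside-product-small D W R i e Pe pos large pp) (λ v v≢i → ≮⇒≥ (λ lt → none (v , v≢i , lt)))))
    where
    open ≤-Reasoning
    a = deg i e
    k = core D W i e
    V = (2 * U) ^ m
    instance
      _ = >-nonZero pos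
    impossible : ¬ (a ≤ 2 * U * k)
    impossible a≤ = <⇒≱ (m^n>0 a m) (+-cancelˡ-≤ (3 * a ^ m) (a ^ m) 0 (begin
      3 * a ^ m + a ^ m                                ≡⟨ four (a ^ m) ⟩
      4 * a ^ m                                        ≤⟨ *-monoʳ-≤ 4 (^-monoˡ-≤ m a≤) ⟩
      4 * (2 * U * k) ^ m                              ≡⟨ cong (4 *_) (^-distribʳ-* m (2 * U) k) ⟩
      4 * (V * k ^ m)                                  ≡⟨ *-assoc 4 V (k ^ m) ⟨
      4 * V * k ^ m                                    ≤⟨ *-monoʳ-≤ (4 * V) (core^m-bound D W i e Pe) ⟩
      4 * V * (ballPoors D W i e + noPoors i e + reps i e)
        ≡⟨ distr (4 * V) (ballPoors D W i e) (noPoors i e) (reps i e) ⟩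
      4 * V * ballPoors D W i e + 4 * V * noPoors i e + 4 * V * reps i e
        ≤⟨ +-mono-≤ (+-mono-≤ bp np) (reps-small i e (4 * V) large' pos) ⟩
      a ^ m + a ^ m + a ^ m                            ≡⟨ three (a ^ m) ⟩
      3 * a ^ m + 0 ∎))
      where
      four : ∀ x → 3 * x + x ≡ 4 * x
      four = solve-∀
      three : ∀ x → x + x + x ≡ 3 * x + 0
      three = solve-∀
      distr : ∀ v x y z → v * (x + y + z) ≡ v * x + v * y + v * z
      distr = solve-∀

  -- The number of edges between the two neighbourhoods of the pair (e_i , e_v) in the link graph.
  crossing : Fin r → Fin r → Vec (Fin n) r → ℕ
  crossing i v e = ∑ (allFin n) (λ y → ⟦ P? (e [ i ]≔ y) ⟧ * codeg i v e y)

  crossing-sym : ∀ i v e → v ≢ i → crossing i v e ≡ crossing v i e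
  crossing-sym i v e v≢i = begin
    crossing i v e
      ≡⟨ ∑-cong (allFin n) (λ y → ∑-*ˡ (allFin n) ⟦ P? (e [ i ]≔ y) ⟧ _) ⟨
    ∑ (allFin n) (λ y → ∑ (allFin n) (λ z → ⟦ P? (e [ i ]≔ y) ⟧ * ⟦ codeg? i v e y z ⟧))
      ≡⟨ ∑-swap (allFin n) (allFin n) (λ y z → ⟦ P? (e [ i ]≔ y) ⟧ * ⟦ codeg? i v e y z ⟧) ⟩
    ∑ (allFin n) (λ z → ∑ (allFin n) (λ y → ⟦ P? (e [ i ]≔ y) ⟧ * ⟦ codeg? i v e y z ⟧))
      ≡⟨ ∑-cong (allFin n) (λ z → trans (∑-cong (allFin n) (λ y → swap y z)) (∑-*ˡ (allFin n) ⟦ P? (e [ v ]≔ z) ⟧ _)) ⟩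
    crossing v i e ∎
    where
    open ≡-Reasoning
    exch : ∀ x y z → x * (y * z) ≡ y * (x * z)
    exch = solve-∀
    swap : ∀ y z → ⟦ P? (e [ i ]≔ y) ⟧ * ⟦ codeg? i v e y z ⟧ ≡ ⟦ P? (e [ v ]≔ z) ⟧ * ⟦ codeg? v i e z y ⟧
    swap y z = begin
      ⟦ P? (e [ i ]≔ y) ⟧ * ⟦ codeg? i v e y z ⟧
        ≡⟨ cong (⟦ P? (e [ i ]≔ y) ⟧ *_) (⟦⟧-× (P? (e [ v ]≔ z)) (P? ((e [ v ]≔ z) [ i ]≔ y))) ⟩
      ⟦ P? (e [ i ]≔ y) ⟧ * (⟦ P? (e [ v ]≔ z) ⟧ * ⟦ P? ((e [ v ]≔ z) [ i ]≔ y) ⟧)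
        ≡⟨ cong (λ e' → ⟦ P? (e [ i ]≔ y) ⟧ * (⟦ P? (e [ v ]≔ z) ⟧ * ⟦ P? e' ⟧)) ([]≔-commutes e v i v≢i) ⟩
      ⟦ P? (e [ i ]≔ y) ⟧ * (⟦ P? (e [ v ]≔ z) ⟧ * ⟦ P? ((e [ i ]≔ y) [ v ]≔ z) ⟧)
        ≡⟨ exch ⟦ P? (e [ i ]≔ y) ⟧ ⟦ P? (e [ v ]≔ z) ⟧ _ ⟩
      ⟦ P? (e [ v ]≔ z) ⟧ * (⟦ P? (e [ i ]≔ y) ⟧ * ⟦ P? ((e [ i ]≔ y) [ v ]≔ z) ⟧)
        ≡⟨ cong (⟦ P? (e [ v ]≔ z) ⟧ *_) (⟦⟧-× (P? (e [ i ]≔ y)) (P? ((e [ i ]≔ y) [ v ]≔ z))) ⟨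
      ⟦ P? (e [ v ]≔ z) ⟧ * ⟦ codeg? v i e z y ⟧ ∎

  -- A neighbour inside the ball contributes at most `M` edges, one outside it fewer than `D / W`.
  crossing-upper : ∀ D W M i v e → (∀ i e → deg i e ≤ M) →
    W * crossing i v e ≤ W * M * inside D W i v e + D * deg i e
  crossing-upper D W M i v e degM = begin
    W * crossing i v e
      ≡⟨ ∑-*ˡ (allFin n) W _ ⟨
    ∑ (allFin n) (λ y → W * (⟦ P? (e [ i ]≔ y) ⟧ * codeg i v e y))
      ≤⟨ ∑-mono (allFin n) (λ y → ≤-trans (≤-reflexive (exch W ⟦ P? (e [ i ]≔ y) ⟧ (codeg i v e y))) (*⟦⟧-≤ (P? (e [ i ]≔ y)) (pointwise y))) ⟩
    ∑ (allFin n) (λ y → W * M * ⟦ in? D W i v e y ⟧ + D * ⟦ P? (e [ i ]≔ y) ⟧)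
      ≡⟨ trans (∑-+ (allFin n) _ _) (cong₂ _+_ (∑-*ˡ (allFin n) (W * M) _) (∑-*ˡ (allFin n) D _)) ⟩
    W * M * inside D W i v e + D * deg i e ∎
    where
    open ≤-Reasoning
    exch : ∀ w x y → w * (x * y) ≡ w * y * x
    exch = solve-∀
    codeg≤deg : ∀ y → codeg i v e y ≤ deg v e
    codeg≤deg y = card-mono (codeg? i v e y) (λ z → P? (e [ v ]≔ z)) (λ _ → proj₁)
    pointwise : ∀ y → P (e [ i ]≔ y) → W * codeg i v e y ≤ W * M * ⟦ in? D W i v e y ⟧ + D * ⟦ P? (e [ i ]≔ y) ⟧
    pointwise y p = case ball? D W i v e y of λ where
      (yes b) → ≤-trans (*-monoʳ-≤ W (≤-trans (codeg≤deg y) (degM v e)))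
        (≤-trans (≤-reflexive (sym (trans (cong (W * M *_) (⟦⟧-true (in? D W i v e y) (p , b))) (*-identityʳ _)))) (m≤m+n _ _))
      (no ¬b) → ≤-trans (<⇒≤ (≰⇒> ¬b))
        (≤-trans (≤-reflexive (sym (trans (cong (D *_) (⟦⟧-true (P? (e [ i ]≔ y)) p)) (*-identityʳ _)))) (m≤n+m _ _))

  crossing-lower : ∀ D W i v e → D * inside D W i v e ≤ W * crossing i v e
  crossing-lower D W i v e = begin
    D * inside D W i v e                                              ≡⟨ ∑-*ˡ (allFin n) D _ ⟨
    ∑ (allFin n) (λ y → D * ⟦ in? D W i v e y ⟧)                      ≤⟨ ∑-mono (allFin n) (λ y → *⟦⟧-≤ (in? D W i v e y) (pointwise y)) ⟩
    ∑ (allFin n) (λ y → W * (⟦ P? (e [ i ]≔ y) ⟧ * codeg i v e y))    ≡⟨ ∑-*ˡ (allFin n) W _ ⟩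
    W * crossing i v e ∎
    where
    open ≤-Reasoning
    pointwise : ∀ y → P (e [ i ]≔ y) × Ball D W i v e y → D ≤ W * (⟦ P? (e [ i ]≔ y) ⟧ * codeg i v e y)
    pointwise y (p , b) = ≤-trans b (≤-reflexive (cong (W *_) (sym (trans (cong (_* codeg i v e y) (⟦⟧-true (P? (e [ i ]≔ y)) p)) (*-identityˡ _)))))

  -- Sparsity bounds the crossing number by Q²D²/U + QD²/W, which is at most (3/8) D²/W'. A
  -- `W'`-ball around `e_v` with half of the neighbours would force at least (1/2) D²/W'. The term
  -- QD²/W, due to vertices outside the large ball, is what makes `W'` smaller than `W`.
  sparse-reverse : ∀ D Q W W' U i v e → (∀ i e → deg i e ≤ Q * D) → v ≢ i → D ≤ deg v e → 0 < D → 0 < W → 0 < U →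
    4 * W' * (Q * Q) ≤ U → 8 * W' * Q ≤ W →
    U * inside D W i v e < deg i e → 2 * inside D W' v i e < deg v e
  sparse-reverse D Q W W' U i v e degM v≢i D≤deg 0<D 0<W 0<U U-large W-large sparse = ≰⇒> λ dense →
    <⇒≱ positive (+-cancelˡ-≤ (3 * (U * W * (D * D))) _ 0 (begin
      3 * (U * W * (D * D)) + U * W * (D * D)
        ≡⟨ four (U * W * (D * D)) ⟩
      4 * (U * W * (D * D))
        ≤⟨ *-monoʳ-≤ 4 (*-monoʳ-≤ (U * W) (*-monoʳ-≤ D (≤-trans D≤deg dense))) ⟩
      4 * (U * W * (D * (2 * inside D W' v i e)))
        ≡⟨ regroup₁ U W D (inside D W' v i e) ⟩
      8 * U * W * (D * inside D W' v i e)
        ≤⟨ *-monoʳ-≤ (8 * U * W) (crossing-lower D W' v i e) ⟩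
      8 * U * W * (W' * crossing v i e)
        ≡⟨ cong (λ x → 8 * U * W * (W' * x)) (crossing-sym i v e v≢i) ⟨
      8 * U * W * (W' * crossing i v e)
        ≡⟨ regroup₂ U W W' (crossing i v e) ⟩
      8 * U * W' * (W * crossing i v e)
        ≤⟨ *-monoʳ-≤ (8 * U * W') (crossing-upper D W (Q * D) i v e degM) ⟩
      8 * U * W' * (W * (Q * D) * inside D W i v e + D * deg i e)
        ≡⟨ regroup₃ U W' W Q D (inside D W i v e) (deg i e) ⟩
      8 * W' * W * (Q * D) * (U * inside D W i v e) + 8 * U * W' * (D * deg i e)
        ≤⟨ +-mono-≤ (*-monoʳ-≤ (8 * W' * W * (Q * D)) (≤-trans (<⇒≤ sparse) (degM i e))) (*-monoʳ-≤ (8 * U * W') (*-monoʳ-≤ D (degM i e))) ⟩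
      8 * W' * W * (Q * D) * (Q * D) + 8 * U * W' * (D * (Q * D))
        ≡⟨ regroup₄ U W' W Q D ⟩
      4 * W' * (Q * Q) * (2 * W * (D * D)) + 8 * W' * Q * (U * (D * D))
        ≤⟨ +-mono-≤ (*-monoˡ-≤ (2 * W * (D * D)) U-large) (*-monoˡ-≤ (U * (D * D)) W-large) ⟩
      U * (2 * W * (D * D)) + W * (U * (D * D))
        ≡⟨ regroup₅ U W D ⟩
      3 * (U * W * (D * D)) + 0 ∎))
    where
    open ≤-Reasoning
    positive : 0 < U * W * (D * D)
    positive = *-mono-< (*-mono-< 0<U 0<W) (*-mono-< 0<D 0<D)
    four : ∀ x → 3 * x + x ≡ 4 * x
    four = solve-∀
    regroup₁ : ∀ u w d x → 4 * (u * w * (d * (2 * x))) ≡ 8 * u * w * (d * x)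
    regroup₁ = solve-∀
    regroup₂ : ∀ u w w' x → 8 * u * w * (w' * x) ≡ 8 * u * w' * (w * x)
    regroup₂ = solve-∀
    regroup₃ : ∀ u w' w q d x a → 8 * u * w' * (w * (q * d) * x + d * a) ≡ 8 * w' * w * (q * d) * (u * x) + 8 * u * w' * (d * a)
    regroup₃ = solve-∀
    regroup₄ : ∀ u w' w q d → 8 * w' * w * (q * d) * (q * d) + 8 * u * w' * (d * (q * d)) ≡ 4 * w' * (q * q) * (2 * w * (d * d)) + 8 * w' * q * (u * (d * d))
    regroup₄ = solve-∀
    regroup₅ : ∀ u w d → u * (2 * w * (d * d)) + w * (u * (d * d)) ≡ 3 * (u * w * (d * d)) + 0
    regroup₅ = solve-∀

  -- The pairing of positions on a typical edge, and the existence of such an edge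

  module Main {D Q W W' U R : ℕ} (scales : Scales r m c D Q W W' U R) (degM : ∀ i e → deg i e ≤ Q * D) where

    open Scales scales

    record Good (e : Vec (Fin n) r) : Set where
      field
        edge : P e
        D≤deg : ∀ i → D ≤ deg i e
        few-poorPairs : ∀ i → R * poorPairs D W i e ≤ deg i e ^ m
        few-poorPairs' : ∀ i → 9 * poorPairs D W' i e ≤ deg i e ^ m
        few-ballPoors : ∀ i → 4 * (2 * U) ^ m * ballPoors D W i e ≤ deg i e ^ m
        few-noPoors : ∀ i → 4 * (2 * U) ^ m * noPoors i e ≤ deg i e ^ m

    module _ {e : Vec (Fin n) r} (good : Good e) where
      open Good good

      deg-pos : ∀ i → 0 < deg i e
      deg-pos i = <-≤-trans D-pos (D≤deg i)

      -- Formulated with the small ball, the only one for which the reverse direction is controlled,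
      -- and with `outside`, to which the product bound applies.
      Sparse : Fin r → Fin r → Set
      Sparse i j = j ≢ i × deg i e < 2 * outside D W' i j e

      inside-small⇒Sparse : ∀ i j → j ≢ i → 2 * inside D W' i j e < deg i e → Sparse i j
      inside-small⇒Sparse i j j≢i small = j≢i , +-cancelˡ-< (2 * inside D W' i j e) _ _ (begin-strict
        2 * inside D W' i j e + deg i e                       <⟨ +-monoˡ-< (deg i e) small ⟩
        deg i e + deg i e                                     ≡⟨ cong (deg i e +_) (+-identityʳ (deg i e)) ⟨
        2 * deg i e                                           ≤⟨ *-monoʳ-≤ 2 (deg≤inside+outside D W' i j e) ⟩
        2 * (inside D W' i j e + outside D W' i j e)          ≡⟨ *-distribˡ-+ 2 (inside D W' i j e) _ ⟩
        2 * inside D W' i j e + 2 * outside D W' i j e ∎)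
        where open ≤-Reasoning

      -- A direction that is sparse for the large ball is sparse for the small ball it contains; the
      -- reverse direction comes from comparing crossings.
      partner : ∀ i → ∃ λ j → Sparse i j × Sparse j i
      partner i with sparse-direction D W U R i e edge r-pos U-large R-core (deg-pos i)
        (≤-trans D-reps (D≤deg i)) (few-poorPairs i) (few-ballPoors i) (few-noPoors i) (≤-trans D-reps'' (D≤deg i))
      ... | j , j≢i , small = j ,
        inside-small⇒Sparse i j j≢i (≤-<-trans (*-mono-≤ U-large (card-mono (in? D W' i j e) (in? D W i j e)
          (λ y q → proj₁ q , ≤-trans (proj₂ q) (*-monoˡ-≤ (codeg i j e y) W'≤W)))) small) ,
        inside-small⇒Sparse j i (j≢i ∘ sym) (sparse-reverse D Q W W' U i j e degM j≢i (D≤deg j) D-pos W-pos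
          (<-≤-trans (s≤s z≤n) U-large) U-reverse W-reverse small)

      -- Two directions that each lose more than half of the neighbours have a product above
      -- `deg² / 4`, whereas the factor 9 allows only `2 deg² / 9`.
      Sparse-unique : ∀ i u v → Sparse i u → Sparse i v → u ≡ v
      Sparse-unique i u v (u≢i , su) (v≢i , sv) = case u Fin.≟ v of λ where
          (yes u≡v) → u≡v
          (no u≢v) → ⊥-elim (impossible (outside-product-small D W' 9 i e edge (deg-pos i)
            (≤-trans D-reps' (D≤deg i)) (few-poorPairs' i) u v u≢i v≢i u≢v))
        where
        open ≤-Reasoning
        a = deg i e
        x = outside D W' i u e
        y = outside D W' i v e
        regroup : ∀ x y → 2 * (2 * x * (2 * y)) ≡ 8 * (x * y)
        regroup = solve-∀
        eight : ∀ z → 9 * z ≡ 8 * z + z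
        eight = solve-∀
        half-pos : ∀ z → a < 2 * z → 0 < z
        half-pos (suc z) _ = s≤s z≤n
        impossible : ¬ (9 * (x * y) ≤ 2 * (a * a))
        impossible h = <⇒≱ (*-mono-< (half-pos x su) (half-pos y sv)) (+-cancelˡ-≤ (8 * (x * y)) _ 0 (begin
          8 * (x * y) + x * y    ≡⟨ eight (x * y) ⟨
          9 * (x * y)            ≤⟨ h ⟩
          2 * (a * a)            ≤⟨ *-monoʳ-≤ 2 (*-mono-≤ (<⇒≤ su) (<⇒≤ sv)) ⟩
          2 * (2 * x * (2 * y))  ≡⟨ regroup x y ⟩
          8 * (x * y)            ≡⟨ +-identityʳ _ ⟨
          8 * (x * y) + 0 ∎))

      good⇒even : r % 2 ≡ 0
      good⇒even = involution⇒even (λ i → proj₁ (partner i))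
        -- The partner of `i` has both `i` and its own partner as sparse directions, so these
        -- coincide.
        (λ i → Sparse-unique (proj₁ (partner i)) _ i (proj₁ (proj₂ (partner (proj₁ (partner i))))) (proj₂ (proj₂ (partner i))))
        (λ i → proj₁ (proj₁ (proj₂ (partner i))))

    edges : ℕ
    edges = ∑ (tuples n r) (λ e → ⟦ P? e ⟧)

    low? : ∀ i e → Dec (P e × deg i e < D)
    low? i e = P? e ×-dec (deg i e <? D)

    -- The clause `D ≤ deg i e` gives Markov's inequality the uniform weight `D ^ m`; edges of
    -- smaller degree fall under `low?`.
    many? : ∀ k i (X : Vec (Fin n) r → ℕ) e → Dec (D ≤ deg i e × deg i e ^ m < k * X e)
    many? k i X e = (D ≤? deg i e) ×-dec (deg i e ^ m <? k * X e)

    markov : ∀ k i X → D ^ m * ∑ (tuples n r) (λ e → ⟦ many? k i X e ⟧) ≤ k * ∑ (tuples n r) X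
    markov k i X = begin
      D ^ m * ∑ (tuples n r) (λ e → ⟦ many? k i X e ⟧)   ≡⟨ ∑-*ˡ (tuples n r) (D ^ m) _ ⟨
      ∑ (tuples n r) (λ e → D ^ m * ⟦ many? k i X e ⟧)   ≤⟨ ∑-mono (tuples n r) (λ e → *⟦⟧-≤ (many? k i X e)
                                                              (λ q → ≤-trans (^-monoˡ-≤ m (proj₁ q)) (<⇒≤ (proj₂ q)))) ⟩
      ∑ (tuples n r) (λ e → k * X e)                     ≡⟨ ∑-*ˡ (tuples n r) k X ⟩
      k * ∑ (tuples n r) X ∎
      where open ≤-Reasoning

    -- `n-small` is the definition of `Q` up to rounding. It trades the `n ^ m` tuples of the
    -- counting lemmas for the `D ^ m` tuples that a single edge is guaranteed.
    module _ (n-pos : 0 < n) (edges-many : n ^ r * D * (10 * r) ≤ n * edges) (n-small : n ^ suc m' ≤ Q * D ^ m) where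

      private instance
        _ = >-nonZero n-pos
        _ = >-nonZero D-pos
        _ = >-nonZero W-pos
        _ = >-nonZero W'-pos
        _ = >-nonZero r-pos
        _ = m^n≢0 D m
        _ = m*n≢0 10 r
        n*n≢0 = m*n≢0 n n
        n*n*D^m≢0 = m*n≢0 (n * n) (D ^ m)
        n*D^m≢0 = m*n≢0 n (D ^ m)

      edges-many' : n ^ r * D ≤ n * edges
      edges-many' = ≤-trans (m≤m*n (n ^ r * D) (10 * r)) edges-many

      -- The degree in direction `i` is constant on lines in that direction, so either all edges of
      -- a line are low, and there are at most `D` of them, or none is.
      low-few : ∀ i → 10 * r * ∑ (tuples n r) (λ e → ⟦ low? i e ⟧) ≤ edges
      low-few i = *-cancelˡ-≤ n (begin
        n * (10 * r * x)       ≡⟨ exch n (10 * r) x ⟩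
        n * x * (10 * r)       ≤⟨ *-monoˡ-≤ (10 * r) (line-bound n r i _ D line) ⟩
        n ^ r * D * (10 * r)   ≤⟨ edges-many ⟩
        n * edges ∎)
        where
        open ≤-Reasoning
        x = ∑ (tuples n r) (λ e → ⟦ low? i e ⟧)
        exch : ∀ a b c → a * (b * c) ≡ a * c * b
        exch = solve-∀
        line : ∀ e → ∑ (allFin n) (λ y → ⟦ low? i (e [ i ]≔ y) ⟧) ≤ D
        line e = begin
          ∑ (allFin n) (λ y → ⟦ low? i (e [ i ]≔ y) ⟧)
            ≤⟨ ∑-mono (allFin n) (λ y → ≤-trans (⟦⟧-mono (low? i (e [ i ]≔ y)) (P? (e [ i ]≔ y) ×-dec (deg i e <? D))
                 (λ q → proj₁ q , subst (_< D) (deg-update i e y) (proj₂ q))) (≤-reflexive (⟦⟧-× (P? (e [ i ]≔ y)) (deg i e <? D)))) ⟩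
          ∑ (allFin n) (λ y → ⟦ P? (e [ i ]≔ y) ⟧ * ⟦ deg i e <? D ⟧)
            ≡⟨ ∑-*ʳ (allFin n) ⟦ deg i e <? D ⟧ _ ⟩
          deg i e * ⟦ deg i e <? D ⟧
            ≤⟨ *⟦⟧-≤ (deg i e <? D) <⇒≤ ⟩
          D ∎

      -- The bad share of the edges is at most `r * r * c * k * Q / W`. It is needed twice: with `R`
      -- for the large balls and with 9 for the small ones.
      poorPairs-few : ∀ W k i → 0 < W → 10 * r * (r * r * c) * k * Q ≤ W →
        10 * r * ∑ (tuples n r) (λ e → ⟦ many? k i (poorPairs D W i) e ⟧) ≤ edges
      poorPairs-few W k i 0<W W-large = *-cancelˡ-≤ (W * (n * n * D ^ m)) {{m*n≢0 W (n * n * D ^ m) {{>-nonZero 0<W}}}} (begin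
        W * (n * n * D ^ m) * (10 * r * b)
          ≡⟨ regroup₁ W (n * n) (D ^ m) (10 * r) b ⟩
        10 * r * (W * (n * n * (D ^ m * b)))
          ≤⟨ *-monoʳ-≤ (10 * r) (*-monoʳ-≤ W (*-monoʳ-≤ (n * n) (markov k i (poorPairs D W i)))) ⟩
        10 * r * (W * (n * n * (k * x)))
          ≡⟨ regroup₂ (10 * r) W (n * n) k x ⟩
        10 * r * k * (W * (n * n * x))
          ≤⟨ *-monoʳ-≤ (10 * r * k) (poorPairs-count D W i) ⟩
        10 * r * k * (n ^ m * (r * (r * (n ^ r * (c * D)))))
          ≡⟨ regroup₃ (10 * r) k n (n ^ suc m') r (n ^ r) c D ⟩
        10 * r * (r * r * c) * k * (n * n ^ suc m') * (n ^ r * D)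
          ≤⟨ *-mono-≤ (*-monoʳ-≤ (10 * r * (r * r * c) * k) (*-monoʳ-≤ n n-small)) edges-many' ⟩
        10 * r * (r * r * c) * k * (n * (Q * D ^ m)) * (n * edges)
          ≡⟨ regroup₄ (10 * r * (r * r * c) * k) n Q (D ^ m) edges ⟩
        10 * r * (r * r * c) * k * Q * (n * n * D ^ m) * edges
          ≤⟨ *-monoˡ-≤ edges (*-monoˡ-≤ (n * n * D ^ m) W-large) ⟩
        W * (n * n * D ^ m) * edges ∎)
        where
        open ≤-Reasoning
        b = ∑ (tuples n r) (λ e → ⟦ many? k i (poorPairs D W i) e ⟧)
        x = ∑ (tuples n r) (poorPairs D W i)
        regroup₁ : ∀ w n d k b → w * (n * d) * (k * b) ≡ k * (w * (n * (d * b)))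
        regroup₁ = solve-∀
        regroup₂ : ∀ κ w n k x → κ * (w * (n * (k * x))) ≡ κ * k * (w * (n * x))
        regroup₂ = solve-∀
        regroup₃ : ∀ κ k n p r q c d → κ * k * (n * p * (r * (r * (q * (c * d))))) ≡ κ * (r * r * c) * k * (n * p) * (q * d)
        regroup₃ = solve-∀
        regroup₄ : ∀ k n q d x → k * (n * (q * d)) * (n * x) ≡ k * q * (n * n * d) * x
        regroup₄ = solve-∀

      -- Here the cover is used for both coordinates of the plane, so the line bound is `c` instead
      -- of `D / W` and the share becomes `r * r * c * c * k * Q / D`.
      noPoors-few : ∀ k i → 10 * r * k * (r * r * (c * c)) * Q ≤ D →
        10 * r * ∑ (tuples n r) (λ e → ⟦ many? k i (noPoors i) e ⟧) ≤ edges
      noPoors-few k i D-large = *-cancelˡ-≤ (n * n * D ^ m) (begin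
        n * n * D ^ m * (10 * r * b)
          ≡⟨ regroup₁ (n * n) (D ^ m) (10 * r) b ⟩
        10 * r * (n * n * (D ^ m * b))
          ≤⟨ *-monoʳ-≤ (10 * r) (*-monoʳ-≤ (n * n) (markov k i (noPoors i))) ⟩
        10 * r * (n * n * (k * x))
          ≡⟨ regroup₂ (10 * r) (n * n) k x ⟩
        10 * r * k * (n * n * x)
          ≤⟨ *-monoʳ-≤ (10 * r * k) (noPoors-count i) ⟩
        10 * r * k * (n ^ m * (r * (r * (n ^ r * (c * c)))))
          ≡⟨ regroup₃ (10 * r) k n (n ^ suc m') r (n ^ r) c ⟩
        10 * r * k * (r * r * (c * c)) * (n * n ^ suc m') * n ^ r
          ≤⟨ *-monoˡ-≤ (n ^ r) (*-monoʳ-≤ (10 * r * k * (r * r * (c * c))) (*-monoʳ-≤ n n-small)) ⟩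
        10 * r * k * (r * r * (c * c)) * (n * (Q * D ^ m)) * n ^ r
          ≡⟨ regroup₄ (10 * r * k * (r * r * (c * c))) n Q (D ^ m) (n ^ r) ⟩
        10 * r * k * (r * r * (c * c)) * Q * (n * D ^ m * n ^ r)
          ≤⟨ *-monoˡ-≤ (n * D ^ m * n ^ r) D-large ⟩
        D * (n * D ^ m * n ^ r)
          ≡⟨ regroup₅ D n (D ^ m) (n ^ r) ⟩
        n * D ^ m * (n ^ r * D)
          ≤⟨ *-monoʳ-≤ (n * D ^ m) edges-many' ⟩
        n * D ^ m * (n * edges)
          ≡⟨ regroup₆ n (D ^ m) edges ⟩
        n * n * D ^ m * edges ∎)
        where
        open ≤-Reasoning
        b = ∑ (tuples n r) (λ e → ⟦ many? k i (noPoors i) e ⟧)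
        x = ∑ (tuples n r) (noPoors i)
        regroup₁ : ∀ n d k b → n * d * (k * b) ≡ k * (n * (d * b))
        regroup₁ = solve-∀
        regroup₂ : ∀ κ n k x → κ * (n * (k * x)) ≡ κ * k * (n * x)
        regroup₂ = solve-∀
        regroup₃ : ∀ κ k n p r q c → κ * k * (n * p * (r * (r * (q * (c * c))))) ≡ κ * k * (r * r * (c * c)) * (n * p) * q
        regroup₃ = solve-∀
        regroup₄ : ∀ k n q d p → k * (n * (q * d)) * p ≡ k * q * (n * d * p)
        regroup₄ = solve-∀
        regroup₅ : ∀ d n p q → d * (n * p * q) ≡ n * p * (q * d)
        regroup₅ = solve-∀
        regroup₆ : ∀ n p x → n * p * (n * x) ≡ n * n * p * x
        regroup₆ = solve-∀

      -- Balls have at most `W * (Q * Q) * D` elements, which makes the share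
      -- `r * c * k * (W * (Q * Q)) ^ m / D`. With `k = 4 * (2 * U) ^ m` this condition on `D` is
      -- the one of order `Q ^ (9 * m)`.
      ballPoors-few : ∀ k i → 10 * r * k * (r * c) * (W * (Q * Q)) ^ m ≤ D →
        10 * r * ∑ (tuples n r) (λ e → ⟦ many? k i (ballPoors D W i) e ⟧) ≤ edges
      ballPoors-few k i D-large = *-cancelˡ-≤ (n * D ^ m) (begin
        n * D ^ m * (10 * r * b)
          ≡⟨ regroup₁ n (D ^ m) (10 * r) b ⟩
        10 * r * (n * (D ^ m * b))
          ≤⟨ *-monoʳ-≤ (10 * r) (*-monoʳ-≤ n (markov k i (ballPoors D W i))) ⟩
        10 * r * (n * (k * x))
          ≡⟨ regroup₂ (10 * r) n k x ⟩
        10 * r * k * (n * x)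
          ≤⟨ *-monoʳ-≤ (10 * r * k) (ballPoors-count D W (W * (Q * Q) * D) ballK i) ⟩
        10 * r * k * (r * (n ^ r * (c * (W * (Q * Q) * D) ^ m)))
          ≡⟨ cong (λ p → 10 * r * k * (r * (n ^ r * (c * p)))) (^-distribʳ-* m (W * (Q * Q)) D) ⟩
        10 * r * k * (r * (n ^ r * (c * ((W * (Q * Q)) ^ m * D ^ m))))
          ≡⟨ regroup₃ (10 * r * k) r (n ^ r) c ((W * (Q * Q)) ^ m) (D ^ m) ⟩
        10 * r * k * (r * c) * (W * (Q * Q)) ^ m * (n ^ r * D ^ m)
          ≤⟨ *-monoˡ-≤ (n ^ r * D ^ m) D-large ⟩
        D * (n ^ r * D ^ m)
          ≡⟨ regroup₄ D (n ^ r) (D ^ m) ⟩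
        D ^ m * (n ^ r * D)
          ≤⟨ *-monoʳ-≤ (D ^ m) edges-many' ⟩
        D ^ m * (n * edges)
          ≡⟨ regroup₅ (D ^ m) n edges ⟩
        n * D ^ m * edges ∎)
        where
        open ≤-Reasoning
        b = ∑ (tuples n r) (λ e → ⟦ many? k i (ballPoors D W i) e ⟧)
        x = ∑ (tuples n r) (ballPoors D W i)
        ballK : ∀ i u e → card (ball? D W i u e) ≤ W * (Q * Q) * D
        ballK i u e = *-cancelˡ-≤ D (≤-trans (card-ball D W (Q * D) degM i u e) (≤-reflexive (regroup W Q D)))
          where
          regroup : ∀ w q d → w * (q * d * (q * d)) ≡ d * (w * (q * q) * d)
          regroup = solve-∀
        regroup₁ : ∀ n d k b → n * d * (k * b) ≡ k * (n * (d * b))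
        regroup₁ = solve-∀
        regroup₂ : ∀ κ n k x → κ * (n * (k * x)) ≡ κ * k * (n * x)
        regroup₂ = solve-∀
        regroup₃ : ∀ κ r q c w d → κ * (r * (q * (c * (w * d)))) ≡ κ * (r * c) * w * (q * d)
        regroup₃ = solve-∀
        regroup₄ : ∀ d q p → d * (q * p) ≡ p * (q * d)
        regroup₄ = solve-∀
        regroup₅ : ∀ p n x → p * (n * x) ≡ n * p * x
        regroup₅ = solve-∀

      defect : Fin r → Vec (Fin n) r → ℕ
      defect i e = ⟦ low? i e ⟧ + (⟦ many? R i (poorPairs D W i) e ⟧ + (⟦ many? 9 i (poorPairs D W' i) e ⟧
        + (⟦ many? (4 * (2 * U) ^ m) i (ballPoors D W i) e ⟧ + ⟦ many? (4 * (2 * U) ^ m) i (noPoors i) e ⟧)))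

      defects-few : ∀ i → 10 * r * ∑ (tuples n r) (defect i) ≤ 5 * edges
      defects-few i = add 4 low (low-few i) (add 3 pp₁ (poorPairs-few W R i W-pos W-poor) (add 2 pp₂ (poorPairs-few W' 9 i W'-pos W'-poor)
        (add 1 bp (ballPoors-few V i D-ball) (≤-trans (noPoors-few V i D-noPoor) (≤-reflexive (sym (*-identityˡ edges)))))))
        where
        V = 4 * (2 * U) ^ m
        low pp₁ pp₂ bp : Vec (Fin n) r → ℕ
        low e = ⟦ low? i e ⟧
        pp₁ e = ⟦ many? R i (poorPairs D W i) e ⟧
        pp₂ e = ⟦ many? 9 i (poorPairs D W' i) e ⟧
        bp e = ⟦ many? V i (ballPoors D W i) e ⟧
        add : ∀ k f {g} → 10 * r * ∑ (tuples n r) f ≤ edges → 10 * r * ∑ (tuples n r) g ≤ k * edges →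
          10 * r * ∑ (tuples n r) (λ e → f e + g e) ≤ suc k * edges
        add k f {g} p q = ≤-trans (≤-reflexive (trans (cong (10 * r *_) (∑-+ (tuples n r) f g)) (*-distribˡ-+ (10 * r) _ _))) (+-mono-≤ p q)

      edges-pos : 0 < edges
      edges-pos = *-cancelˡ-< n 0 edges (subst (_< n * edges) (sym (*-zeroʳ n)) (<-≤-trans (*-mono-< (m^n>0 n r) D-pos) edges-many'))

      -- Five kinds of defect at `r` positions, each affecting at most `edges / (10 r)` tuples, add
      -- up to at most half of the edges.
      defects<edges : ∑ (tuples n r) (λ e → ∑ (allFin r) (λ i → defect i e)) < edges
      defects<edges = ≰⇒> λ h → <⇒≱ edges-pos (+-cancelˡ-≤ edges edges 0 (begin
        edges + edges    ≡⟨ cong (edges +_) (+-identityʳ edges) ⟨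
        2 * edges        ≤⟨ *-monoʳ-≤ 2 h ⟩
        2 * d            ≤⟨ *-cancelˡ-≤ (5 * r) {{m*n≢0 5 r}} (begin
          5 * r * (2 * d)                     ≡⟨ regroup₁ r d ⟩
          10 * r * d                          ≤⟨ ∑-union (allFin r) (tuples n r) defect (10 * r) (5 * edges) defects-few ⟩
          length (allFin r) * (5 * edges)     ≡⟨ cong (_* (5 * edges)) (length-allFin r) ⟩
          r * (5 * edges)                     ≡⟨ regroup₂ r edges ⟩
          5 * r * edges ∎) ⟩
        edges            ≡⟨ +-identityʳ edges ⟨
        edges + 0 ∎))
        where
        open ≤-Reasoning
        d = ∑ (tuples n r) (λ e → ∑ (allFin r) (λ i → defect i e))
        regroup₁ : ∀ r d → 5 * r * (2 * d) ≡ 10 * r * d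
        regroup₁ = solve-∀
        regroup₂ : ∀ r x → r * (5 * x) ≡ 5 * r * x
        regroup₂ = solve-∀

      defect-free⇒Good : ∀ e → ∑ (allFin r) (λ i → defect i e) < ⟦ P? e ⟧ → Good e
      defect-free⇒Good e lt = record
        { edge = Pe
        ; D≤deg = D≤deg
        ; few-poorPairs = λ i → few i R (poorPairs D W i) (proj₁ (proj₂ (parts i)))
        ; few-poorPairs' = λ i → few i 9 (poorPairs D W' i) (proj₁ (proj₂ (proj₂ (parts i))))
        ; few-ballPoors = λ i → few i (4 * (2 * U) ^ m) (ballPoors D W i) (proj₁ (proj₂ (proj₂ (proj₂ (parts i)))))
        ; few-noPoors = λ i → few i (4 * (2 * U) ^ m) (noPoors i) (proj₂ (proj₂ (proj₂ (proj₂ (parts i))))) }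
        where
        Pe : P e
        Pe = ⟦⟧-pos (P? e) (≤-<-trans z≤n lt)
        zero-below : ∀ {a b c} → a ≤ b → b < c → c ≤ 1 → a ≤ 0
        zero-below p q t = ≤-trans p (≤-pred (≤-trans q t))
        none : ∀ i → defect i e ≤ 0
        none i = zero-below (∑-term (λ i → defect i e) (∈-allFin i)) lt (⟦⟧≤1 (P? e))
        split : ∀ a b c d f → a + (b + (c + (d + f))) ≤ 0 → a ≤ 0 × b ≤ 0 × c ≤ 0 × d ≤ 0 × f ≤ 0
        split zero zero zero zero zero _ = z≤n , z≤n , z≤n , z≤n , z≤n
        parts : ∀ i → ⟦ low? i e ⟧ ≤ 0 × ⟦ many? R i (poorPairs D W i) e ⟧ ≤ 0 × ⟦ many? 9 i (poorPairs D W' i) e ⟧ ≤ 0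
          × ⟦ many? (4 * (2 * U) ^ m) i (ballPoors D W i) e ⟧ ≤ 0 × ⟦ many? (4 * (2 * U) ^ m) i (noPoors i) e ⟧ ≤ 0
        parts i = split ⟦ low? i e ⟧ ⟦ many? R i (poorPairs D W i) e ⟧ ⟦ many? 9 i (poorPairs D W' i) e ⟧
          ⟦ many? (4 * (2 * U) ^ m) i (ballPoors D W i) e ⟧ ⟦ many? (4 * (2 * U) ^ m) i (noPoors i) e ⟧ (none i)
        zero⇒¬ : {A : Set} (d : Dec A) → ⟦ d ⟧ ≤ 0 → ¬ A
        zero⇒¬ (no ¬a) _ = ¬a
        D≤deg : ∀ i → D ≤ deg i e
        D≤deg i = ≮⇒≥ λ lt → zero⇒¬ (low? i e) (proj₁ (parts i)) (Pe , lt)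
        few : ∀ i k X → ⟦ many? k i X e ⟧ ≤ 0 → k * X e ≤ deg i e ^ m
        few i k X h = ≮⇒≥ λ lt → zero⇒¬ (many? k i X e) h (D≤deg i , lt)

      even-uniformity : r % 2 ≡ 0
      even-uniformity = good⇒even (defect-free⇒Good _ (proj₂
        (∑-<⇒∃ (tuples n r) (λ e → ∑ (allFin r) (λ i → defect i e)) (λ e → ⟦ P? e ⟧) defects<edges)))

-- Reduction to bounded codegrees

-- This is what `3 ≤ r` provides: besides `i` and the cover position `j` there is a coordinate along
-- which to count.
third : ∀ {r} → 3 ≤ r → (i j : Fin r) → ∃ λ l → l ≢ i × j ≢ l
third (s≤s (s≤s (s≤s _))) zero zero = suc zero , (λ ()) , (λ ())
third (s≤s (s≤s (s≤s _))) zero (suc zero) = suc (suc zero) , (λ ()) , (λ ())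
third (s≤s (s≤s (s≤s _))) zero (suc (suc j)) = suc zero , (λ ()) , (λ ())
third (s≤s (s≤s (s≤s _))) (suc zero) zero = suc (suc zero) , (λ ()) , (λ ())
third (s≤s (s≤s (s≤s _))) (suc (suc i)) zero = suc zero , (λ ()) , (λ ())
third (s≤s (s≤s (s≤s _))) (suc i) (suc j) = zero , (λ ()) , (λ ())

module Regularize {n r m' c : ℕ} (3≤r : 3 ≤ r) {P : Vec (Fin n) r → Set} (P? : ∀ e → Dec (P e))
  (Z : Fin r → Vec (Fin n) (3 + m') → List (Fin n))
  (Z≤c : ∀ i S → length (Z i S) ≤ c)
  (covers : ∀ i S → ¬ Repeats [] S → ∀ e → Edges.Common P? i S e → ∃ λ j → j ≢ i × lookup e j ∈ Z i S)
  where

  open Edges P?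
  open CoverCount {n} {r} {2 + m'} {c} Z Z≤c
  open Counting {n} {r} {2 + m'} {c} P? Z Z≤c covers using (Proper; proper?)
  open EdgeAnalysis {n} {r} {m'} {c} P? Z Z≤c covers using (m; reps; reps-small; proper)

  private
    p : ℕ
    p = suc m'
    K : ℕ
    K = n ^ m * (r * (r * (n ^ r * c)))

  deg≤n : ∀ i e → deg i e ≤ n
  deg≤n i e = ≤-trans (∑-bound (allFin n) 1 (λ y → ⟦⟧≤1 (P? (e [ i ]≔ y)))) (≤-reflexive (trans (*-identityʳ _) (length-allFin n)))

  -- A dyadic class: the upper bound at all positions controls lines in every direction, the lower
  -- bound at `i` provides many tuples.
  level? : ∀ i M e → Dec (P e × M < deg i e × (∀ j → deg j e ≤ 2 * M))
  level? i M e = P? e ×-dec (M <? deg i e) ×-dec Fin.all? (λ j → deg j e ≤? 2 * M)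

  proper-many : ∀ i e → P e → m * suc m * 2 ≤ deg i e → 0 < deg i e →
    deg i e ^ m ≤ 2 * ∑ (tuples n m) (λ T → ⟦ proper? i (lookup e i ∷ T) e ⟧)
  proper-many i e Pe large pos = +-cancelʳ-≤ (d ^ m) (d ^ m) (2 * X) (begin
    d ^ m + d ^ m             ≡⟨ cong (d ^ m +_) (+-identityʳ (d ^ m)) ⟨
    2 * d ^ m                 ≡⟨ cong (2 *_) (∑-tuples-all (λ y → P? (e [ i ]≔ y)) m) ⟨
    2 * ∑ (tuples n m) (λ T → ⟦ common? i T e ⟧)
      ≤⟨ *-monoʳ-≤ 2 (≤-trans (∑-mono (tuples n m) split) (≤-reflexive (∑-+ (tuples n m) _ _))) ⟩
    2 * (X + reps i e)        ≡⟨ *-distribˡ-+ 2 X (reps i e) ⟩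
    2 * X + 2 * reps i e      ≤⟨ +-monoʳ-≤ (2 * X) (reps-small i e 2 large pos) ⟩
    2 * X + d ^ m ∎)
    where
    open ≤-Reasoning
    d = deg i e
    X = ∑ (tuples n m) (λ T → ⟦ proper? i (lookup e i ∷ T) e ⟧)
    split : ∀ T → ⟦ common? i T e ⟧ ≤ ⟦ proper? i (lookup e i ∷ T) e ⟧ + ⟦ common? i T e ⟧ * ⟦ repeats? (lookup e i ∷ []) T ⟧
    split T = ≤-trans
      (⟦⟧-∪ (common? i T e) (proper? i (lookup e i ∷ T) e) (common? i T e ×-dec repeats? (lookup e i ∷ []) T)
        (λ com → case repeats? (lookup e i ∷ []) T of λ where
          (yes rep) → inj₂ (com , rep)
          (no nr) → inj₁ (proper i e T Pe com nr)))
      (≤-reflexive (cong (⟦ proper? i (lookup e i ∷ T) e ⟧ +_) (⟦⟧-× (common? i T e) (repeats? (lookup e i ∷ []) T))))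

  -- Each edge of the class has at least `M ^ m / 2` proper tuples, and a line in any direction
  -- contains at most `2 * M` edges of the class. Dividing by `M` leaves the exponent `p`, that is
  -- `m - 1`.
  level-count : ∀ i M → m * suc m * 2 ≤ M →
    n * n * M ^ p * ∑ (tuples n r) (λ e → ⟦ level? i M e ⟧) ≤ 4 * K
  level-count i M large = *-cancelˡ-≤ M (begin
    M * (n * n * M ^ p * X)
      ≡⟨ regroup₁ M (n * n) (M ^ p) X ⟩
    n * n * (M ^ m * X)
      ≡⟨ cong (n * n *_) (∑-*ˡ (tuples n r) (M ^ m) _) ⟨
    n * n * ∑ (tuples n r) (λ e → M ^ m * ⟦ level? i M e ⟧)
      ≤⟨ *-monoʳ-≤ (n * n) (∑-mono (tuples n r) many) ⟩
    n * n * ∑ (tuples n r) (λ e → 2 * ∑ (tuples n m) (F e))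
      ≡⟨ trans (cong (n * n *_) (∑-*ˡ (tuples n r) 2 _)) (exch (n * n) 2 _) ⟩
    2 * (n * n * ∑ (tuples n r) (λ e → ∑ (tuples n m) (F e)))
      ≤⟨ *-monoʳ-≤ 2 (cover-count i F G (2 * M) line dom) ⟩
    2 * (n ^ m * (r * (r * (n ^ r * (c * (2 * M))))))
      ≡⟨ regroup₂ (n ^ m) r (n ^ r) c M ⟩
    M * (4 * K) ∎)
    where
    open ≤-Reasoning
    instance
      _ = >-nonZero (<-≤-trans (s≤s z≤n) large)
    X = ∑ (tuples n r) (λ e → ⟦ level? i M e ⟧)
    F : Vec (Fin n) r → Vec (Fin n) m → ℕ
    F e T = ⟦ proper? i (lookup e i ∷ T) e ⟧ * ⟦ level? i M e ⟧
    G : Fin r → Vec (Fin n) r → Vec (Fin n) m → ℕ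
    G l e T = ⟦ level? i M e ⟧
    regroup₁ : ∀ a n b x → a * (n * b * x) ≡ n * (a * b * x)
    regroup₁ = solve-∀
    exch : ∀ a b x → a * (b * x) ≡ b * (a * x)
    exch = solve-∀
    regroup₂ : ∀ a r b c x → 2 * (a * (r * (r * (b * (c * (2 * x)))))) ≡ x * (4 * (a * (r * (r * (b * c)))))
    regroup₂ = solve-∀
    many : ∀ e → M ^ m * ⟦ level? i M e ⟧ ≤ 2 * ∑ (tuples n m) (F e)
    many e = ≤-trans (scaled (level? i M e) bound) (≤-reflexive
      (trans (*-assoc 2 (∑ (tuples n m) (λ T → ⟦ proper? i (lookup e i ∷ T) e ⟧)) ⟦ level? i M e ⟧) (cong (2 *_) (sym (∑-*ʳ (tuples n m) ⟦ level? i M e ⟧ (λ T → ⟦ proper? i (lookup e i ∷ T) e ⟧))))))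
      where
      scaled : {A : Set} (d : Dec A) {a b : ℕ} → (A → a ≤ b) → a * ⟦ d ⟧ ≤ b * ⟦ d ⟧
      scaled (yes q) h = *-monoˡ-≤ 1 (h q)
      scaled (no _) {a} h = ≤-trans (≤-reflexive (*-zeroʳ a)) z≤n
      bound : P e × M < deg i e × (∀ j → deg j e ≤ 2 * M) → M ^ m ≤ 2 * ∑ (tuples n m) (λ T → ⟦ proper? i (lookup e i ∷ T) e ⟧)
      bound (Pe , M<d , _) = ≤-trans (^-monoˡ-≤ m (<⇒≤ M<d))
        (proper-many i e Pe (≤-trans large (<⇒≤ M<d)) (≤-<-trans z≤n M<d))
    line : ∀ l → l ≢ i → ∀ e T → ∑ (allFin n) (λ z → G l (e [ l ]≔ z) T) ≤ 2 * M
    line l _ e T = begin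
      ∑ (allFin n) (λ z → ⟦ level? i M (e [ l ]≔ z) ⟧)
        ≤⟨ ∑-mono (allFin n) (λ z → ≤-trans (⟦⟧-mono (level? i M (e [ l ]≔ z)) (P? (e [ l ]≔ z) ×-dec (deg l e ≤? 2 * M))
             (λ q → proj₁ q , subst (_≤ 2 * M) (deg-update l e z) (proj₂ (proj₂ q) l)))
             (≤-reflexive (⟦⟧-× (P? (e [ l ]≔ z)) (deg l e ≤? 2 * M)))) ⟩
      ∑ (allFin n) (λ z → ⟦ P? (e [ l ]≔ z) ⟧ * ⟦ deg l e ≤? 2 * M ⟧)
        ≡⟨ ∑-*ʳ (allFin n) ⟦ deg l e ≤? 2 * M ⟧ _ ⟩
      deg l e * ⟦ deg l e ≤? 2 * M ⟧
        ≤⟨ *⟦⟧-≤ (deg l e ≤? 2 * M) id ⟩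
      2 * M ∎
    dom : Dominated i F G
    dom e T with ⟦⟧-cases (proper? i (lookup e i ∷ T) e)
    ... | inj₁ F≡0 = inj₁ (cong (_* ⟦ level? i M e ⟧) F≡0)
    ... | inj₂ (com , nr) with covers i (lookup e i ∷ T) nr e com
    ... | j , j≢i , j∈Z with third 3≤r i j
    ... | l , l≢i , j≢l = inj₂ (j , l , (j≢i , l≢i , j≢l , j∈Z) ,
      ≤-trans (*-monoˡ-≤ ⟦ level? i M e ⟧ (⟦⟧≤1 (proper? i (lookup e i ∷ T) e))) (≤-reflexive (*-identityˡ _)))

  big? : ∀ M e → Dec (P e × ∃ λ i → M < deg i e)
  big? M e = P? e ×-dec Fin.any? (λ i → M <? deg i e)

  bigs : ℕ → ℕ
  bigs M = ∑ (tuples n r) (λ e → ⟦ big? M e ⟧)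

  bigs-step : ∀ M → bigs M ≤ bigs (2 * M) + ∑ (tuples n r) (λ e → ∑ (allFin r) (λ i → ⟦ level? i M e ⟧))
  bigs-step M = ≤-trans (∑-mono (tuples n r) pointwise) (≤-reflexive (∑-+ (tuples n r) _ _))
    where
    pointwise : ∀ e → ⟦ big? M e ⟧ ≤ ⟦ big? (2 * M) e ⟧ + ∑ (allFin r) (λ i → ⟦ level? i M e ⟧)
    pointwise e = ⟦⟧-≤ (big? M e) λ where
      (Pe , i , M<d) → case Fin.any? (λ i → 2 * M <? deg i e) of λ where
        (yes q) → ≤-trans (≤-reflexive (sym (⟦⟧-true (big? (2 * M) e) (Pe , q)))) (m≤m+n _ _)
        (no ¬q) → ≤-trans (≤-reflexive (sym (⟦⟧-true (level? i M e) (Pe , M<d , λ j → ≮⇒≥ (λ lt → ¬q (j , lt))))))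
          (≤-trans (∑-term (λ i → ⟦ level? i M e ⟧) (∈-allFin i)) (m≤n+m _ _))

  -- A geometric series over the dyadic classes, summed from the top, where degrees above `n` do not
  -- occur. Doubling `M` multiplies `M ^ p` by at least 2 because `p ≥ 1`, that is `s ≥ 3`.
  bigs-count : ∀ k M → n ≤ M * 2 ^ k → m * suc m * 2 ≤ M → n * n * M ^ p * bigs M ≤ 8 * (r * K)
  bigs-count zero M n≤M large = ≤-trans (≤-reflexive (trans (cong (n * n * M ^ p *_) none) (*-zeroʳ (n * n * M ^ p)))) z≤n
    where
    none : bigs M ≡ 0
    none = ∑-zero (tuples n r) (λ e → ⟦⟧-false (big? M e) (λ where
      (_ , i , M<d) → <⇒≱ M<d (≤-trans (deg≤n i e) (≤-trans n≤M (≤-reflexive (*-identityʳ M))))))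
  bigs-count (suc k) M n≤M large = begin
    Y * bigs M                                    ≤⟨ *-monoʳ-≤ Y (bigs-step M) ⟩
    Y * (bigs (2 * M) + L)                        ≡⟨ *-distribˡ-+ Y (bigs (2 * M)) L ⟩
    Y * bigs (2 * M) + Y * L                      ≤⟨ +-mono-≤ above (∑-union (allFin r) (tuples n r) (λ i e → ⟦ level? i M e ⟧) Y (4 * K) (λ i → level-count i M large)) ⟩
    4 * (r * K) + length (allFin r) * (4 * K)     ≡⟨ cong (λ x → 4 * (r * K) + x * (4 * K)) (length-allFin r) ⟩
    4 * (r * K) + r * (4 * K)                     ≡⟨ regroup r K ⟩
    8 * (r * K) ∎
    where
    open ≤-Reasoning
    Y = n * n * M ^ p
    L = ∑ (tuples n r) (λ e → ∑ (allFin r) (λ i → ⟦ level? i M e ⟧))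
    regroup : ∀ r x → 4 * (r * x) + r * (4 * x) ≡ 8 * (r * x)
    regroup = solve-∀
    above : Y * bigs (2 * M) ≤ 4 * (r * K)
    above = *-cancelˡ-≤ 2 (begin
      2 * (n * n * M ^ p * bigs (2 * M))            ≡⟨ regroup₁ (n * n) (M ^ p) (bigs (2 * M)) ⟩
      n * n * (2 * 1 * M ^ p) * bigs (2 * M)        ≤⟨ *-monoˡ-≤ (bigs (2 * M)) (*-monoʳ-≤ (n * n) (*-monoˡ-≤ (M ^ p) (*-monoʳ-≤ 2 (m^n>0 2 m')))) ⟩
      n * n * (2 ^ p * M ^ p) * bigs (2 * M)        ≡⟨ cong (λ x → n * n * x * bigs (2 * M)) (^-distribʳ-* p 2 M) ⟨
      n * n * (2 * M) ^ p * bigs (2 * M)            ≤⟨ bigs-count k (2 * M) (≤-trans n≤M (≤-reflexive (regroup₂ M (2 ^ k)))) (≤-trans large (m≤n*m M 2)) ⟩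
      8 * (r * K)                                   ≡⟨ regroup₃ (r * K) ⟩
      2 * (4 * (r * K)) ∎)
      where
      regroup₁ : ∀ n x y → 2 * (n * x * y) ≡ n * (2 * 1 * x) * y
      regroup₁ = solve-∀
      regroup₂ : ∀ x y → x * (2 * y) ≡ 2 * x * y
      regroup₂ = solve-∀
      regroup₃ : ∀ x → 8 * x ≡ 2 * (4 * x)
      regroup₃ = solve-∀

  Regular : ℕ → Vec (Fin n) r → Set
  Regular M e = P e × (∀ i → deg i e ≤ M)

  regular? : ∀ M e → Dec (Regular M e)
  regular? M e = P? e ×-dec Fin.all? (λ i → deg i e ≤? M)

  -- Regularity refers to degrees in `P`: a line with more than `M` edges of `P` contains no regular
  -- edge at all.
  regular-deg : ∀ M i e → Edges.deg (regular? M) i e ≤ M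
  regular-deg M i e = begin
    ∑ (allFin n) (λ y → ⟦ regular? M (e [ i ]≔ y) ⟧)
      ≤⟨ ∑-mono (allFin n) (λ y → ≤-trans (⟦⟧-mono (regular? M (e [ i ]≔ y)) (P? (e [ i ]≔ y) ×-dec (deg i e ≤? M))
           (λ q → proj₁ q , subst (_≤ M) (deg-update i e y) (proj₂ q i))) (≤-reflexive (⟦⟧-× (P? (e [ i ]≔ y)) (deg i e ≤? M)))) ⟩
    ∑ (allFin n) (λ y → ⟦ P? (e [ i ]≔ y) ⟧ * ⟦ deg i e ≤? M ⟧)
      ≡⟨ ∑-*ʳ (allFin n) ⟦ deg i e ≤? M ⟧ _ ⟩
    deg i e * ⟦ deg i e ≤? M ⟧
      ≤⟨ *⟦⟧-≤ (deg i e ≤? M) id ⟩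
    M ∎
    where open ≤-Reasoning

  edges : ℕ
  edges = ∑ (tuples n r) (λ e → ⟦ P? e ⟧)

  regulars : ℕ → ℕ
  regulars M = ∑ (tuples n r) (λ e → ⟦ regular? M e ⟧)

  edges≤regulars+bigs : ∀ M → edges ≤ regulars M + bigs M
  edges≤regulars+bigs M = ≤-trans
    (∑-mono (tuples n r) (λ e → ⟦⟧-∪ (P? e) (regular? M e) (big? M e) (λ Pe → case Fin.any? (λ i → M <? deg i e) of λ where
      (yes q) → inj₂ (Pe , q)
      (no ¬q) → inj₁ (Pe , λ i → ≮⇒≥ (λ lt → ¬q (i , lt))))))
    (≤-reflexive (∑-+ (tuples n r) _ _))

  -- At `M = Q * D` the series bound and `n-small` give at most `8 r r r c n^r D / n` big edges,
  -- since `Q ≤ Q ^ p`. This is at most 8/20 of all edges.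
  regulars-many : ∀ D Q → 0 < n → 0 < c → 0 < Q → 0 < D → m * suc m * 2 ≤ D →
    n ^ r * D * (20 * (r * r * r * c)) ≤ n * edges → n ^ p ≤ Q * D ^ m → edges ≤ 2 * regulars (Q * D)
  regulars-many D Q n-pos c-pos Q-pos D-pos D-large edges-many n-small = +-cancelʳ-≤ edges edges (2 * G) (begin
    edges + edges      ≡⟨ cong (edges +_) (+-identityʳ edges) ⟨
    2 * edges          ≤⟨ *-monoʳ-≤ 2 (edges≤regulars+bigs (Q * D)) ⟩
    2 * (G + F)        ≡⟨ *-distribˡ-+ 2 G F ⟩
    2 * G + 2 * F      ≤⟨ +-monoʳ-≤ (2 * G) few ⟩
    2 * G + edges ∎)
    where
    open ≤-Reasoning
    instance
      _ = >-nonZero n-pos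
      _ = >-nonZero c-pos
      _ = >-nonZero Q-pos
      _ = >-nonZero D-pos
      _ = >-nonZero (<-≤-trans (s≤s z≤n) 3≤r)
      Q*D≢0 = m*n≢0 Q D
      n*n≢0 = m*n≢0 n n
      [Q*D]^p≢0 = m^n≢0 (Q * D) p
    G = regulars (Q * D)
    F = bigs (Q * D)
    C = r * r * r * c
    instance
      C≢0 = m*n≢0 (r * r * r) c {{m*n≢0 (r * r) r {{m*n≢0 r r}}}}
      8C≢0 = m*n≢0 8 C
      Y≢0 = m*n≢0 (n * n) ((Q * D) ^ p)
      8CY≢0 = m*n≢0 (8 * C) (n * n * (Q * D) ^ p)
    n≤2^n : ∀ k → k ≤ 2 ^ k
    n≤2^n zero = z≤n
    n≤2^n (suc k) = ≤-trans (+-mono-≤ (m^n>0 2 k) (n≤2^n k)) (≤-reflexive (cong (2 ^ k +_) (sym (+-identityʳ (2 ^ k)))))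
    Q*D^p≤ : Q * D ^ p ≤ (Q * D) ^ p
    Q*D^p≤ = ≤-trans (*-monoˡ-≤ (D ^ p) (≤-trans (≤-reflexive (sym (*-identityʳ Q))) (*-monoʳ-≤ Q (m^n>0 Q m'))))
      (≤-reflexive (sym (^-distribʳ-* p Q D)))
    few : 2 * F ≤ edges
    few = *-cancelˡ-≤ (8 * C * (n * n * (Q * D) ^ p)) (begin
      8 * C * (n * n * (Q * D) ^ p) * (2 * F)
        ≡⟨ regroup₁ C (n * n * (Q * D) ^ p) F ⟩
      16 * C * (n * n * (Q * D) ^ p * F)
        ≤⟨ *-mono-≤ (*-monoˡ-≤ C (m≤m+n 16 4)) (bigs-count n (Q * D) (≤-trans (n≤2^n n) (m≤n*m (2 ^ n) (Q * D))) (≤-trans D-large (m≤n*m D Q))) ⟩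
      20 * C * (8 * (r * K))
        ≡⟨ regroup₂ (20 * C) n (n ^ p) r (n ^ r) c ⟩
      20 * C * (8 * C * (n * n ^ p * n ^ r))
        ≤⟨ *-monoʳ-≤ (20 * C) (*-monoʳ-≤ (8 * C) (*-monoˡ-≤ (n ^ r) (*-monoʳ-≤ n n-small))) ⟩
      20 * C * (8 * C * (n * (Q * D ^ m) * n ^ r))
        ≡⟨ regroup₃ (20 * C) (8 * C) n Q D (D ^ p) (n ^ r) ⟩
      8 * C * n * (Q * D ^ p) * (n ^ r * D * (20 * C))
        ≤⟨ *-mono-≤ (*-monoʳ-≤ (8 * C * n) Q*D^p≤) edges-many ⟩
      8 * C * n * (Q * D) ^ p * (n * edges)
        ≡⟨ regroup₄ (8 * C) n ((Q * D) ^ p) edges ⟩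
      8 * C * (n * n * (Q * D) ^ p) * edges ∎)
      where
      regroup₁ : ∀ c y f → 8 * c * y * (2 * f) ≡ 16 * c * (y * f)
      regroup₁ = solve-∀
      regroup₂ : ∀ a n x r y c → a * (8 * (r * (n * x * (r * (r * (y * c)))))) ≡ a * (8 * (r * r * r * c) * (n * x * y))
      regroup₂ = solve-∀
      regroup₃ : ∀ a b n q d x y → a * (b * (n * (q * (d * x)) * y)) ≡ b * n * (q * x) * (y * d * a)
      regroup₃ = solve-∀
      regroup₄ : ∀ a n x y → a * n * x * (n * y) ≡ a * (n * n * x) * y
      regroup₄ = solve-∀

  dense⇒even : ∀ {D Q W W' U R} → Scales r m c D Q W W' U R → 0 < n → 0 < c → m * suc m * 2 ≤ D →
    n ^ r * D * (20 * (r * r * r * c)) ≤ n * edges → n ^ p ≤ Q * D ^ m → r % 2 ≡ 0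
  dense⇒even {D} {Q} scales n-pos c-pos D-large edges-many n-small =
    EdgeAnalysis.Main.even-uniformity {n} {r} {m'} {c} (regular? (Q * D)) Z Z≤c covers' scales (regular-deg (Q * D)) n-pos many n-small
    where
    open ≤-Reasoning
    instance
      _ = >-nonZero n-pos
      _ = >-nonZero c-pos
      _ = >-nonZero (<-≤-trans (s≤s z≤n) 3≤r)
      rrc≢0 = m*n≢0 (r * r) c {{m*n≢0 r r}}
    -- Discarding edges only shrinks common links, so the same covers serve the regular edges.
    covers' : ∀ i S → ¬ Repeats [] S → ∀ e → Edges.Common (regular? (Q * D)) i S e → ∃ λ j → j ≢ i × lookup e j ∈ Z i S
    covers' i S nr e com = covers i S nr e (All.map proj₁ com)
    many : n ^ r * D * (10 * r) ≤ n * regulars (Q * D)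
    many = *-cancelˡ-≤ 2 (begin
      2 * (n ^ r * D * (10 * r))             ≡⟨ regroup₁ (n ^ r * D) r ⟩
      n ^ r * D * (20 * r)                   ≤⟨ *-monoʳ-≤ (n ^ r * D) (*-monoʳ-≤ 20 (m≤m*n r (r * r * c))) ⟩
      n ^ r * D * (20 * (r * (r * r * c)))   ≡⟨ cong (λ x → n ^ r * D * (20 * x)) (regroup₂ r c) ⟩
      n ^ r * D * (20 * (r * r * r * c))     ≤⟨ edges-many ⟩
      n * edges                              ≤⟨ *-monoʳ-≤ n (regulars-many D Q n-pos c-pos (Scales.Q-pos scales) (Scales.D-pos scales) D-large edges-many n-small) ⟩
      n * (2 * regulars (Q * D))             ≡⟨ regroup₃ n (regulars (Q * D)) ⟩
      2 * (n * regulars (Q * D)) ∎)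
      where
      regroup₁ : ∀ a r → 2 * (a * (10 * r)) ≡ a * (20 * r)
      regroup₁ = solve-∀
      regroup₂ : ∀ r c → r * (r * r * c) ≡ r * r * r * c
      regroup₂ = solve-∀
      regroup₃ : ∀ n x → n * (2 * x) ≡ 2 * (n * x)
      regroup₃ = solve-∀

-- From hypergraphs to tuples

∣p∪q∣≤∣p∣+∣q∣ : ∀ {n} (p q : Subset n) → ∣ p ∪ q ∣ ≤ ∣ p ∣ + ∣ q ∣
∣p∪q∣≤∣p∣+∣q∣ [] [] = z≤n
∣p∪q∣≤∣p∣+∣q∣ (true ∷ p) (true ∷ q) = s≤s (≤-trans (∣p∪q∣≤∣p∣+∣q∣ p q) (+-monoʳ-≤ ∣ p ∣ (n≤1+n ∣ q ∣)))
∣p∪q∣≤∣p∣+∣q∣ (true ∷ p) (false ∷ q) = s≤s (∣p∪q∣≤∣p∣+∣q∣ p q)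
∣p∪q∣≤∣p∣+∣q∣ (false ∷ p) (true ∷ q) = ≤-trans (s≤s (∣p∪q∣≤∣p∣+∣q∣ p q)) (≤-reflexive (sym (+-suc ∣ p ∣ ∣ q ∣)))
∣p∪q∣≤∣p∣+∣q∣ (false ∷ p) (false ∷ q) = ∣p∪q∣≤∣p∣+∣q∣ p q

setOf : ∀ {n r} → Vec (Fin n) r → Subset n
setOf [] = ⊥
setOf (x ∷ e) = ⁅ x ⁆ ∪ setOf e

∈-setOf⁺ : ∀ {n r} (e : Vec (Fin n) r) j → lookup e j ∈ˢ setOf e
∈-setOf⁺ (x ∷ e) zero = x∈p∪q⁺ (inj₁ (x∈⁅x⁆ x))
∈-setOf⁺ (x ∷ e) (suc j) = x∈p∪q⁺ {p = ⁅ x ⁆} (inj₂ (∈-setOf⁺ e j))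

∈-setOf⁻ : ∀ {n r} (e : Vec (Fin n) r) {y} → y ∈ˢ setOf e → ∃ λ j → lookup e j ≡ y
∈-setOf⁻ [] y∈ = ⊥-elim (∉⊥ y∈)
∈-setOf⁻ (x ∷ e) y∈ with x∈p∪q⁻ ⁅ x ⁆ (setOf e) y∈
... | inj₁ p = zero , sym (x∈⁅y⁆⇒x≡y x p)
... | inj₂ q with ∈-setOf⁻ e q
...   | j , eq = suc j , eq

∣setOf∣≤ : ∀ {n r} (e : Vec (Fin n) r) → ∣ setOf e ∣ ≤ r
∣setOf∣≤ {n} [] = ≤-reflexive (∣⊥∣≡0 n)
∣setOf∣≤ (x ∷ e) = ≤-trans (∣p∪q∣≤∣p∣+∣q∣ ⁅ x ⁆ (setOf e)) (+-mono-≤ (≤-reflexive (∣⁅x⁆∣≡1 x)) (∣setOf∣≤ e))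

-- A repeated entry would be absorbed by the union and leave fewer than `r` elements.
∣setOf∣≡⇒injective : ∀ {n r} (e : Vec (Fin n) r) → r ≤ ∣ setOf e ∣ → ∀ j k → lookup e j ≡ lookup e k → j ≡ k
∣setOf∣≡⇒injective {n} {suc r} (x ∷ e) full = inj
  where
  fresh : ∀ j → x ≢ lookup e j
  fresh j refl = <⇒≱ full (≤-trans (p⊆q⇒∣p∣≤∣q∣ absorbed) (∣setOf∣≤ e))
    where
    absorbed : ⁅ x ⁆ ∪ setOf e ⊆ setOf e
    absorbed y∈ with x∈p∪q⁻ ⁅ x ⁆ (setOf e) y∈
    ... | inj₁ p = subst (_∈ˢ setOf e) (sym (x∈⁅y⁆⇒x≡y x p)) (∈-setOf⁺ e j)
    ... | inj₂ q = q
  full' : r ≤ ∣ setOf e ∣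
  full' = ≤-pred (≤-trans full (≤-trans (∣p∪q∣≤∣p∣+∣q∣ ⁅ x ⁆ (setOf e)) (≤-reflexive (cong (_+ ∣ setOf e ∣) (∣⁅x⁆∣≡1 x)))))
  inj : ∀ j k → lookup (x ∷ e) j ≡ lookup (x ∷ e) k → j ≡ k
  inj zero zero _ = refl
  inj zero (suc k) eq = ⊥-elim (fresh k eq)
  inj (suc j) zero eq = ⊥-elim (fresh j (sym eq))
  inj (suc j) (suc k) eq = cong suc (∣setOf∣≡⇒injective e full' j k eq)

∈-tuples : ∀ {n r} (e : Vec (Fin n) r) → e ∈ tuples n r
∈-tuples [] = here refl
∈-tuples (x ∷ e) = ∈-cartesianProductWith⁺ _∷_ (∈-allFin x) (∈-tuples e)

setOf-map-suc : ∀ {n r} (e : Vec (Fin n) r) → setOf (Vec.map suc e) ≡ false ∷ setOf e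
setOf-map-suc [] = refl
setOf-map-suc (x ∷ e) = cong (⁅ suc x ⁆ ∪_) (setOf-map-suc e)

⁅zero⁆∪-tail : ∀ {n} (p : Subset n) → ⁅ zero ⁆ ∪ (false ∷ p) ≡ true ∷ p
⁅zero⁆∪-tail p = cong (true ∷_) (∪-identityˡ p)

setOf-surjective : ∀ {n} (p : Subset n) → ∃ λ (e : Vec (Fin n) ∣ p ∣) → setOf e ≡ p
setOf-surjective [] = [] , refl
setOf-surjective (true ∷ p) with setOf-surjective p
... | e , eq = zero ∷ Vec.map suc e , trans (cong (⁅ zero ⁆ ∪_) (trans (setOf-map-suc e) (cong (false ∷_) eq))) (⁅zero⁆∪-tail p)
setOf-surjective (false ∷ p) with setOf-surjective p
... | e , eq = Vec.map suc e , trans (setOf-map-suc e) (cong (false ∷_) eq)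

_≟ˢ_ : ∀ {n} (p q : Subset n) → Dec (p ≡ q)
_≟ˢ_ = ≡-dec Bool._≟_

∑-allSubsets-≡ : ∀ {n} (q : Subset n) → ∑ (allSubsets n) (λ p → ⟦ q ≟ˢ p ⟧) ≤ 1
∑-allSubsets-≡ [] = ≤-refl
∑-allSubsets-≡ {suc n} (b ∷ q) = begin
  ∑ (allSubsets (suc n)) (λ p → ⟦ (b ∷ q) ≟ˢ p ⟧)
    ≡⟨ trans (∑-++ (map (true ∷_) (allSubsets n)) _ _) (cong₂ _+_ (∑-map (true ∷_) (allSubsets n) _) (∑-map (false ∷_) (allSubsets n) _)) ⟩
  ∑ (allSubsets n) (λ p → ⟦ (b ∷ q) ≟ˢ (true ∷ p) ⟧) + ∑ (allSubsets n) (λ p → ⟦ (b ∷ q) ≟ˢ (false ∷ p) ⟧)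
    ≤⟨ half b ⟩
  1 ∎
  where
  open ≤-Reasoning
  same : ∀ b → ∑ (allSubsets n) (λ p → ⟦ (b ∷ q) ≟ˢ (b ∷ p) ⟧) ≤ 1
  same b = ≤-trans (∑-mono (allSubsets n) (λ p → ⟦⟧-mono ((b ∷ q) ≟ˢ (b ∷ p)) (q ≟ˢ p) (λ where refl → refl))) (∑-allSubsets-≡ q)
  diff : ∀ b b' → b ≢ b' → ∑ (allSubsets n) (λ p → ⟦ (b ∷ q) ≟ˢ (b' ∷ p) ⟧) ≡ 0
  diff b b' b≢b' = ∑-zero (allSubsets n) (λ p → ⟦⟧-false ((b ∷ q) ≟ˢ (b' ∷ p)) (λ where refl → b≢b' refl))
  half : ∀ b → ∑ (allSubsets n) (λ p → ⟦ (b ∷ q) ≟ˢ (true ∷ p) ⟧) + ∑ (allSubsets n) (λ p → ⟦ (b ∷ q) ≟ˢ (false ∷ p) ⟧) ≤ 1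
  half true = ≤-trans (+-mono-≤ (same true) (≤-reflexive (diff true false (λ ())))) ≤-refl
  half false = ≤-trans (+-mono-≤ (≤-reflexive (diff false true (λ ()))) (same false)) ≤-refl

length-filterᵇ : {A : Set} (f : A → Bool) (xs : List A) → length (filterᵇ f xs) ≡ ∑ xs (λ x → ⟦ f x Bool.≟ true ⟧)
length-filterᵇ f [] = refl
length-filterᵇ f (x ∷ xs) with f x
... | true = cong suc (length-filterᵇ f xs)
... | false = length-filterᵇ f xs

¬Repeats⇒∉ : ∀ {n k} {L : List (Fin n)} (S : Vec (Fin n) k) → ¬ Repeats L S → ∀ j {x} → x ∈ L → lookup S j ≢ x
¬Repeats⇒∉ (y ∷ S) nr zero x∈L refl = nr (hit x∈L)
¬Repeats⇒∉ (y ∷ S) nr (suc j) x∈L eq = ¬Repeats⇒∉ S (nr ∘ later) j (there x∈L) eq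

¬Repeats⇒injective : ∀ {n k} {L : List (Fin n)} (S : Vec (Fin n) k) → ¬ Repeats L S → ∀ j k → lookup S j ≡ lookup S k → j ≡ k
¬Repeats⇒injective (y ∷ S) nr zero zero _ = refl
¬Repeats⇒injective (y ∷ S) nr zero (suc k) eq = ⊥-elim (¬Repeats⇒∉ S (nr ∘ later) k (here refl) (sym eq))
¬Repeats⇒injective (y ∷ S) nr (suc j) zero eq = ⊥-elim (¬Repeats⇒∉ S (nr ∘ later) j (here refl) eq)
¬Repeats⇒injective (y ∷ S) nr (suc j) (suc k) eq = cong suc (¬Repeats⇒injective S (nr ∘ later) j k eq)

∈-allFinL : ∀ {k} (j : Fin k) → j ∈ allFinL k
∈-allFinL zero = here refl
∈-allFinL (suc j) = there (∈-map⁺ suc (∈-allFinL j))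

∈-⋃⁺ : ∀ {n} {A : Set} (h : A → Fin n) {xs : List A} {x} → x ∈ xs → h x ∈ˢ ⋃ (map (λ x → ⁅ h x ⁆) xs)
∈-⋃⁺ h (here refl) = x∈p∪q⁺ (inj₁ (x∈⁅x⁆ _))
∈-⋃⁺ h {y ∷ _} (there p) = x∈p∪q⁺ {p = ⁅ h y ⁆} (inj₂ (∈-⋃⁺ h p))

∈-⋃⁻ : ∀ {n} {A : Set} (h : A → Fin n) (xs : List A) {y} → y ∈ˢ ⋃ (map (λ x → ⁅ h x ⁆) xs) → ∃ λ x → h x ≡ y
∈-⋃⁻ h [] y∈ = ⊥-elim (∉⊥ y∈)
∈-⋃⁻ h (x ∷ xs) y∈ with x∈p∪q⁻ ⁅ h x ⁆ _ y∈
... | inj₁ p = x , sym (x∈⁅y⁆⇒x≡y (h x) p)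
... | inj₂ q = ∈-⋃⁻ h xs q

-- Ordered edges, and covers of common links from greedy matchings

module FromHypergraph {n r' : ℕ} (H : Hypergraph (suc r') n) where

  r : ℕ
  r = suc r'

  -- All orderings of an edge qualify; a tuple with a repeated entry does not, because `uniform`
  -- asks for `r` elements.
  P : Vec (Fin n) r → Set
  P e = isEdge H (setOf e) ≡ true

  P? : ∀ e → Dec (P e)
  P? e = isEdge H (setOf e) Bool.≟ true

  open Edges P?

  -- Every edge is represented by its increasing ordering, and a tuple represents only one set. The
  -- factor r! is given away.
  edgeCount≤ : edgeCount H ≤ ∑ (tuples n r) (λ e → ⟦ P? e ⟧)
  edgeCount≤ = begin
    edgeCount H
      ≡⟨ length-filterᵇ (isEdge H) (allSubsets n) ⟩
    ∑ (allSubsets n) (λ p → ⟦ isEdge H p Bool.≟ true ⟧)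
      ≤⟨ ∑-mono (allSubsets n) (λ p → ⟦⟧-≤ (isEdge H p Bool.≟ true) (represented p)) ⟩
    ∑ (allSubsets n) (λ p → ∑ (tuples n r) (λ e → ⟦ P? e ⟧ * ⟦ setOf e ≟ˢ p ⟧))
      ≡⟨ ∑-swap (allSubsets n) (tuples n r) (λ p e → ⟦ P? e ⟧ * ⟦ setOf e ≟ˢ p ⟧) ⟩
    ∑ (tuples n r) (λ e → ∑ (allSubsets n) (λ p → ⟦ P? e ⟧ * ⟦ setOf e ≟ˢ p ⟧))
      ≤⟨ ∑-mono (tuples n r) (λ e → ≤-trans (≤-reflexive (∑-*ˡ (allSubsets n) ⟦ P? e ⟧ _))
           (≤-trans (*-monoʳ-≤ ⟦ P? e ⟧ (∑-allSubsets-≡ (setOf e))) (≤-reflexive (*-identityʳ _)))) ⟩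
    ∑ (tuples n r) (λ e → ⟦ P? e ⟧) ∎
    where
    open ≤-Reasoning
    represented : ∀ p → isEdge H p ≡ true → 1 ≤ ∑ (tuples n r) (λ e → ⟦ P? e ⟧ * ⟦ setOf e ≟ˢ p ⟧)
    represented p edge = ≤-trans
      (≤-reflexive (sym (cong₂ _*_ (⟦⟧-true (P? e) (trans (cong (isEdge H) set≡p) edge)) (⟦⟧-true (setOf e ≟ˢ p) set≡p))))
      (∑-term (λ e → ⟦ P? e ⟧ * ⟦ setOf e ≟ˢ p ⟧) (∈-tuples e))
      where
      rep : ∃ λ (e : Vec (Fin n) r) → setOf e ≡ p
      rep = subst (λ k → ∃ λ (e : Vec (Fin n) k) → setOf e ≡ p) (uniform H p edge) (setOf-surjective p)
      e = proj₁ rep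
      set≡p = proj₂ rep

  edge-injective : ∀ e → P e → ∀ j k → lookup e j ≡ lookup e k → j ≡ k
  edge-injective e Pe = ∣setOf∣≡⇒injective e (≤-reflexive (sym (uniform H (setOf e) Pe)))

  module Greedy {s t : ℕ} (K-free : ¬ ContainsK (suc s) t H) (i : Fin r) (S : Vec (Fin n) (suc s)) (nr : ¬ Repeats [] S) where

    -- The dummy coordinate `i` of each tuple is included, whence the bound `t * r` on the size of
    -- covers.
    entries : ∀ {k} → Vec (Vec (Fin n) r) k → List (Fin n)
    entries [] = []
    entries (e ∷ es) = toList e ++ entries es

    length-entries : ∀ {k} (es : Vec (Vec (Fin n) r) k) → length (entries es) ≡ k * r
    length-entries [] = refl
    length-entries (e ∷ es) = trans (length-++ (toList e)) (cong₂ _+_ (length-toList e) (length-entries es))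

    ∈-entries : ∀ {k} (es : Vec (Vec (Fin n) r) k) a j → lookup (lookup es a) j ∈ entries es
    ∈-entries (e ∷ es) zero j = ∈-++⁺ˡ (∈-toList⁺ (∈-lookup j e))
    ∈-entries (e ∷ es) (suc a) j = ∈-++⁺ʳ (toList e) (∈-entries es a j)

    Avoids : List (Fin n) → Vec (Fin n) r → Set
    Avoids zs e = ∀ j → j ≢ i → ¬ lookup e j ∈ zs

    avoids? : ∀ zs e → Dec (Avoids zs e)
    avoids? zs e = Fin.all? λ j → ¬? (j Fin.≟ i) →-dec ¬? (lookup e j ∈? zs)

    data Matching : ∀ {k} → Vec (Vec (Fin n) r) k → Set where
      []  : Matching []
      add : ∀ {k e} {es : Vec (Vec (Fin n) r) k} → Common i S e → Avoids (entries es) e → Matching es → Matching (e ∷ es)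

    matching-common : ∀ {k} {es : Vec (Vec (Fin n) r) k} → Matching es → ∀ a → Common i S (lookup es a)
    matching-common (add com _ _) zero = com
    matching-common (add _ _ M) (suc a) = matching-common M a

    matching-disjoint : ∀ {k} {es : Vec (Vec (Fin n) r) k} → Matching es → ∀ a b j l → a ≢ b → j ≢ i → l ≢ i →
      lookup (lookup es a) j ≢ lookup (lookup es b) l
    matching-disjoint M zero zero j l a≢b = ⊥-elim (a≢b refl)
    matching-disjoint {es = _ ∷ es} (add _ av _) zero (suc b) j l _ j≢i _ eq = av j j≢i (subst (_∈ entries es) (sym eq) (∈-entries es b l))
    matching-disjoint {es = _ ∷ es} (add _ av _) (suc a) zero j l _ _ l≢i eq = av l l≢i (subst (_∈ entries es) eq (∈-entries es a j))
    matching-disjoint (add _ _ M) (suc a) (suc b) j l a≢b = matching-disjoint M a b j l (a≢b ∘ cong suc)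

    -- X_a consists of the coordinates of the `a`-th tuple other than `i`, and Y of the entries of
    -- `S`. Vertices within X_a, or in X_a and Y, are distinct because an edge contains both;
    -- different X_a are separated by the matching, and Y by `nr`.
    matching⇒K : {es : Vec (Vec (Fin n) r) t} → Matching es → ContainsK (suc s) t H
    matching⇒K {es} M = record { emb = emb ; injective = injective ; edges = edges }
      where
      emb : KVertex r (suc s) t → Fin n
      emb (inj₁ (a , j)) = lookup (lookup es a) (punchIn i j)
      emb (inj₂ y) = lookup S y
      edge : ∀ a y → P (lookup es a [ i ]≔ lookup S y)
      edge a y = lookup⁺ (matching-common M a) y
      unchanged : ∀ a y j → lookup (lookup es a [ i ]≔ lookup S y) (punchIn i j) ≡ lookup (lookup es a) (punchIn i j)
      unchanged a y j = lookup∘update′ (Fin.punchInᵢ≢i i j) (lookup es a) (lookup S y)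
      injective : ∀ u v → emb u ≡ emb v → u ≡ v
      injective (inj₁ (a , j)) (inj₁ (b , l)) eq with a Fin.≟ b
      ... | yes refl = cong (λ j → inj₁ (a , j)) (Fin.punchIn-injective i j l
            (edge-injective (lookup es a [ i ]≔ lookup S zero) (edge a zero) _ _ (trans (unchanged a zero j) (trans eq (sym (unchanged a zero l))))))
      ... | no a≢b = ⊥-elim (matching-disjoint M a b _ _ a≢b (Fin.punchInᵢ≢i i j) (Fin.punchInᵢ≢i i l) eq)
      injective (inj₁ (a , j)) (inj₂ y) eq = ⊥-elim (Fin.punchInᵢ≢i i j (edge-injective (lookup es a [ i ]≔ lookup S y) (edge a y) _ i
        (trans (unchanged a y j) (trans eq (sym (lookup∘update i (lookup es a) (lookup S y)))))))
      injective (inj₂ y) (inj₁ (a , j)) eq = ⊥-elim (Fin.punchInᵢ≢i i j (edge-injective (lookup es a [ i ]≔ lookup S y) (edge a y) _ i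
        (trans (unchanged a y j) (trans (sym eq) (sym (lookup∘update i (lookup es a) (lookup S y)))))))
      injective (inj₂ y) (inj₂ z) eq = cong inj₂ (¬Repeats⇒injective S nr y z eq)
      image≡ : ∀ a y → imageEdge {r} {suc s} {t} emb a y ≡ setOf (lookup es a [ i ]≔ lookup S y)
      image≡ a y = ⊆-antisym to from
        where
        e = lookup es a [ i ]≔ lookup S y
        h : Fin r' → Fin n
        h j = emb (inj₁ (a , j))
        to : imageEdge {r} {suc s} {t} emb a y ⊆ setOf e
        to x∈ with x∈p∪q⁻ ⁅ lookup S y ⁆ _ x∈
        ... | inj₁ p = subst (_∈ˢ setOf e) (trans (lookup∘update i (lookup es a) (lookup S y)) (sym (x∈⁅y⁆⇒x≡y _ p))) (∈-setOf⁺ e i)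
        ... | inj₂ q with ∈-⋃⁻ h (allFinL r') q
        ...   | j , eq = subst (_∈ˢ setOf e) (trans (unchanged a y j) eq) (∈-setOf⁺ e (punchIn i j))
        from : setOf e ⊆ imageEdge {r} {suc s} {t} emb a y
        from x∈ with ∈-setOf⁻ e x∈
        ... | j , eq with i Fin.≟ j
        ...   | yes refl = x∈p∪q⁺ (inj₁ (subst (_∈ˢ ⁅ lookup S y ⁆) (trans (sym (lookup∘update i (lookup es a) (lookup S y))) eq) (x∈⁅x⁆ _)))
        ...   | no i≢j = x∈p∪q⁺ {p = ⁅ lookup S y ⁆} (inj₂ (subst (_∈ˢ ⋃ (map (λ j → ⁅ h j ⁆) (allFinL r')))
                  (trans (sym (unchanged a y (punchOut i≢j))) (trans (cong (lookup e) (Fin.punchIn-punchOut i≢j)) eq))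
                  (∈-⋃⁺ h (∈-allFinL (punchOut i≢j)))))
      edges : ∀ a y → isEdge H (imageEdge {r} {suc s} {t} emb a y) ≡ true
      edges a y = trans (cong (isEdge H) (image≡ a y)) (edge a y)

    Cover : Set
    Cover = ∃ λ zs → length zs ≤ t * r × (∀ e → Common i S e → ∃ λ j → j ≢ i × lookup e j ∈ zs)

    -- `f` counts the members still missing from a matching of size `t`. When no common edge avoids
    -- the earlier ones, their vertices form a cover.
    greedy : ∀ f k → f + k ≡ t → (es : Vec (Vec (Fin n) r) k) → Matching es → Cover
    greedy zero k refl es M = ⊥-elim (K-free (matching⇒K M))
    greedy (suc f) k eq es M with any? (λ e → common? i S e ×-dec avoids? (entries es) e) (tuples n r)
    ... | yes found with satisfied found
    ...   | e , com , av = greedy f (suc k) (trans (+-suc f k) eq) (e ∷ es) (add com av M)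
    greedy (suc f) k eq es M | no none = entries es ,
      ≤-trans (≤-reflexive (length-entries es)) (*-monoˡ-≤ r (≤-trans (m≤n+m k (suc f)) (≤-reflexive eq))) , covered
      where
      covered : ∀ e → Common i S e → ∃ λ j → j ≢ i × lookup e j ∈ entries es
      covered e com with Fin.any? (λ j → ¬? (j Fin.≟ i) ×-dec (lookup e j ∈? entries es))
      ... | yes q = q
      ... | no ¬q = ⊥-elim (none (lose (∈-tuples e) (com , λ j j≢i j∈ → ¬q (j , j≢i , j∈))))

    cover : Cover
    cover = greedy t 0 (+-identityʳ t) [] []

  module Covers {s t : ℕ} (K-free : ¬ ContainsK (suc s) t H) where

    -- The empty list on tuples with repetitions is a placeholder; `covers` makes a claim only about
    -- repetition-free tuples.
    Z : Fin r → Vec (Fin n) (suc s) → List (Fin n)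
    Z i S with repeats? [] S
    ... | yes _ = []
    ... | no nr = proj₁ (Greedy.cover K-free i S nr)

    Z≤ : ∀ i S → length (Z i S) ≤ t * r
    Z≤ i S with repeats? [] S
    ... | yes _ = z≤n
    ... | no nr = proj₁ (proj₂ (Greedy.cover K-free i S nr))

    covers : ∀ i S → ¬ Repeats [] S → ∀ e → Common i S e → ∃ λ j → j ≢ i × lookup e j ∈ Z i S
    covers i S nr with repeats? [] S
    ... | yes rep = ⊥-elim (nr rep)
    ... | no nr' = proj₂ (proj₂ (Greedy.cover K-free i S nr'))

-- Choice of parameters

module Constants (r m c Q : ℕ) (r-pos : 0 < r) (m-pos : 0 < m) (c-pos : 0 < c) (Q-pos : 0 < Q) where

  -- `W'`, `U`, `R`, `W` are taken in this order, each with equality in a constraint that involves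
  -- only earlier ones. In powers of `Q` they have orders 1, 3, 3, 4, so `N` has order `6 * m` and
  -- `V` order `3 * m`. `G` dominates the five lower bounds required of `D` and has order `9 * m`.
  W' U R W N V G : ℕ
  W' = 10 * r * (r * r * c) * 9 * Q
  U = 4 * W' * (Q * Q)
  R = 16 * (r * r) * U
  W = 10 * r * (r * r * c) * R * Q
  N = (W * (Q * Q)) ^ m
  V = 4 * (2 * U) ^ m
  G = m * suc m * (10 * r) * V * (r * r * (c * c)) * N

  private instance
    _ = >-nonZero r-pos
    _ = >-nonZero m-pos
    _ = >-nonZero c-pos
    _ = >-nonZero Q-pos
    rr≢0 = m*n≢0 r r
    rrc≢0 = m*n≢0 (r * r) c
    cc≢0 = m*n≢0 c c
    rrcc≢0 = m*n≢0 (r * r) (c * c)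
    10r≢0 = m*n≢0 10 r
    k≢0 = m*n≢0 (10 * r) (r * r * c)
    k9≢0 = m*n≢0 (10 * r * (r * r * c)) 9
    QQ≢0 = m*n≢0 Q Q
    W'≢0 = m*n≢0 (10 * r * (r * r * c) * 9) Q
    4W'≢0 = m*n≢0 4 W'
    U≢0 = m*n≢0 (4 * W') (Q * Q)
    16rr≢0 = m*n≢0 16 (r * r)
    R≢0 = m*n≢0 (16 * (r * r)) U
    kR≢0 = m*n≢0 (10 * r * (r * r * c)) R
    W≢0 = m*n≢0 (10 * r * (r * r * c) * R) Q
    WQQ≢0 = m*n≢0 W (Q * Q)
    2U≢0 = m*n≢0 2 U
    2U^m≢0 = m^n≢0 (2 * U) m
    V≢0 = m*n≢0 4 ((2 * U) ^ m)

  opaque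
    9≤R : 9 ≤ R
    9≤R = ≤-trans (≤-trans (m≤m+n 9 7) (m≤m*n 16 (r * r))) (m≤m*n (16 * (r * r)) U)

    9≤W' : 9 ≤ W'
    9≤W' = ≤-trans (m≤n*m 9 (10 * r * (r * r * c))) (m≤m*n (10 * r * (r * r * c) * 9) Q)

    W'≤W : W' ≤ W
    W'≤W = *-monoˡ-≤ Q (*-monoʳ-≤ (10 * r * (r * r * c)) 9≤R)

    W≤N : W ≤ N
    W≤N = ≤-trans (m≤m*n W (Q * Q)) (≤-trans (≤-reflexive (sym (*-identityʳ _))) (^-monoʳ-≤ (W * (Q * Q)) m-pos))

    R≤W : R ≤ W
    R≤W = ≤-trans (m≤n*m R (10 * r * (r * r * c))) (m≤m*n (10 * r * (r * r * c) * R) Q)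

    Q≤N : Q ≤ N
    Q≤N = ≤-trans (m≤n*m Q (10 * r * (r * r * c) * R)) W≤N

    W-reverse : 8 * W' * Q ≤ W
    W-reverse = ≤-trans (m≤m*n (8 * W' * Q) (10 * r * (r * r * c) * (8 * (r * r) * (Q * Q))) {{m*n≢0 (10 * r * (r * r * c)) (8 * (r * r) * (Q * Q)) {{k≢0}} {{m*n≢0 (8 * (r * r)) (Q * Q) {{m*n≢0 8 (r * r)}}}}}})
      (≤-reflexive (regroup (10 * r * (r * r * c)) (r * r) W' Q))
      where
      regroup : ∀ k x w q → 8 * w * q * (k * (8 * x * (q * q))) ≡ k * (16 * x * (4 * w * (q * q))) * q
      regroup = solve-∀

    5≤ : ∀ {x a b d y z} → 0 < a → 0 < b → 0 < d → y ≤ z → x * y ≤ x * a * b * d * z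
    5≤ {x} {a} {b} {d} pa pb pd y≤z = *-mono-≤ (≤-trans (m≤m*n x a {{>-nonZero pa}})
      (≤-trans (m≤m*n (x * a) b {{>-nonZero pb}}) (m≤m*n (x * a * b) d {{>-nonZero pd}}))) y≤z

    private
      10r-pos : 0 < 10 * r
      10r-pos = >-nonZero⁻¹ (10 * r)
      V-pos : 0 < V
      V-pos = >-nonZero⁻¹ V
      rrcc-pos : 0 < r * r * (c * c)
      rrcc-pos = >-nonZero⁻¹ (r * r * (c * c))
      N-pos : 0 < N
      N-pos = <-≤-trans Q-pos Q≤N

    G-R : m * suc m * R ≤ G
    G-R = 5≤ {m * suc m} 10r-pos V-pos rrcc-pos (≤-trans R≤W W≤N)

    G-9 : m * suc m * 9 ≤ G
    G-9 = 5≤ {m * suc m} 10r-pos V-pos rrcc-pos (≤-trans 9≤W' (≤-trans W'≤W W≤N))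

    G-V : m * suc m * V ≤ G
    G-V = ≤-trans (*-monoˡ-≤ V (m≤m*n (m * suc m) (10 * r)))
      (≤-trans (m≤m*n (m * suc m * (10 * r) * V) (r * r * (c * c))) (m≤m*n (m * suc m * (10 * r) * V * (r * r * (c * c))) N {{>-nonZero N-pos}}))

    G-Q : 10 * r * V * (r * r * (c * c)) * Q ≤ G
    G-Q = *-mono-≤ (*-monoˡ-≤ (r * r * (c * c)) (*-monoˡ-≤ V (m≤n*m (10 * r) (m * suc m) {{m*n≢0 m (suc m)}}))) Q≤N

    G-N : 10 * r * V * (r * c) * N ≤ G
    G-N = *-monoˡ-≤ N (*-mono-≤ (*-monoˡ-≤ V (m≤n*m (10 * r) (m * suc m) {{m*n≢0 m (suc m)}})) (*-mono-≤ (m≤m*n r r) (m≤m*n c c)))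

    scales : ∀ {D} → G ≤ D → Scales r m c D Q W W' U R
    scales {D} G≤D = record
      { r-pos = r-pos ; Q-pos = Q-pos
      ; D-pos = <-≤-trans (<-≤-trans (*-mono-< {0} {m * suc m} {0} {9} (*-mono-< m-pos (s≤s z≤n)) (s≤s z≤n)) G-9) G≤D
      ; W-pos = >-nonZero⁻¹ W ; W'-pos = >-nonZero⁻¹ W'
      ; U-large = ≤-trans (≤-trans (m≤m+n 2 2) (m≤m*n 4 W')) (m≤m*n (4 * W') (Q * Q))
      ; W-poor = ≤-refl ; W'-poor = ≤-refl ; W'≤W = W'≤W ; U-reverse = ≤-refl ; W-reverse = W-reverse ; R-core = ≤-refl
      ; D-reps = ≤-trans G-R G≤D ; D-reps' = ≤-trans G-9 G≤D ; D-reps'' = ≤-trans G-V G≤D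
      ; D-noPoor = ≤-trans G-Q G≤D ; D-ball = ≤-trans G-N G≤D }

-- The coefficient of `Q ^ (9 * m)` in `G`. The base of the `m`-th power is the product of `2 * U`
-- and `W * (Q * Q)` without its factor `Q ^ 9`.
thresholdConstant : ℕ → ℕ → ℕ → ℕ
thresholdConstant r m c = m * suc m * (10 * r) * 4 * (r * r * (c * c)) * (8 * (k * 9) * (k * (16 * (r * r) * (4 * (k * 9))))) ^ m
  where k = 10 * r * (r * r * c)

threshold-formula : ∀ r m c Q (r-pos : 0 < r) (m-pos : 0 < m) (c-pos : 0 < c) (Q-pos : 0 < Q) →
  Constants.G r m c Q r-pos m-pos c-pos Q-pos ≡ thresholdConstant r m c * Q ^ (9 * m)
threshold-formula r m c Q r-pos m-pos c-pos Q-pos = begin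
  m * suc m * (10 * r) * (4 * (2 * U) ^ m) * (r * r * (c * c)) * (W * (Q * Q)) ^ m
    ≡⟨ regroup (m * suc m * (10 * r)) ((2 * U) ^ m) (r * r * (c * c)) ((W * (Q * Q)) ^ m) ⟩
  m * suc m * (10 * r) * 4 * (r * r * (c * c)) * ((2 * U) ^ m * (W * (Q * Q)) ^ m)
    ≡⟨ cong (a₀ *_) (trans (sym (^-distribʳ-* m (2 * U) (W * (Q * Q)))) (cong (_^ m) (powers k (r * r) Q))) ⟩
  a₀ * (b₀ * Q ^ 9) ^ m
    ≡⟨ cong (a₀ *_) (trans (^-distribʳ-* m b₀ (Q ^ 9)) (cong (b₀ ^ m *_) (^-*-assoc Q 9 m))) ⟩
  a₀ * (b₀ ^ m * Q ^ (9 * m))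
    ≡⟨ *-assoc a₀ (b₀ ^ m) (Q ^ (9 * m)) ⟨
  a₀ * b₀ ^ m * Q ^ (9 * m) ∎
  where
  open ≡-Reasoning
  open Constants r m c Q r-pos m-pos c-pos Q-pos using (U; W)
  k = 10 * r * (r * r * c)
  a₀ = m * suc m * (10 * r) * 4 * (r * r * (c * c))
  b₀ = 8 * (k * 9) * (k * (16 * (r * r) * (4 * (k * 9))))
  regroup : ∀ a u d w → a * (4 * u) * d * w ≡ a * 4 * d * (u * w)
  regroup = solve-∀
  powers : ∀ k x q → 2 * (4 * (k * 9 * q) * (q * q)) * (k * (16 * x * (4 * (k * 9 * q) * (q * q))) * q * (q * q))
    ≡ 8 * (k * 9) * (k * (16 * x * (4 * (k * 9)))) * (q * (q * (q * (q * (q * (q * (q * (q * (q * 1)))))))))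
  powers = solve-∀

-- Elimination of Q and the value of ε

module FinalArithmetic (m' : ℕ) where

  -- Here `suc q` equals `m * h`. Eliminating `Q` bounds `D ^ h` by a constant times n^(9mp);
  -- compared with D = n^(p/m) this saves a factor n^(p/(mh)), and ε = 1/(mh) stays within this
  -- saving because `p ≥ 1`.
  m p h q : ℕ
  m = 2 + m'
  p = suc m'
  h = suc (m * (9 * m))
  q = m * (9 * m) + p * h

  -- Raise `D ≤ C * Q ^ (9 * m)` by the factor (D^m)^(9m) and apply the bound on `Q * D ^ m`. If
  -- `D ^ m` exceeds `n ^ p`, then `Q ≤ 1` and `D` is bounded by `C`.
  power-bound : ∀ n D Q C → 0 < n → D ≤ C * Q ^ (9 * m) → (D ^ m ≤ n ^ p → Q * D ^ m ≤ 2 * n ^ p) → (n ^ p < D ^ m → Q ≤ 1) →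
    D ^ h ≤ (C * 2 ^ (9 * m) + C ^ h) * n ^ (p * (9 * m))
  power-bound n D Q C n-pos D≤ small large = case D ^ m ≤? n ^ p of λ where
      (yes le) → ≤-trans (main (small le)) (*-monoˡ-≤ X (m≤m+n (C * 2 ^ (9 * m)) (C ^ h)))
      (no gt) → ≤-trans (trivial (large (≰⇒> gt))) (*-monoˡ-≤ X (m≤n+m (C ^ h) (C * 2 ^ (9 * m))))
    where
    open ≤-Reasoning
    X = n ^ (p * (9 * m))
    instance
      _ = >-nonZero n-pos
      _ = m^n≢0 n (p * (9 * m))
    main : Q * D ^ m ≤ 2 * n ^ p → D ^ h ≤ C * 2 ^ (9 * m) * X
    main le = begin
      D * D ^ (m * (9 * m))                      ≡⟨ cong (D *_) (^-*-assoc D m (9 * m)) ⟨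
      D * (D ^ m) ^ (9 * m)                      ≤⟨ *-monoˡ-≤ ((D ^ m) ^ (9 * m)) D≤ ⟩
      C * Q ^ (9 * m) * (D ^ m) ^ (9 * m)        ≡⟨ *-assoc C _ _ ⟩
      C * (Q ^ (9 * m) * (D ^ m) ^ (9 * m))      ≡⟨ cong (C *_) (^-distribʳ-* (9 * m) Q (D ^ m)) ⟨
      C * (Q * D ^ m) ^ (9 * m)                  ≤⟨ *-monoʳ-≤ C (^-monoˡ-≤ (9 * m) le) ⟩
      C * (2 * n ^ p) ^ (9 * m)                  ≡⟨ cong (C *_) (^-distribʳ-* (9 * m) 2 (n ^ p)) ⟩
      C * (2 ^ (9 * m) * (n ^ p) ^ (9 * m))      ≡⟨ cong (λ x → C * (2 ^ (9 * m) * x)) (^-*-assoc n p (9 * m)) ⟩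
      C * (2 ^ (9 * m) * X)                      ≡⟨ *-assoc C _ _ ⟨
      C * 2 ^ (9 * m) * X ∎
    trivial : Q ≤ 1 → D ^ h ≤ C ^ h * X
    trivial Q≤1 = ≤-trans (^-monoˡ-≤ h (≤-trans D≤ (≤-trans (*-monoʳ-≤ C (≤-trans (^-monoˡ-≤ (9 * m) Q≤1) (≤-reflexive (^-zeroˡ (9 * m))))) (≤-reflexive (*-identityʳ C)))))
      (m≤m*n (C ^ h) X)

  -- The summand `m * m'` is the unspent saving: `p * m` is available and `m` is claimed. The
  -- identity also shows that the truncated subtractions in the final exponent are genuine.
  exponent : ∀ r' → suc r' * (m * suc q) ≡ r' * (m * suc q) + p * (9 * m) * (m * m) + m * m' + (suc q + m)
  exponent r' = trans (cong (_+ r' * (m * suc q)) (core m')) (regroup (r' * (m * suc q)) (p * (9 * m) * (m * m)) (m * m') (suc q + m))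
    where
    core : ∀ m' → (2 + m') * ((2 + m') * (1 + (2 + m') * (9 * (2 + m')))) ≡
      (1 + m') * (9 * (2 + m')) * ((2 + m') * (2 + m')) + (2 + m') * m' + ((2 + m') * (1 + (2 + m') * (9 * (2 + m'))) + (2 + m'))
    core = solve-∀
    regroup : ∀ a b c d → b + c + d + a ≡ a + b + c + d
    regroup = solve-∀

  finish : ∀ r' n E c₁ C D → 0 < n → 0 < C → E ≤ c₁ * n ^ r' * D → D ^ h ≤ C * n ^ (p * (9 * m)) →
    E ^ (m * suc q) ≤ (c₁ * C) ^ (m * suc q) * n ^ (suc r' * (m * suc q) ∸ suc q ∸ m)
  finish r' n E c₁ C D n-pos C-pos E≤ D≤ = begin
    E ^ b
      ≤⟨ ^-monoˡ-≤ b E≤ ⟩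
    (c₁ * n ^ r' * D) ^ b
      ≡⟨ trans (^-distribʳ-* b (c₁ * n ^ r') D) (cong (_* D ^ b) (trans (^-distribʳ-* b c₁ (n ^ r')) (cong (c₁ ^ b *_) (^-*-assoc n r' b)))) ⟩
    c₁ ^ b * n ^ (r' * b) * D ^ b
      ≡⟨ cong (λ x → c₁ ^ b * n ^ (r' * b) * x) (trans (cong (D ^_) b≡) (sym (^-*-assoc D h (m * m)))) ⟩
    c₁ ^ b * n ^ (r' * b) * (D ^ h) ^ (m * m)
      ≤⟨ *-monoʳ-≤ (c₁ ^ b * n ^ (r' * b)) (^-monoˡ-≤ (m * m) D≤) ⟩
    c₁ ^ b * n ^ (r' * b) * (C * n ^ (p * (9 * m))) ^ (m * m)
      ≡⟨ cong (c₁ ^ b * n ^ (r' * b) *_) (trans (^-distribʳ-* (m * m) C _) (cong (C ^ (m * m) *_) (^-*-assoc n (p * (9 * m)) (m * m)))) ⟩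
    c₁ ^ b * n ^ (r' * b) * (C ^ (m * m) * n ^ (p * (9 * m) * (m * m)))
      ≡⟨ regroup (c₁ ^ b) (n ^ (r' * b)) (C ^ (m * m)) (n ^ (p * (9 * m) * (m * m))) ⟩
    c₁ ^ b * C ^ (m * m) * (n ^ (r' * b) * n ^ (p * (9 * m) * (m * m)))
      ≡⟨ cong (c₁ ^ b * C ^ (m * m) *_) (^-distribˡ-+-* n (r' * b) (p * (9 * m) * (m * m))) ⟨
    c₁ ^ b * C ^ (m * m) * n ^ (r' * b + p * (9 * m) * (m * m))
      ≤⟨ *-mono-≤ (*-monoʳ-≤ (c₁ ^ b) (^-monoʳ-≤ C mm≤b)) (^-monoʳ-≤ n exponent≤) ⟩
    c₁ ^ b * C ^ b * n ^ (suc r' * b ∸ suc q ∸ m)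
      ≡⟨ cong (_* n ^ (suc r' * b ∸ suc q ∸ m)) (^-distribʳ-* b c₁ C) ⟨
    (c₁ * C) ^ b * n ^ (suc r' * b ∸ suc q ∸ m) ∎
    where
    open ≤-Reasoning
    b = m * suc q
    instance
      _ = >-nonZero n-pos
      _ = >-nonZero C-pos
    -- `suc q` unfolds to `m * h`.
    b≡ : b ≡ h * (m * m)
    b≡ = assoc m h
      where
      assoc : ∀ m h → m * (m * h) ≡ h * (m * m)
      assoc = solve-∀
    mm≤b : m * m ≤ b
    mm≤b = ≤-trans (m≤n*m (m * m) h) (≤-reflexive (sym b≡))
    exponent≤ : r' * b + p * (9 * m) * (m * m) ≤ suc r' * b ∸ suc q ∸ m
    exponent≤ = ≤-trans (m≤m+n _ (m * m')) (≤-reflexive (sym (trans (∸-+-assoc (suc r' * b) (suc q) m)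
      (trans (cong (_∸ (suc q + m)) (exponent r')) (m+n∸n≡m (r' * b + p * (9 * m) * (m * m) + m * m') (suc q + m))))))
    regroup : ∀ a b c d → a * b * (c * d) ≡ a * c * (b * d)
    regroup = solve-∀

module Turán (m' r' t : ℕ) (3≤r : 3 ≤ suc r') (odd : suc r' % 2 ≡ 1) (t-pos : 1 ≤ t) where

  open FinalArithmetic m'

  r c c₀ C₀ C₁ : ℕ
  r = suc r'
  c = t * r
  c₀ = 20 * (r * r * r * c)
  C₀ = thresholdConstant r m c
  C₁ = 2 ^ h * (C₀ * 2 ^ (9 * m) + C₀ ^ h) + 1

  c-pos : 0 < c
  c-pos = *-mono-≤ t-pos (s≤s z≤n)

  module _ {n : ℕ} (H : Hypergraph r n) (K-free : ¬ ContainsK (suc m) t H) (n-pos : 0 < n) where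

    open FromHypergraph H using (P?; edgeCount≤; module Covers)
    open Covers K-free

    private instance
      _ = >-nonZero n-pos
      _ = >-nonZero c-pos

    -- Beyond the threshold `G` a typical edge would carry a pairing of its `r` positions, which is
    -- impossible for odd `r`.
    density-bound : ∀ D Q → 0 < Q → n ^ r' * D * c₀ ≤ edgeCount H → n ^ p ≤ Q * D ^ m → D ≤ C₀ * Q ^ (9 * m)
    density-bound D Q Q-pos many n-small = ≮⇒≥ λ lt → odd≢even (Regularize.dense⇒even {n} {r} {m'} {c} 3≤r P? Z Z≤ covers
      (scales (G≤D lt)) n-pos c-pos (≤-trans (*-monoʳ-≤ (m * suc m) (m≤m+n 2 7)) (≤-trans G-9 (G≤D lt))) many' n-small)
      where
      open ≤-Reasoning
      open Constants r m c Q (s≤s z≤n) (s≤s z≤n) c-pos Q-pos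
      G≤D : C₀ * Q ^ (9 * m) < D → G ≤ D
      G≤D lt = ≤-trans (≤-reflexive (threshold-formula r m c Q (s≤s z≤n) (s≤s z≤n) c-pos Q-pos)) (<⇒≤ lt)
      odd≢even : ¬ (r % 2 ≡ 0)
      odd≢even even = 1+n≢0 (trans (sym odd) even)
      many' : n ^ r * D * c₀ ≤ n * ∑ (tuples n r) (λ e → ⟦ P? e ⟧)
      many' = begin
        n * n ^ r' * D * c₀       ≡⟨ regroup n (n ^ r') D c₀ ⟩
        n * (n ^ r' * D * c₀)     ≤⟨ *-monoʳ-≤ n (≤-trans many edgeCount≤) ⟩
        n * ∑ (tuples n r) (λ e → ⟦ P? e ⟧) ∎
        where
        regroup : ∀ n x d c → n * x * d * c ≡ n * (x * d * c)
        regroup = solve-∀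

    edgeCount-bound : edgeCount H ^ (m * suc q) ≤ (c₀ * C₁) ^ (m * suc q) * n ^ (r * (m * suc q) ∸ suc q ∸ m)
    edgeCount-bound = finish r' n (edgeCount H) c₀ C₁ (suc D) n-pos (m≤n+m 1 _) below (power D refl)
      where
      open ≤-Reasoning
      instance
        _ = m^n≢0 n r'
        rr≢0 = m*n≢0 r r
        rrr≢0 = m*n≢0 (r * r) r
        rrrc≢0 = m*n≢0 (r * r * r) c
        c₀≢0 = m*n≢0 20 (r * r * r * c)
        b₀≢0 = m*n≢0 c₀ (n ^ r')
      b₀ = c₀ * n ^ r'
      -- The average codegree up to the constant `c₀`, rounded down; `below` pays for the rounding
      -- with `suc D`.
      D = edgeCount H / b₀
      X = n ^ (p * (9 * m))
      instance
        X≢0 = m^n≢0 n (p * (9 * m))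
      below : edgeCount H ≤ c₀ * n ^ r' * suc D
      below = begin
        edgeCount H                          ≡⟨ m≡m%n+[m/n]*n (edgeCount H) b₀ ⟩
        edgeCount H % b₀ + D * b₀              ≤⟨ +-monoˡ-≤ (D * b₀) (<⇒≤ (m%n<n (edgeCount H) b₀)) ⟩
        b₀ + D * b₀                            ≡⟨ *-comm (suc D) b₀ ⟩
        b₀ * suc D ∎
      power : ∀ d → d ≡ D → suc d ^ h ≤ C₁ * X
      -- With fewer than `b₀` edges nothing is known about the structure; the summand 1 in `C₁`
      -- handles this case.
      power zero _ = ≤-trans (≤-reflexive (^-zeroˡ h)) (*-mono-≤ (m≤n+m 1 (2 ^ h * (C₀ * 2 ^ (9 * m) + C₀ ^ h))) (m^n>0 n (p * (9 * m))))
      power d@(suc d') d≡D = begin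
        suc d ^ h                                              ≤⟨ ^-monoˡ-≤ h (≤-trans (+-monoˡ-≤ d (s≤s z≤n)) (≤-reflexive (cong (d +_) (sym (+-identityʳ d))))) ⟩
        (2 * d) ^ h                                            ≡⟨ ^-distribʳ-* h 2 d ⟩
        2 ^ h * d ^ h                                          ≤⟨ *-monoʳ-≤ (2 ^ h) (power-bound n d Q C₀ n-pos (density-bound d Q (s≤s z≤n) many n-small) small large) ⟩
        2 ^ h * ((C₀ * 2 ^ (9 * m) + C₀ ^ h) * X)              ≡⟨ *-assoc (2 ^ h) _ X ⟨
        2 ^ h * (C₀ * 2 ^ (9 * m) + C₀ ^ h) * X                ≤⟨ *-monoˡ-≤ X (m≤m+n (2 ^ h * (C₀ * 2 ^ (9 * m) + C₀ ^ h)) 1) ⟩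
        C₁ * X ∎
        where
        instance
          d^m≢0 = m^n≢0 d m
        -- Rounded up so that `n-small` holds. The excess costs a factor 2 when `d ^ m ≤ n ^ p`, and
        -- otherwise `Q` is 1.
        Q = suc (n ^ p / d ^ m)
        many : n ^ r' * d * c₀ ≤ edgeCount H
        many = ≤-trans (≤-reflexive (trans (cong (λ x → n ^ r' * x * c₀) d≡D) (regroup (n ^ r') D c₀))) (m/n*n≤m (edgeCount H) b₀)
          where
          regroup : ∀ x d c → x * d * c ≡ d * (c * x)
          regroup = solve-∀
        n-small : n ^ p ≤ Q * d ^ m
        n-small = begin
          n ^ p                                        ≡⟨ m≡m%n+[m/n]*n (n ^ p) (d ^ m) ⟩
          n ^ p % d ^ m + n ^ p / d ^ m * d ^ m        ≤⟨ +-monoˡ-≤ (n ^ p / d ^ m * d ^ m) (<⇒≤ (m%n<n (n ^ p) (d ^ m))) ⟩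
          Q * d ^ m ∎
        small : d ^ m ≤ n ^ p → Q * d ^ m ≤ 2 * n ^ p
        small le = ≤-trans (+-mono-≤ le (m/n*n≤m (n ^ p) (d ^ m))) (≤-reflexive (cong (n ^ p +_) (sym (+-identityʳ (n ^ p)))))
        large : n ^ p < d ^ m → Q ≤ 1
        large lt = ≤-reflexive (cong suc (m<n⇒m/n≡0 lt))

-- After taking roots of order `(s ∸ 1) * suc q` the exponent of `n` is r - 1/(s-1) - 1/(q+1). So ε
-- = 1/(q+1), and choosing `q` before `r` and `t` expresses that ε depends only on `s`.
theorem1p1 : (s : ℕ) → 3 ≤ s →
    Σ ℕ λ q →
    (r : ℕ) → 3 ≤ r → r % 2 ≡ 1 →
    (t : ℕ) → 1 ≤ t →
    Σ ℕ λ C →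
    (n : ℕ) → (H : Hypergraph r n) → ¬ ContainsK s t H →
    edgeCount H ^ ((s ∸ 1) * suc q)
    ≤ C ^ ((s ∸ 1) * suc q)
    * n ^ (r * ((s ∸ 1) * suc q) ∸ suc q ∸ (s ∸ 1))
theorem1p1 (suc (suc (suc m'))) (s≤s (s≤s (s≤s _))) = FinalArithmetic.q m' , bound
  where
  open FinalArithmetic m'
  bound : (r : ℕ) → 3 ≤ r → r % 2 ≡ 1 → (t : ℕ) → 1 ≤ t → Σ ℕ λ C → (n : ℕ) → (H : Hypergraph r n) → ¬ ContainsK (suc m) t H →
    edgeCount H ^ (m * suc q) ≤ C ^ (m * suc q) * n ^ (r * (m * suc q) ∸ suc q ∸ m)
  bound (suc r') 3≤r odd t t-pos = Turán.c₀ m' r' t 3≤r odd t-pos * Turán.C₁ m' r' t 3≤r odd t-pos , λ where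
    -- The right side may vanish for `n = 0`, so the count itself must be 0: there are no `r`-tuples
    -- over an empty vertex set.
    zero H _ → ≤-trans (≤-reflexive (cong (_^ (m * suc q)) (n≤0⇒n≡0 (FromHypergraph.edgeCount≤ H)))) z≤n
    (suc n) H K-free → Turán.edgeCount-bound m' r' t 3≤r odd t-pos H K-free (s≤s z≤n)
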